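{- Let $m$ be a positive integer divisible by $4$, and let $\Phi_m(x)$ denote the $m$th cyclotomic polynomial. Then for every complex $z\neq0$, $$\prod_{k=1}^\infty\Phi_m\left(\tfrac zk\right)=\frac{\delta(m)}{(-\pi z)^{\varphi(m)/2}}\prod_{\substack{1\le j\le \frac m2-1\\ \gcd(j,m)=1}}\sin\left(\pi ze^{2\pi ij/m}\right),$$ where $$\delta(m)=\begin{cases} i &\text{if } m=4;\\ -1&\text{if } m=8\text{ or } m=4p^\alpha \text{ with } p \text{ a prime},\ p\equiv3\pmod 4,\ \alpha\ge1;\\ 1&\text{otherwise.}\end{cases}$$
   Context: $\varphi$ is Euler's totient function. The infinite product denotes the limit of its partial products (the value $0$ is allowed). -}

module Defs where

open import Data.Integer.Base as ℤ using (+_; -[1+_]; +[1+_]; +0)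
import Data.Integer.Properties as ℤₚ
open import Data.List.Base using (List; map; upTo; filter; length; foldr)
open import Data.Nat.Base as ℕ using (ℕ; zero; suc; _!)
import Data.Nat.DivMod as ℕ using (_%_)
open import Data.Nat.GCD using (gcd)
open import Data.Nat.Primality using (Prime; prime?; prime⇒nonTrivial; prime⇒nonZero)
import Data.Nat.Properties as ℕₚ
open import Data.Product using (∃; _×_; _,_; proj₁; proj₂)
open import Data.Rational.Base
open import Data.Rational.Properties
open import Data.Rational.Solver using (module +-*-Solver)
import Data.Rational.Unnormalised.Base as ℚᵘ
import Data.Rational.Unnormalised.Properties as ℚᵘₚ
open import Data.Sum.Base using (_⊎_; inj₁; inj₂)
open import Relation.Binary.PropositionalEquality
open import Relation.Nullary using (Dec; yes; no; contradiction)
open import Relation.Nullary.Decidable using (map′; _×-dec_; _⊎-dec_)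

open +-*-Solver using (solve; _:+_; _:*_; :-_; _:-_; _:=_)

------------------------------------------------------------------------

-- Opaque, since unfolding the normalisation of fractions is very costly.
opaque
  fromℕ : ℕ → ℚ
  fromℕ n = + n / 1

  inv : (n : ℕ) .{{_ : ℕ.NonZero n}} → ℚ
  inv n = + 1 / n

recip : ℚ → ℚ
recip q with q ≟ 0ℚ
... | yes _   = 0ℚ
... | no  q≢0 = (1/ q) {{≢-nonZero q≢0}}

_^ℚ_ : ℚ → ℕ → ℚ
q ^ℚ zero  = 1ℚ
q ^ℚ suc n = q ^ℚ n * q

infixr 8 _^ℚ_

sumℚ : ℕ → (ℕ → ℚ) → ℚ
sumℚ zero    f = 0ℚ
sumℚ (suc n) f = sumℚ n f + f n

0≤1 : 0ℚ ≤ 1ℚ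
0≤1 = nonNegative⁻¹ 1ℚ

0<1 : 0ℚ < 1ℚ
0<1 = positive⁻¹ 1ℚ

0<½ : 0ℚ < ½
0<½ = positive⁻¹ ½

pos* : ∀ {p q} → 0ℚ < p → 0ℚ < q → 0ℚ < p * q
pos* {p} {q} a b = positive⁻¹ (p * q) {{pos*pos⇒pos p {{positive a}} q {{positive b}}}}

nonNeg* : ∀ {p q} → 0ℚ ≤ p → 0ℚ ≤ q → 0ℚ ≤ p * q
nonNeg* {p} {q} a b =
  nonNegative⁻¹ (p * q) {{nonNeg*nonNeg⇒nonNeg p {{nonNegative a}} q {{nonNegative b}}}}

nonNeg+ : ∀ {p q} → 0ℚ ≤ p → 0ℚ ≤ q → 0ℚ ≤ p + q
nonNeg+ {p} {q} a b = subst (_≤ p + q) (+-identityˡ 0ℚ) (+-mono-≤ a b)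

pos+ : ∀ {p q} → 0ℚ ≤ p → 0ℚ < q → 0ℚ < p + q
pos+ {p} {q} a b = subst (_< p + q) (+-identityˡ 0ℚ) (+-mono-≤-< a b)

*-monoˡ₀ : ∀ {a b} c → 0ℚ ≤ c → a ≤ b → c * a ≤ c * b
*-monoˡ₀ c 0≤c a≤b = *-monoˡ-≤-nonNeg c {{nonNegative 0≤c}} a≤b

*-monoʳ₀ : ∀ {a b} c → 0ℚ ≤ c → a ≤ b → a * c ≤ b * c
*-monoʳ₀ c 0≤c a≤b = *-monoʳ-≤-nonNeg c {{nonNegative 0≤c}} a≤b

*-mono₀ : ∀ {a b c d} → 0ℚ ≤ c → 0ℚ ≤ b → a ≤ b → c ≤ d → a * c ≤ b * d
*-mono₀ {b = b} {c = c} 0≤c 0≤b a≤b c≤d =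
  ≤-trans (*-monoʳ₀ c 0≤c a≤b) (*-monoˡ₀ b 0≤b c≤d)

p≤p+q : ∀ p {q} → 0ℚ ≤ q → p ≤ p + q
p≤p+q p {q} 0≤q = subst (_≤ p + q) (+-identityʳ p) (+-monoʳ-≤ p 0≤q)

q≤p+q : ∀ {p} q → 0ℚ ≤ p → q ≤ p + q
q≤p+q {p} q 0≤p = subst (q ≤_) (+-comm q p) (p≤p+q q 0≤p)

p-q≤p : ∀ p {q} → 0ℚ ≤ q → p - q ≤ p
p-q≤p p {q} 0≤q = subst (p - q ≤_) (+-identityʳ p) (+-monoʳ-≤ p (neg-antimono-≤ 0≤q))

0≤q-p : ∀ {p q} → p ≤ q → 0ℚ ≤ q - p
0≤q-p {p} {q} p≤q = subst (_≤ q - p) (+-inverseʳ p) (+-monoˡ-≤ (- p) p≤q)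

p+[q-p]≡q : ∀ p q → p + (q - p) ≡ q
p+[q-p]≡q p q = trans (+-comm p (q - p))
  (trans (+-assoc q (- p) p) (trans (cong (λ t → q + t) (+-inverseˡ p)) (+-identityʳ q)))

½+½ : ∀ p → ½ * p + ½ * p ≡ p
½+½ p = trans (sym (*-distribʳ-+ p ½ ½)) (*-identityˡ p)

∣∣-sym : ∀ p q → ∣ p - q ∣ ≡ ∣ q - p ∣
∣∣-sym p q = trans (sym (∣-p∣≡∣p∣ (p - q)))
  (cong ∣_∣ (solve 2 (λ p q → :- (p :- q) := q :- p) refl p q))

triangle : ∀ p q r → ∣ p - r ∣ ≤ ∣ p - q ∣ + ∣ q - r ∣
triangle p q r = subst (λ t → ∣ t ∣ ≤ ∣ p - q ∣ + ∣ q - r ∣)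
  (solve 3 (λ p q r → (p :- q) :+ (q :- r) := p :- r) refl p q r)
  (∣p+q∣≤∣p∣+∣q∣ (p - q) (q - r))

∣p∣≤∣p-q∣+∣q∣ : ∀ p q → ∣ p ∣ ≤ ∣ p - q ∣ + ∣ q ∣
∣p∣≤∣p-q∣+∣q∣ p q = subst (λ t → ∣ t ∣ ≤ ∣ p - q ∣ + ∣ q ∣)
  (solve 2 (λ p q → (p :- q) :+ q := p) refl p q) (∣p+q∣≤∣p∣+∣q∣ (p - q) q)

p≤∣p∣ : ∀ p → p ≤ ∣ p ∣
p≤∣p∣ p with ≤-total 0ℚ p
... | inj₁ 0≤p = ≤-reflexive (sym (0≤p⇒∣p∣≡p 0≤p))
... | inj₂ p≤0 = ≤-trans p≤0 (0≤∣p∣ p)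

∣∣-bound : ∀ {p b} → p ≤ b → - p ≤ b → ∣ p ∣ ≤ b
∣∣-bound {p} {b} p≤b -p≤b with ∣p∣≡p∨∣p∣≡-p p
... | inj₁ e = subst (_≤ b) (sym e) p≤b
... | inj₂ e = subst (_≤ b) (sym e) -p≤b

∣∣p∣-∣q∣∣≤ : ∀ p q → ∣ ∣ p ∣ - ∣ q ∣ ∣ ≤ ∣ p - q ∣
∣∣p∣-∣q∣∣≤ p q = ∣∣-bound (half p q)
  (subst₂ _≤_ (solve 2 (λ a b → b :- a := :- (a :- b)) refl (∣ p ∣) (∣ q ∣)) (∣∣-sym q p) (half q p))
  where
  half : ∀ p q → ∣ p ∣ - ∣ q ∣ ≤ ∣ p - q ∣
  half p q = subst (∣ p ∣ - ∣ q ∣ ≤_)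
    (solve 2 (λ a b → (a :+ b) :- b := a) refl (∣ p - q ∣) (∣ q ∣))
    (+-monoˡ-≤ (- ∣ q ∣) (∣p∣≤∣p-q∣+∣q∣ p q))

opaque
  unfolding fromℕ inv

  toℚᵘ-fromℕ : ∀ n → toℚᵘ (fromℕ n) ℚᵘ.≃ ℚᵘ.mkℚᵘ (+ n) 0
  toℚᵘ-fromℕ n = toℚᵘ-fromℚᵘ (ℚᵘ.mkℚᵘ (+ n) 0)

  toℚᵘ-inv : ∀ n → toℚᵘ (inv (suc n)) ℚᵘ.≃ ℚᵘ.mkℚᵘ (+ 1) n
  toℚᵘ-inv n = toℚᵘ-fromℚᵘ (ℚᵘ.mkℚᵘ (+ 1) n)

  0≤fromℕ : ∀ n → 0ℚ ≤ fromℕ n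
  0≤fromℕ n = nonNegative⁻¹ (+ n / 1) {{normalize-nonNeg n 1}}

  0<inv′ : ∀ n .{{_ : ℕ.NonZero n}} → 0ℚ < inv n
  0<inv′ n = positive⁻¹ (+ 1 / n) {{normalize-pos 1 n}}

  fromℕ-0 : fromℕ 0 ≡ 0ℚ
  fromℕ-0 = refl

  fromℕ-1 : fromℕ 1 ≡ 1ℚ
  fromℕ-1 = refl

  inv-1 : inv 1 ≡ 1ℚ
  inv-1 = refl

  inv-2 : inv 2 ≡ ½
  inv-2 = refl

  2*½ : fromℕ 2 * ½ ≡ 1ℚ
  2*½ = refl

  0<fromℕ4 : 0ℚ < fromℕ 4
  0<fromℕ4 = positive⁻¹ (+ 4 / 1)

fromℕ-+ : ∀ m n → fromℕ (m ℕ.+ n) ≡ fromℕ m + fromℕ n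
fromℕ-+ m n = toℚᵘ-injective (begin
  toℚᵘ (fromℕ (m ℕ.+ n))                   ≈⟨ toℚᵘ-fromℕ (m ℕ.+ n) ⟩
  ℚᵘ.mkℚᵘ (+ (m ℕ.+ n)) 0                  ≈⟨ ℚᵘ.*≡* (cong (ℤ._* + 1) (sym (cong₂ ℤ._+_ (ℤₚ.*-identityʳ (+ m)) (ℤₚ.*-identityʳ (+ n))))) ⟩
  ℚᵘ.mkℚᵘ (+ m) 0 ℚᵘ.+ ℚᵘ.mkℚᵘ (+ n) 0    ≈⟨ ℚᵘₚ.+-cong (ℚᵘₚ.≃-sym (toℚᵘ-fromℕ m)) (ℚᵘₚ.≃-sym (toℚᵘ-fromℕ n)) ⟩
  toℚᵘ (fromℕ m) ℚᵘ.+ toℚᵘ (fromℕ n)       ≈⟨ ℚᵘₚ.≃-sym (toℚᵘ-homo-+ (fromℕ m) (fromℕ n)) ⟩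
  toℚᵘ (fromℕ m + fromℕ n)                 ∎)
  where open ℚᵘₚ.≃-Reasoning

inv*fromℕ : ∀ n → inv (suc n) * fromℕ (suc n) ≡ 1ℚ
inv*fromℕ n = toℚᵘ-injective (begin
  toℚᵘ (inv (suc n) * fromℕ (suc n))             ≈⟨ toℚᵘ-homo-* (inv (suc n)) (fromℕ (suc n)) ⟩
  toℚᵘ (inv (suc n)) ℚᵘ.* toℚᵘ (fromℕ (suc n))   ≈⟨ ℚᵘₚ.*-cong (toℚᵘ-inv n) (toℚᵘ-fromℕ (suc n)) ⟩
  ℚᵘ.mkℚᵘ (+ 1) n ℚᵘ.* ℚᵘ.mkℚᵘ (+ suc n) 0       ≈⟨ ℚᵘ.*≡* (ℤₚ.*-assoc (+ 1) (+ suc n) (+ 1)) ⟩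
  toℚᵘ 1ℚ                                        ∎)
  where open ℚᵘₚ.≃-Reasoning

0<inv : ∀ n → 0ℚ < inv (suc n)
0<inv n = 0<inv′ (suc n)

0≤inv : ∀ n → 0ℚ ≤ inv (suc n)
0≤inv n = <⇒≤ (0<inv n)

fromℕ-mono : ∀ {m n} → m ℕ.≤ n → fromℕ m ≤ fromℕ n
fromℕ-mono {m} {n} m≤n = subst (fromℕ m ≤_)
  (trans (sym (fromℕ-+ m (n ℕ.∸ m))) (cong fromℕ (ℕₚ.m+[n∸m]≡n m≤n)))
  (p≤p+q (fromℕ m) (0≤fromℕ (n ℕ.∸ m)))

fromℕ-suc : ∀ n → fromℕ (suc n) ≡ 1ℚ + fromℕ n
fromℕ-suc n = trans (fromℕ-+ 1 n) (cong (_+ fromℕ n) fromℕ-1)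

fromℕ-* : ∀ m n → fromℕ (m ℕ.* n) ≡ fromℕ m * fromℕ n
fromℕ-* zero    n = trans fromℕ-0 (sym (trans (cong (_* fromℕ n) fromℕ-0) (*-zeroˡ (fromℕ n))))
fromℕ-* (suc m) n = begin
  fromℕ (n ℕ.+ m ℕ.* n)               ≡⟨ fromℕ-+ n (m ℕ.* n) ⟩
  fromℕ n + fromℕ (m ℕ.* n)           ≡⟨ cong₂ _+_ (sym (*-identityˡ (fromℕ n))) (fromℕ-* m n) ⟩
  1ℚ * fromℕ n + fromℕ m * fromℕ n    ≡⟨ sym (*-distribʳ-+ (fromℕ n) 1ℚ (fromℕ m)) ⟩
  (1ℚ + fromℕ m) * fromℕ n            ≡⟨ cong (_* fromℕ n) (sym (fromℕ-suc m)) ⟩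
  fromℕ (suc m) * fromℕ n             ∎
  where open ≡-Reasoning

inv-anti : ∀ {m n} → m ℕ.≤ n → inv (suc n) ≤ inv (suc m)
inv-anti {m} {n} m≤n = subst₂ _≤_ lhs rhs
  (*-monoʳ₀ (inv (suc m)) (0≤inv m)
    (*-monoˡ₀ (inv (suc n)) (0≤inv n) (fromℕ-mono (ℕ.s≤s m≤n))))
  where
  lhs : inv (suc n) * fromℕ (suc m) * inv (suc m) ≡ inv (suc n)
  lhs = trans (*-assoc (inv (suc n)) _ _)
    (trans (cong (inv (suc n) *_) (trans (*-comm (fromℕ (suc m)) (inv (suc m))) (inv*fromℕ m)))
           (*-identityʳ _))
  rhs : inv (suc n) * fromℕ (suc n) * inv (suc m) ≡ inv (suc m)
  rhs = trans (cong (_* inv (suc m)) (inv*fromℕ n)) (*-identityˡ _)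

inv-unique : ∀ {a b c} → a * c ≡ 1ℚ → b * c ≡ 1ℚ → a ≡ b
inv-unique {a} {b} {c} ac bc = begin
  a            ≡⟨ sym (*-identityʳ a) ⟩
  a * 1ℚ       ≡⟨ cong (a *_) (sym bc) ⟩
  a * (b * c)  ≡⟨ solve 3 (λ a b c → a :* (b :* c) := b :* (a :* c)) refl a b c ⟩
  b * (a * c)  ≡⟨ cong (b *_) ac ⟩
  b * 1ℚ       ≡⟨ *-identityʳ b ⟩
  b            ∎
  where open ≡-Reasoning

inv-* : ∀ m n .{{_ : ℕ.NonZero m}} .{{_ : ℕ.NonZero n}} .{{_ : ℕ.NonZero (m ℕ.* n)}} →
        inv (m ℕ.* n) ≡ inv m * inv n
inv-* (suc m) (suc n) = inv-unique {c = fromℕ (suc m ℕ.* suc n)} (inv*fromℕ (n ℕ.+ m ℕ.* suc n)) (begin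
  inv (suc m) * inv (suc n) * fromℕ (suc m ℕ.* suc n)
    ≡⟨ cong (inv (suc m) * inv (suc n) *_) (fromℕ-* (suc m) (suc n)) ⟩
  inv (suc m) * inv (suc n) * (fromℕ (suc m) * fromℕ (suc n))
    ≡⟨ solve 4 (λ a b c d → a :* b :* (c :* d) := (a :* c) :* (b :* d)) refl
         (inv (suc m)) (inv (suc n)) (fromℕ (suc m)) (fromℕ (suc n)) ⟩
  inv (suc m) * fromℕ (suc m) * (inv (suc n) * fromℕ (suc n))
    ≡⟨ cong₂ _*_ (inv*fromℕ m) (inv*fromℕ n) ⟩
  1ℚ * 1ℚ ∎)
  where open ≡-Reasoning

ceilℕ : ∀ q → ∃ λ b → ∣ q ∣ ≤ fromℕ b
ceilℕ (mkℚ n d c) = ℤ.∣ n ∣ , toℚᵘ-cancel-≤ (ℚᵘₚ.≤-respʳ-≃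
  (ℚᵘₚ.≃-sym (toℚᵘ-fromℕ ℤ.∣ n ∣))
  (ℚᵘ.*≤* (ℤₚ.*-monoˡ-≤-nonNeg (+ ℤ.∣ n ∣) (ℤ.+≤+ (ℕ.s≤s ℕ.z≤n)))))

floorInv : ∀ ε → 0ℚ < ε → ∃ λ d → inv (suc d) ≤ ε
floorInv ε@(mkℚ +[1+ k ] d c) _ = d , toℚᵘ-cancel-≤ (ℚᵘₚ.≤-respˡ-≃
  (ℚᵘₚ.≃-sym (toℚᵘ-inv d))
  (ℚᵘ.*≤* (ℤₚ.*-monoʳ-≤-nonNeg (+ suc d) {+ 1} {+[1+ k ]} (ℤ.+≤+ (ℕ.s≤s ℕ.z≤n)))))
floorInv (mkℚ +0 d c) (*<* (ℤ.+<+ ()))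
floorInv (mkℚ -[1+ k ] d c) (*<* ())

archimedes : ∀ C ε → 0ℚ < ε → ∃ λ j → C * inv (suc j) ≤ ε
archimedes C ε 0<ε with ceilℕ C | floorInv ε 0<ε
... | b , ∣C∣≤b | d , d≤ε = d ℕ.+ b ℕ.* suc d , (begin
  C * inv (suc b ℕ.* suc d)               ≡⟨ cong (C *_) (inv-* (suc b) (suc d)) ⟩
  C * (inv (suc b) * inv (suc d))         ≡⟨ sym (*-assoc C (inv (suc b)) (inv (suc d))) ⟩
  C * inv (suc b) * inv (suc d)
    ≤⟨ *-monoʳ₀ (inv (suc d)) (0≤inv d) (*-monoʳ₀ (inv (suc b)) (0≤inv b)
         (≤-trans (p≤∣p∣ C) (≤-trans ∣C∣≤b (fromℕ-mono (ℕₚ.n≤1+n b))))) ⟩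
  fromℕ (suc b) * inv (suc b) * inv (suc d)
    ≡⟨ cong (_* inv (suc d)) (trans (*-comm (fromℕ (suc b)) (inv (suc b))) (inv*fromℕ b)) ⟩
  1ℚ * inv (suc d)                        ≡⟨ *-identityˡ (inv (suc d)) ⟩
  inv (suc d)                             ≤⟨ d≤ε ⟩
  ε                                       ∎)
  where open ≤-Reasoning

0<½^ : ∀ j → 0ℚ < ½ ^ℚ j
0<½^ zero    = 0<1
0<½^ (suc j) = pos* (0<½^ j) 0<½

½^≤inv : ∀ j → ½ ^ℚ j ≤ inv (suc j)
½^≤inv zero    = ≤-reflexive (sym inv-1)
½^≤inv (suc j) = ≤-trans (*-monoʳ₀ {½ ^ℚ j} {inv (suc j)} ½ (<⇒≤ 0<½) (½^≤inv j))
  (subst (_≤ inv (suc (suc j))) (trans (inv-* (suc j) 2) (cong (inv (suc j) *_) inv-2))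
    (inv-anti {suc j} {suc (j ℕ.* 2)} (ℕ.s≤s (ℕₚ.m≤m*n j 2))))

nullSeq : ∀ C → 0ℚ ≤ C → ∀ ε → 0ℚ < ε → ∃ λ j → C * ½ ^ℚ j ≤ ε
nullSeq C 0≤C ε 0<ε =
  let j , le = archimedes C ε 0<ε
  in  j , ≤-trans (*-monoˡ₀ {½ ^ℚ j} {inv (suc j)} C 0≤C (½^≤inv j)) le

recip* : ∀ {q} → 0ℚ < q → recip q * q ≡ 1ℚ
recip* {q} 0<q with q ≟ 0ℚ
... | yes refl = contradiction refl (<⇒≢ 0<q)
... | no  q≢0  = *-inverseˡ q {{≢-nonZero q≢0}}

0<recip : ∀ {q} → 0ℚ < q → 0ℚ < recip q
0<recip {q} 0<q with q ≟ 0ℚ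
... | yes refl = contradiction refl (<⇒≢ 0<q)
... | no  q≢0  = positive⁻¹ _ {{1/pos⇒pos q {{positive 0<q}}}}

recip-anti : ∀ {p q} → 0ℚ < p → p ≤ q → recip q ≤ recip p
recip-anti {p} {q} 0<p p≤q = subst₂ _≤_ lhs rhs
  (*-monoʳ₀ {recip q * p} {recip q * q} (recip p) (<⇒≤ (0<recip 0<p))
    (*-monoˡ₀ {p} {q} (recip q) (<⇒≤ (0<recip 0<q)) p≤q))
  where
  0<q : 0ℚ < q
  0<q = <-≤-trans 0<p p≤q
  lhs : recip q * p * recip p ≡ recip q
  lhs = trans (*-assoc (recip q) p (recip p))
    (trans (cong (recip q *_) (trans (*-comm p (recip p)) (recip* 0<p))) (*-identityʳ (recip q)))
  rhs : recip q * q * recip p ≡ recip p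
  rhs = trans (cong (_* recip p) (recip* 0<q)) (*-identityˡ (recip p))

------------------------------------------------------------------------

IsCauchy : (ℕ → ℚ) → Set
IsCauchy s = ∀ ε → 0ℚ < ε →
  ∃ λ N → ∀ m n → N ℕ.≤ m → N ℕ.≤ n → ∣ s m - s n ∣ ≤ ε

-- Sequences whose difference tends to 0 represent the same real.  This
-- equality is not named, since convergence is stated through _<ʳ_, which
-- respects it.
record ℝ : Set where
  constructor mkℝ
  field
    seq    : ℕ → ℚ
    cauchy : IsCauchy seq

open ℝ public

scaleCauchy : ∀ s C → 0ℚ < C →
  (∀ ε → 0ℚ < ε → ∃ λ N → ∀ m n → N ℕ.≤ m → N ℕ.≤ n → ∣ s m - s n ∣ ≤ C * ε) →
  IsCauchy s
scaleCauchy s C 0<C h ε 0<ε with h (recip C * ε) (pos* (0<recip 0<C) 0<ε)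
... | N , le = N , λ m n N≤m N≤n → subst (∣ s m - s n ∣ ≤_) eq (le m n N≤m N≤n)
  where
  eq : C * (recip C * ε) ≡ ε
  eq = trans (sym (*-assoc C (recip C) ε))
    (trans (cong (_* ε) (trans (*-comm C (recip C)) (recip* 0<C))) (*-identityˡ ε))

2* : ∀ ε → ε + ε ≡ (1ℚ + 1ℚ) * ε
2* ε = trans (sym (cong₂ _+_ (*-identityˡ ε) (*-identityˡ ε))) (sym (*-distribʳ-+ ε 1ℚ 1ℚ))

≤⊔ˡ : ∀ {M N m} → M ℕ.⊔ N ℕ.≤ m → M ℕ.≤ m
≤⊔ˡ {M} {N} = ℕₚ.≤-trans (ℕₚ.m≤m⊔n M N)

≤⊔ʳ : ∀ {M N m} → M ℕ.⊔ N ℕ.≤ m → N ℕ.≤ m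
≤⊔ʳ {M} {N} = ℕₚ.≤-trans (ℕₚ.m≤n⊔m M N)

+-cauchy : ∀ s t → IsCauchy s → IsCauchy t → IsCauchy (λ n → s n + t n)
+-cauchy s t cs ct = scaleCauchy (λ n → s n + t n) (1ℚ + 1ℚ) (positive⁻¹ (1ℚ + 1ℚ)) go
  where
  go : ∀ ε → 0ℚ < ε → ∃ λ N → ∀ m n → N ℕ.≤ m → N ℕ.≤ n →
       ∣ (s m + t m) - (s n + t n) ∣ ≤ (1ℚ + 1ℚ) * ε
  go ε 0<ε with cs ε 0<ε | ct ε 0<ε
  ... | M , hM | N , hN = M ℕ.⊔ N , λ m n p q → begin
    ∣ (s m + t m) - (s n + t n) ∣
      ≡⟨ cong ∣_∣ (solve 4 (λ a b c d → (a :+ b) :- (c :+ d) := (a :- c) :+ (b :- d)) refl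
           (s m) (t m) (s n) (t n)) ⟩
    ∣ (s m - s n) + (t m - t n) ∣    ≤⟨ ∣p+q∣≤∣p∣+∣q∣ (s m - s n) (t m - t n) ⟩
    ∣ s m - s n ∣ + ∣ t m - t n ∣
      ≤⟨ +-mono-≤ (hM m n (≤⊔ˡ p) (≤⊔ˡ q)) (hN m n (≤⊔ʳ {M} p) (≤⊔ʳ {M} q)) ⟩
    ε + ε                            ≡⟨ 2* ε ⟩
    (1ℚ + 1ℚ) * ε                    ∎
    where open ≤-Reasoning

neg-cauchy : ∀ s → IsCauchy s → IsCauchy (λ n → - s n)
neg-cauchy s cs ε 0<ε with cs ε 0<ε
... | N , h = N , λ m n p q → subst (_≤ ε)
  (trans (∣∣-sym (s m) (s n))
    (cong ∣_∣ (solve 2 (λ a b → b :- a := (:- a) :- (:- b)) refl (s m) (s n))))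
  (h m n p q)

abs-cauchy : ∀ s → IsCauchy s → IsCauchy (λ n → ∣ s n ∣)
abs-cauchy s cs ε 0<ε with cs ε 0<ε
... | N , h = N , λ m n p q → ≤-trans (∣∣p∣-∣q∣∣≤ (s m) (s n)) (h m n p q)

const-cauchy : ∀ q → IsCauchy (λ _ → q)
const-cauchy q ε 0<ε = 0 , λ _ _ _ _ →
  subst (λ t → ∣ t ∣ ≤ ε) (sym (+-inverseʳ q)) (<⇒≤ 0<ε)

sumAbs : (ℕ → ℚ) → ℕ → ℚ
sumAbs s n = sumℚ n (λ k → ∣ s k ∣)

sumAbs-nonNeg : ∀ s n → 0ℚ ≤ sumAbs s n
sumAbs-nonNeg s zero    = ≤-refl
sumAbs-nonNeg s (suc n) = nonNeg+ (sumAbs-nonNeg s n) (0≤∣p∣ (s n))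

≤sumAbs : ∀ s {k n} → k ℕ.< n → ∣ s k ∣ ≤ sumAbs s n
≤sumAbs s {k} {suc n} (ℕ.s≤s k≤n) with ℕₚ.m≤n⇒m<n∨m≡n k≤n
... | inj₁ k<n  = ≤-trans (≤sumAbs s k<n) (p≤p+q (sumAbs s n) (0≤∣p∣ (s n)))
... | inj₂ refl = q≤p+q (∣ s n ∣) (sumAbs-nonNeg s n)

bounded : ∀ s → IsCauchy s → ∃ λ B → 0ℚ < B × (∀ n → ∣ s n ∣ ≤ B)
bounded s cs with cs 1ℚ 0<1
... | N , h = S + (1ℚ + ∣ s N ∣) , pos+ {S} {1ℚ + ∣ s N ∣} 0≤S 0<R , bound
  where
  S : ℚ
  S = sumAbs s N
  0≤S : 0ℚ ≤ S
  0≤S = sumAbs-nonNeg s N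
  0<R : 0ℚ < 1ℚ + ∣ s N ∣
  0<R = <-≤-trans 0<1 (p≤p+q 1ℚ (0≤∣p∣ (s N)))
  bound : ∀ n → ∣ s n ∣ ≤ S + (1ℚ + ∣ s N ∣)
  bound n with ℕₚ.<-≤-connex n N
  ... | inj₁ n<N = ≤-trans (≤sumAbs s n<N) (p≤p+q S (<⇒≤ 0<R))
  ... | inj₂ N≤n = ≤-trans
    (≤-trans (∣p∣≤∣p-q∣+∣q∣ (s n) (s N)) (+-monoˡ-≤ ∣ s N ∣ (h n N N≤n ℕₚ.≤-refl)))
    (q≤p+q {S} (1ℚ + ∣ s N ∣) 0≤S)

*-cauchy : ∀ s t → IsCauchy s → IsCauchy t → IsCauchy (λ n → s n * t n)
*-cauchy s t cs ct with bounded s cs | bounded t ct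
... | B , 0<B , hB | D , 0<D , hD = scaleCauchy (λ n → s n * t n) (B + D) (pos+ (<⇒≤ 0<B) 0<D) go
  where
  go : ∀ ε → 0ℚ < ε → ∃ λ N → ∀ m n → N ℕ.≤ m → N ℕ.≤ n →
       ∣ s m * t m - s n * t n ∣ ≤ (B + D) * ε
  go ε 0<ε with cs ε 0<ε | ct ε 0<ε
  ... | M , hM | N , hN = M ℕ.⊔ N , λ m n p q → begin
    ∣ s m * t m - s n * t n ∣
      ≡⟨ cong ∣_∣ (solve 4 (λ a b c d → a :* b :- c :* d := a :* (b :- d) :+ d :* (a :- c)) refl
           (s m) (t m) (s n) (t n)) ⟩
    ∣ s m * (t m - t n) + t n * (s m - s n) ∣
      ≤⟨ ∣p+q∣≤∣p∣+∣q∣ (s m * (t m - t n)) (t n * (s m - s n)) ⟩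
    ∣ s m * (t m - t n) ∣ + ∣ t n * (s m - s n) ∣
      ≡⟨ cong₂ _+_ (∣p*q∣≡∣p∣*∣q∣ (s m) (t m - t n)) (∣p*q∣≡∣p∣*∣q∣ (t n) (s m - s n)) ⟩
    ∣ s m ∣ * ∣ t m - t n ∣ + ∣ t n ∣ * ∣ s m - s n ∣
      ≤⟨ +-mono-≤ (*-mono₀ {∣ s m ∣} {B} {∣ t m - t n ∣} {ε} (0≤∣p∣ (t m - t n)) (<⇒≤ 0<B) (hB m) (hN m n (≤⊔ʳ {M} p) (≤⊔ʳ {M} q)))
                  (*-mono₀ {∣ t n ∣} {D} {∣ s m - s n ∣} {ε} (0≤∣p∣ (s m - s n)) (<⇒≤ 0<D) (hD n) (hM m n (≤⊔ˡ p) (≤⊔ˡ q))) ⟩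
    B * ε + D * ε    ≡⟨ sym (*-distribʳ-+ ε B D) ⟩
    (B + D) * ε      ∎
    where open ≤-Reasoning

infix  8 -ʳ_
infixl 7 _*ʳ_
infixl 6 _+ʳ_ _-ʳ_
infix  4 _<ʳ_

ofℚ : ℚ → ℝ
ofℚ q = mkℝ (λ _ → q) (const-cauchy q)

0ʳ 1ʳ : ℝ
0ʳ = ofℚ 0ℚ
1ʳ = ofℚ 1ℚ

-ʳ_ ∣_∣ʳ : ℝ → ℝ
-ʳ_ x = mkℝ (λ n → - seq x n) (neg-cauchy (seq x) (cauchy x))
∣ x ∣ʳ = mkℝ (λ n → ∣ seq x n ∣) (abs-cauchy (seq x) (cauchy x))

_+ʳ_ _-ʳ_ _*ʳ_ : ℝ → ℝ → ℝ
x +ʳ y = mkℝ (λ n → seq x n + seq y n) (+-cauchy (seq x) (seq y) (cauchy x) (cauchy y))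
x -ʳ y = x +ʳ (-ʳ y)
x *ʳ y = mkℝ (λ n → seq x n * seq y n) (*-cauchy (seq x) (seq y) (cauchy x) (cauchy y))

_<ʳ_ : ℝ → ℝ → Set
x <ʳ y = ∃ λ ε → 0ℚ < ε × ∃ λ N → ∀ n → N ℕ.≤ n → seq x n + ε ≤ seq y n

recip-cauchy : ∀ x → 0ʳ <ʳ x → IsCauchy (λ n → recip (seq x n))
recip-cauchy x (ε , 0<ε , N , h) =
  scaleCauchy (λ n → recip (seq x n)) (recip ε * recip ε) (pos* (0<recip 0<ε) (0<recip 0<ε)) go
  where
  s = seq x
  ε≤ : ∀ {n} → N ℕ.≤ n → ε ≤ s n
  ε≤ {n} N≤n = subst (_≤ s n) (+-identityˡ ε) (h n N≤n)
  0<s : ∀ {n} → N ℕ.≤ n → 0ℚ < s n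
  0<s N≤n = <-≤-trans 0<ε (ε≤ N≤n)
  r≤ : ∀ {n} → N ℕ.≤ n → ∣ recip (s n) ∣ ≤ recip ε
  r≤ N≤n = subst (_≤ recip ε) (sym (0≤p⇒∣p∣≡p (<⇒≤ (0<recip (0<s N≤n)))))
    (recip-anti 0<ε (ε≤ N≤n))
  diff : ∀ a b c d → a * b ≡ 1ℚ → c * d ≡ 1ℚ → a - c ≡ a * c * (d - b)
  diff a b c d ab cd = sym (begin
    a * c * (d - b)
      ≡⟨ solve 4 (λ a b c d → a :* c :* (d :- b) := a :* (c :* d) :- c :* (a :* b)) refl a b c d ⟩
    a * (c * d) - c * (a * b)    ≡⟨ cong₂ (λ u v → a * u - c * v) cd ab ⟩
    a * 1ℚ - c * 1ℚ              ≡⟨ cong₂ _-_ (*-identityʳ a) (*-identityʳ c) ⟩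
    a - c                        ∎)
    where open ≡-Reasoning
  go : ∀ δ → 0ℚ < δ → ∃ λ K → ∀ m n → K ℕ.≤ m → K ℕ.≤ n →
       ∣ recip (s m) - recip (s n) ∣ ≤ recip ε * recip ε * δ
  go δ 0<δ with cauchy x δ 0<δ
  ... | M , hM = N ℕ.⊔ M , λ m n p q → begin
    ∣ recip (s m) - recip (s n) ∣
      ≡⟨ cong ∣_∣ (diff (recip (s m)) (s m) (recip (s n)) (s n) (recip* (0<s (≤⊔ˡ p))) (recip* (0<s (≤⊔ˡ q)))) ⟩
    ∣ recip (s m) * recip (s n) * (s n - s m) ∣
      ≡⟨ trans (∣p*q∣≡∣p∣*∣q∣ (recip (s m) * recip (s n)) (s n - s m))
               (cong (_* ∣ s n - s m ∣) (∣p*q∣≡∣p∣*∣q∣ (recip (s m)) (recip (s n)))) ⟩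
    ∣ recip (s m) ∣ * ∣ recip (s n) ∣ * ∣ s n - s m ∣
      ≤⟨ *-mono₀ {∣ recip (s m) ∣ * ∣ recip (s n) ∣} {recip ε * recip ε} {∣ s n - s m ∣} {δ}
           (0≤∣p∣ (s n - s m)) (<⇒≤ (pos* (0<recip 0<ε) (0<recip 0<ε)))
           (*-mono₀ {∣ recip (s m) ∣} {recip ε} {∣ recip (s n) ∣} {recip ε} (0≤∣p∣ (recip (s n))) (<⇒≤ (0<recip 0<ε)) (r≤ (≤⊔ˡ p)) (r≤ (≤⊔ˡ q)))
           (hM n m (≤⊔ʳ {N} q) (≤⊔ʳ {N} p)) ⟩
    recip ε * recip ε * δ ∎
    where open ≤-Reasoning

recipʳ : (x : ℝ) → 0ʳ <ʳ x → ℝ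
recipʳ x 0<x = mkℝ (λ n → recip (seq x n)) (recip-cauchy x 0<x)

IsCauchyʳ : (ℕ → ℝ) → Set
IsCauchyʳ x = ∀ ε → 0ℚ < ε →
  ∃ λ N → ∀ m n → N ℕ.≤ m → N ℕ.≤ n → ∣ x m -ʳ x n ∣ʳ <ʳ ofℚ ε

modulus : ℝ → ℕ → ℕ
modulus x n = proj₁ (cauchy x (inv (suc n)) (0<inv n))

diagonal : (ℕ → ℝ) → ℕ → ℚ
diagonal x n = seq (x n) (modulus (x n) n)

diagonal-close : ∀ x n k → modulus (x n) n ℕ.≤ k →
                 ∣ diagonal x n - seq (x n) k ∣ ≤ inv (suc n)
diagonal-close x n k le =
  proj₂ (cauchy (x n) (inv (suc n)) (0<inv n)) _ k ℕₚ.≤-refl le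

diagonal-cauchy : ∀ x → IsCauchyʳ x → IsCauchy (diagonal x)
diagonal-cauchy x cx = scaleCauchy (diagonal x) (1ℚ + 1ℚ + 1ℚ) (positive⁻¹ (1ℚ + 1ℚ + 1ℚ)) go
  where
  go : ∀ ε → 0ℚ < ε → ∃ λ N → ∀ m n → N ℕ.≤ m → N ℕ.≤ n →
       ∣ diagonal x m - diagonal x n ∣ ≤ (1ℚ + 1ℚ + 1ℚ) * ε
  go ε 0<ε with floorInv ε 0<ε | cx ε 0<ε
  ... | D , D≤ε | N , h = D ℕ.⊔ N , close
    where
    near : ∀ n k → D ℕ.≤ n → modulus (x n) n ℕ.≤ k → ∣ diagonal x n - seq (x n) k ∣ ≤ ε
    near n k D≤n le = ≤-trans (diagonal-close x n k le) (≤-trans (inv-anti D≤n) D≤ε)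
    close : ∀ m n → D ℕ.⊔ N ℕ.≤ m → D ℕ.⊔ N ℕ.≤ n →
            ∣ diagonal x m - diagonal x n ∣ ≤ (1ℚ + 1ℚ + 1ℚ) * ε
    close m n p q with h m n (≤⊔ʳ {D} p) (≤⊔ʳ {D} q)
    ... | δ , 0<δ , K , hK = begin
      ∣ diagonal x m - diagonal x n ∣
        ≤⟨ triangle (diagonal x m) (seq (x n) k) (diagonal x n) ⟩
      ∣ diagonal x m - seq (x n) k ∣ + ∣ seq (x n) k - diagonal x n ∣
        ≤⟨ +-mono-≤ (triangle (diagonal x m) (seq (x m) k) (seq (x n) k))
                    (≤-reflexive (∣∣-sym (seq (x n) k) (diagonal x n))) ⟩
      ∣ diagonal x m - seq (x m) k ∣ + ∣ seq (x m) k - seq (x n) k ∣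
        + ∣ diagonal x n - seq (x n) k ∣
        ≤⟨ +-mono-≤ (+-mono-≤
             (near m k (≤⊔ˡ p) (ℕₚ.≤-trans (ℕₚ.m≤m⊔n Mm Mn) (ℕₚ.m≤m⊔n _ K)))
             (≤-trans (p≤p+q _ (<⇒≤ 0<δ)) (hK k (ℕₚ.m≤n⊔m (Mm ℕ.⊔ Mn) K))))
             (near n k (≤⊔ˡ q) (ℕₚ.≤-trans (ℕₚ.m≤n⊔m Mm Mn) (ℕₚ.m≤m⊔n _ K))) ⟩
      ε + ε + ε
        ≡⟨ sym (trans (*-distribʳ-+ ε (1ℚ + 1ℚ) 1ℚ)
             (cong₂ _+_ (sym (2* ε)) (*-identityˡ ε))) ⟩
      (1ℚ + 1ℚ + 1ℚ) * ε ∎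
      where
      open ≤-Reasoning
      Mm = modulus (x m) m
      Mn = modulus (x n) n
      k = Mm ℕ.⊔ Mn ℕ.⊔ K

lim : (x : ℕ → ℝ) → IsCauchyʳ x → ℝ
lim x cx = mkℝ (diagonal x) (diagonal-cauchy x cx)

telescope : ∀ (s u : ℕ → ℚ) N → (∀ n → 0ℚ ≤ u n) →
  (∀ n → N ℕ.≤ n → ∣ s (suc n) - s n ∣ ≤ u n - u (suc n)) →
  ∀ n k → N ℕ.≤ n → ∣ s (n ℕ.+ k) - s n ∣ ≤ u n - u (n ℕ.+ k)
telescope s u N 0≤u h n zero N≤n rewrite ℕₚ.+-identityʳ n =
  ≤-reflexive (trans (cong ∣_∣ (+-inverseʳ (s n))) (sym (+-inverseʳ (u n))))
telescope s u N 0≤u h n (suc k) N≤n rewrite ℕₚ.+-suc n k = begin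
  ∣ s (suc (n ℕ.+ k)) - s n ∣
    ≤⟨ triangle (s (suc (n ℕ.+ k))) (s (n ℕ.+ k)) (s n) ⟩
  ∣ s (suc (n ℕ.+ k)) - s (n ℕ.+ k) ∣ + ∣ s (n ℕ.+ k) - s n ∣
    ≤⟨ +-mono-≤ (h (n ℕ.+ k) (ℕₚ.m≤n⇒m≤n+o k N≤n)) (telescope s u N 0≤u h n k N≤n) ⟩
  (u (n ℕ.+ k) - u (suc (n ℕ.+ k))) + (u n - u (n ℕ.+ k))
    ≡⟨ solve 3 (λ a b c → (a :- b) :+ (c :- a) := c :- b) refl
         (u (n ℕ.+ k)) (u (suc (n ℕ.+ k))) (u n) ⟩
  u n - u (suc (n ℕ.+ k)) ∎
  where open ≤-Reasoning

telescope₂ : ∀ (s u : ℕ → ℚ) N → (∀ n → 0ℚ ≤ u n) →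
  (∀ n → N ℕ.≤ n → ∣ s (suc n) - s n ∣ ≤ u n - u (suc n)) →
  ∀ K → N ℕ.≤ K → ∀ m n → K ℕ.≤ m → K ℕ.≤ n → ∣ s m - s n ∣ ≤ u K + u K
telescope₂ s u N 0≤u h K N≤K m n K≤m K≤n =
  ≤-trans (triangle (s m) (s K) (s n))
    (+-mono-≤ (one K≤m) (subst (_≤ u K) (∣∣-sym (s n) (s K)) (one K≤n)))
  where
  one : ∀ {m} → K ℕ.≤ m → ∣ s m - s K ∣ ≤ u K
  one {m} K≤m = subst (λ j → ∣ s j - s K ∣ ≤ u K) (ℕₚ.m+[n∸m]≡n K≤m)
    (≤-trans (telescope s u N 0≤u h K (m ℕ.∸ K) N≤K) (p-q≤p (u K) (0≤u _)))

------------------------------------------------------------------------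

record ℂ : Set where
  constructor mkℂ
  field
    re im : ℝ

open ℂ public

infix  8 -ᶜ_
infixr 8 _^ᶜ_
infixl 7 _*ᶜ_ _•_
infixl 6 _+ᶜ_ _-ᶜ_
infix  4 _#0

ofℝ : ℝ → ℂ
ofℝ x = mkℂ x 0ʳ

0ᶜ 1ᶜ 𝕚 : ℂ
0ᶜ = ofℝ 0ʳ
1ᶜ = ofℝ 1ʳ
𝕚  = mkℂ 0ʳ 1ʳ

-ᶜ_ : ℂ → ℂ
-ᶜ_ z = mkℂ (-ʳ re z) (-ʳ im z)

_+ᶜ_ _-ᶜ_ _*ᶜ_ : ℂ → ℂ → ℂ
z +ᶜ w = mkℂ (re z +ʳ re w) (im z +ʳ im w)
z -ᶜ w = z +ᶜ (-ᶜ w)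
z *ᶜ w = mkℂ (re z *ʳ re w -ʳ im z *ʳ im w) (re z *ʳ im w +ʳ im z *ʳ re w)

_•_ : ℚ → ℂ → ℂ
q • z = mkℂ (ofℚ q *ʳ re z) (ofℚ q *ʳ im z)

_^ᶜ_ : ℂ → ℕ → ℂ
z ^ᶜ zero  = 1ᶜ
z ^ᶜ suc n = z ^ᶜ n *ᶜ z

∣_∣² : ℂ → ℝ
∣ z ∣² = re z *ʳ re z +ʳ im z *ʳ im z

-- z ≠ 0 in the positive (apartness) sense, which is what division needs.
_#0 : ℂ → Set
z #0 = 0ʳ <ʳ ∣ z ∣²

recipᶜ : (z : ℂ) → z #0 → ℂ
recipᶜ z z#0 = mkℂ (re z *ʳ r) ((-ʳ im z) *ʳ r)
  where r = recipʳ ∣ z ∣² z#0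

_÷ᶜ_[_] : ℂ → (w : ℂ) → w #0 → ℂ
z ÷ᶜ w [ w#0 ] = z *ᶜ recipᶜ w w#0

-- Convergence in modulus, with ∣ x n − L ∣ < ε written in squared form.
_⟶_ : (ℕ → ℂ) → ℂ → Set
x ⟶ L = ∀ ε → 0ℚ < ε → ∃ λ N → ∀ n → N ℕ.≤ n → ∣ x n -ᶜ L ∣² <ʳ ofℚ (ε * ε)

infix 4 _⟶_

limᶜ : (x : ℕ → ℂ) → IsCauchyʳ (λ n → re (x n)) → IsCauchyʳ (λ n → im (x n)) → ℂ
limᶜ x cr ci = mkℂ (lim (λ n → re (x n)) cr) (lim (λ n → im (x n)) ci)

∏ : List ℕ → (ℕ → ℂ) → ℂ
∏ js f = foldr (λ j w → f j *ᶜ w) 1ᶜ js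

partialProduct : ((k : ℕ) → .{{ℕ.NonZero k}} → ℂ) → ℕ → ℂ
partialProduct f zero    = 1ᶜ
partialProduct f (suc n) = partialProduct f n *ᶜ f (suc n)

-- ∏_{k=1}^∞ f k = L, with the limit 0 and vanishing factors allowed.
InfiniteProduct : ((k : ℕ) → .{{ℕ.NonZero k}} → ℂ) → ℂ → Set
InfiniteProduct f L = partialProduct f ⟶ L

------------------------------------------------------------------------

expTerm : ℂ → ℕ → ℂ
expTerm z n = inv (n !) {{n ℕₚ.!≢0}} • z ^ᶜ n

expPartial : ℂ → ℕ → ℂ
expPartial z zero    = 0ᶜ
expPartial z (suc n) = expPartial z n +ᶜ expTerm z n

-- ℓ¹ norm of the k-th rational approximation of z
norm : ℂ → ℕ → ℚ
norm z k = ∣ seq (re z) k ∣ + ∣ seq (im z) k ∣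

0≤norm : ∀ z k → 0ℚ ≤ norm z k
0≤norm z k = nonNeg+ (0≤∣p∣ (seq (re z) k)) (0≤∣p∣ (seq (im z) k))

norm-* : ∀ z w k → norm (z *ᶜ w) k ≤ norm z k * norm w k
norm-* z w k = begin
  ∣ a * c - b * d ∣ + ∣ a * d + b * c ∣
    ≤⟨ +-mono-≤ (∣p-q∣≤∣p∣+∣q∣ (a * c) (b * d)) (∣p+q∣≤∣p∣+∣q∣ (a * d) (b * c)) ⟩
  (∣ a * c ∣ + ∣ b * d ∣) + (∣ a * d ∣ + ∣ b * c ∣)
    ≡⟨ cong₂ _+_ (cong₂ _+_ (∣p*q∣≡∣p∣*∣q∣ a c) (∣p*q∣≡∣p∣*∣q∣ b d))
                 (cong₂ _+_ (∣p*q∣≡∣p∣*∣q∣ a d) (∣p*q∣≡∣p∣*∣q∣ b c)) ⟩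
  (∣ a ∣ * ∣ c ∣ + ∣ b ∣ * ∣ d ∣) + (∣ a ∣ * ∣ d ∣ + ∣ b ∣ * ∣ c ∣)
    ≡⟨ solve 4 (λ a b c d → (a :* c :+ b :* d) :+ (a :* d :+ b :* c) := (a :+ b) :* (c :+ d))
         refl (∣ a ∣) (∣ b ∣) (∣ c ∣) (∣ d ∣) ⟩
  (∣ a ∣ + ∣ b ∣) * (∣ c ∣ + ∣ d ∣) ∎
  where
  open ≤-Reasoning
  a = seq (re z) k
  b = seq (im z) k
  c = seq (re w) k
  d = seq (im w) k

norm-• : ∀ q z k → 0ℚ ≤ q → norm (q • z) k ≡ q * norm z k
norm-• q z k 0≤q = begin
  ∣ q * a ∣ + ∣ q * b ∣             ≡⟨ cong₂ _+_ (∣p*q∣≡∣p∣*∣q∣ q a) (∣p*q∣≡∣p∣*∣q∣ q b) ⟩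
  ∣ q ∣ * ∣ a ∣ + ∣ q ∣ * ∣ b ∣     ≡⟨ sym (*-distribˡ-+ (∣ q ∣) (∣ a ∣) (∣ b ∣)) ⟩
  ∣ q ∣ * (∣ a ∣ + ∣ b ∣)           ≡⟨ cong (_* (∣ a ∣ + ∣ b ∣)) (0≤p⇒∣p∣≡p 0≤q) ⟩
  q * (∣ a ∣ + ∣ b ∣)               ∎
  where
  open ≡-Reasoning
  a = seq (re z) k
  b = seq (im z) k

norm-bounded : ∀ z → ∃ λ b → ∀ k → norm z k ≤ fromℕ b
norm-bounded z with bounded (seq (re z)) (cauchy (re z)) | bounded (seq (im z)) (cauchy (im z))
... | B , _ , hB | D , _ , hD with ceilℕ (B + D)
... | b , le = b , λ k → ≤-trans (+-mono-≤ (hB k) (hD k)) (≤-trans (p≤∣p∣ (B + D)) le)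

module ExpCauchy (z : ℂ) where
  b : ℕ
  b = proj₁ (norm-bounded z)

  B : ℚ
  B = fromℕ b

  0≤B : 0ℚ ≤ B
  0≤B = 0≤fromℕ b

  t : ℕ → ℚ
  t zero    = 1ℚ
  t (suc n) = t n * (B * inv (suc n))

  0≤t : ∀ n → 0ℚ ≤ t n
  0≤t zero    = 0≤1
  0≤t (suc n) = nonNeg* (0≤t n) (nonNeg* 0≤B (0≤inv n))

  0≤inv! : ∀ n → 0ℚ ≤ inv (n !) {{n ℕₚ.!≢0}}
  0≤inv! n = <⇒≤ (0<inv′ (n !) {{n ℕₚ.!≢0}})

  inv! : ∀ n → inv (suc n !) {{suc n ℕₚ.!≢0}} ≡ inv (suc n) * inv (n !) {{n ℕₚ.!≢0}}
  inv! n = inv-* (suc n) (n !) {{_}} {{n ℕₚ.!≢0}} {{suc n ℕₚ.!≢0}}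

  pow-bound : ∀ n k → inv (n !) {{n ℕₚ.!≢0}} * norm (z ^ᶜ n) k ≤ t n
  pow-bound zero    k = ≤-reflexive (cong (_* 1ℚ) inv-1)
  pow-bound (suc n) k = begin
    i′ * norm (z ^ᶜ n *ᶜ z) k                 ≤⟨ *-monoˡ₀ i′ (0≤inv! (suc n)) (norm-* (z ^ᶜ n) z k) ⟩
    i′ * (norm (z ^ᶜ n) k * norm z k)         ≡⟨ cong (_* (norm (z ^ᶜ n) k * norm z k)) (inv! n) ⟩
    inv (suc n) * i * (norm (z ^ᶜ n) k * norm z k)
      ≡⟨ solve 4 (λ p i x y → p :* i :* (x :* y) := (i :* x) :* (y :* p)) refl
           (inv (suc n)) i (norm (z ^ᶜ n) k) (norm z k) ⟩
    i * norm (z ^ᶜ n) k * (norm z k * inv (suc n))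
      ≤⟨ *-mono₀ {i * norm (z ^ᶜ n) k} {t n} {norm z k * inv (suc n)} {B * inv (suc n)}
           (nonNeg* (0≤norm z k) (0≤inv n)) (0≤t n) (pow-bound n k)
           (*-monoʳ₀ (inv (suc n)) (0≤inv n) (proj₂ (norm-bounded z) k)) ⟩
    t n * (B * inv (suc n)) ∎
    where
    open ≤-Reasoning
    i  = inv (n !) {{n ℕₚ.!≢0}}
    i′ = inv (suc n !) {{suc n ℕₚ.!≢0}}

  term-bound : ∀ n k → norm (expTerm z n) k ≤ t n
  term-bound n k = subst (_≤ t n) (sym (norm-• (inv (n !) {{n ℕₚ.!≢0}}) (z ^ᶜ n) k (0≤inv! n))) (pow-bound n k)

  N₀ : ℕ
  N₀ = b ℕ.+ b

  ratio : ∀ n → N₀ ℕ.≤ n → B * inv (suc n) ≤ ½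
  ratio n le = begin
    B * inv (suc n)                        ≡⟨ cong (_* inv (suc n)) (sym (½+½ B)) ⟩
    (½ * B + ½ * B) * inv (suc n)          ≡⟨ cong (_* inv (suc n)) (sym (*-distribˡ-+ ½ B B)) ⟩
    ½ * (B + B) * inv (suc n)
      ≤⟨ *-monoʳ₀ (inv (suc n)) (0≤inv n) (*-monoˡ₀ ½ (<⇒≤ 0<½)
           (subst (_≤ fromℕ (suc n)) (fromℕ-+ b b) (fromℕ-mono (ℕₚ.m≤n⇒m≤1+n le)))) ⟩
    ½ * fromℕ (suc n) * inv (suc n)        ≡⟨ *-assoc ½ (fromℕ (suc n)) (inv (suc n)) ⟩
    ½ * (fromℕ (suc n) * inv (suc n))      ≡⟨ cong (½ *_) (trans (*-comm (fromℕ (suc n)) (inv (suc n))) (inv*fromℕ n)) ⟩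
    ½ * 1ℚ                                 ≡⟨ *-identityʳ ½ ⟩
    ½                                      ∎
    where open ≤-Reasoning

  t-halves : ∀ n → N₀ ℕ.≤ n → t (suc n) ≤ t n * ½
  t-halves n le = *-monoˡ₀ (t n) (0≤t n) (ratio n le)

  u : ℕ → ℚ
  u n = t n + t n

  0≤u : ∀ n → 0ℚ ≤ u n
  0≤u n = nonNeg+ (0≤t n) (0≤t n)

  t≤u-u : ∀ n → N₀ ℕ.≤ n → t n ≤ u n - u (suc n)
  t≤u-u n le = begin
    t n                                  ≡⟨ solve 1 (λ x → x := (x :+ x) :- x) refl (t n) ⟩
    (t n + t n) - t n                    ≡⟨ cong (λ y → (t n + t n) - y)
                                              (sym (trans (cong₂ _+_ (*-comm (t n) ½) (*-comm (t n) ½)) (½+½ (t n)))) ⟩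
    (t n + t n) - (t n * ½ + t n * ½)
      ≤⟨ +-monoʳ-≤ (t n + t n) (neg-antimono-≤ (+-mono-≤ (t-halves n le) (t-halves n le))) ⟩
    u n - u (suc n)                      ∎
    where open ≤-Reasoning

  t-decay : ∀ j → t (N₀ ℕ.+ j) ≤ t N₀ * ½ ^ℚ j
  t-decay zero rewrite ℕₚ.+-identityʳ N₀ = ≤-reflexive (sym (*-identityʳ (t N₀)))
  t-decay (suc j) rewrite ℕₚ.+-suc N₀ j = begin
    t (suc (N₀ ℕ.+ j))        ≤⟨ t-halves (N₀ ℕ.+ j) (ℕₚ.m≤m+n N₀ j) ⟩
    t (N₀ ℕ.+ j) * ½          ≤⟨ *-monoʳ₀ ½ (<⇒≤ 0<½) (t-decay j) ⟩
    t N₀ * ½ ^ℚ j * ½         ≡⟨ *-assoc (t N₀) (½ ^ℚ j) ½ ⟩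
    t N₀ * (½ ^ℚ j * ½)       ∎
    where open ≤-Reasoning

  module Part (part : ℂ → ℝ)
              (part-+ : ∀ z w k → seq (part (z +ᶜ w)) k ≡ seq (part z) k + seq (part w) k)
              (part≤ : ∀ z k → ∣ seq (part z) k ∣ ≤ norm z k) where

    step : ∀ k n → N₀ ℕ.≤ n →
           ∣ seq (part (expPartial z (suc n))) k - seq (part (expPartial z n)) k ∣ ≤ u n - u (suc n)
    step k n le = subst (λ x → ∣ x ∣ ≤ u n - u (suc n))
      (sym (trans (cong (_- seq (part (expPartial z n)) k) (part-+ (expPartial z n) (expTerm z n) k))
        (solve 2 (λ a c → (a :+ c) :- a := c) refl
           (seq (part (expPartial z n)) k) (seq (part (expTerm z n)) k))))
      (≤-trans (part≤ (expTerm z n) k) (≤-trans (term-bound n k) (t≤u-u n le)))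

    isCauchy : IsCauchyʳ (λ n → part (expPartial z n))
    isCauchy ε 0<ε =
      let j , le = nullSeq (t N₀) (0≤t N₀) (½ * (½ * (½ * ε)))
                     (pos* 0<½ (pos* 0<½ (pos* 0<½ 0<ε)))
      in  N₀ ℕ.+ j , λ m n K≤m K≤n →
          ½ * ε , pos* 0<½ 0<ε , 0 , λ k _ → bound j le m n K≤m K≤n k
      where
      bound : ∀ j → t N₀ * ½ ^ℚ j ≤ ½ * (½ * (½ * ε)) →
              ∀ m n → N₀ ℕ.+ j ℕ.≤ m → N₀ ℕ.+ j ℕ.≤ n → ∀ k →
              ∣ seq (part (expPartial z m)) k - seq (part (expPartial z n)) k ∣ + ½ * ε ≤ ε
      bound j le m n K≤m K≤n k = begin
        ∣ seq (part (expPartial z m)) k - seq (part (expPartial z n)) k ∣ + ½ * ε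
          ≤⟨ +-monoˡ-≤ (½ * ε) (telescope₂ (λ n → seq (part (expPartial z n)) k) u N₀ 0≤u (step k)
               K (ℕₚ.m≤m+n N₀ j) m n K≤m K≤n) ⟩
        u K + u K + ½ * ε                     ≤⟨ +-monoˡ-≤ (½ * ε) (+-mono-≤ u≤ u≤) ⟩
        ½ * (½ * ε) + ½ * (½ * ε) + ½ * ε     ≡⟨ cong (_+ ½ * ε) (½+½ (½ * ε)) ⟩
        ½ * ε + ½ * ε                         ≡⟨ ½+½ ε ⟩
        ε                                     ∎
        where
        open ≤-Reasoning
        K : ℕ
        K = N₀ ℕ.+ j
        t≤ : t K ≤ ½ * (½ * (½ * ε))
        t≤ = ≤-trans (t-decay j) le
        u≤ : u K ≤ ½ * (½ * ε)
        u≤ = subst (u K ≤_) (½+½ (½ * (½ * ε))) (+-mono-≤ t≤ t≤)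

  re-cauchy : IsCauchyʳ (λ n → re (expPartial z n))
  re-cauchy = Part.isCauchy re (λ _ _ _ → refl) (λ z k → p≤p+q (∣ seq (re z) k ∣) (0≤∣p∣ (seq (im z) k)))

  im-cauchy : IsCauchyʳ (λ n → im (expPartial z n))
  im-cauchy = Part.isCauchy im (λ _ _ _ → refl) (λ z k → q≤p+q (∣ seq (im z) k ∣) (0≤∣p∣ (seq (re z) k)))

exp : ℂ → ℂ
exp z = limᶜ (expPartial z) (ExpCauchy.re-cauchy z) (ExpCauchy.im-cauchy z)

-- sin z = (e^{iz} − e^{−iz}) / 2i, where 1 / 2i = − i / 2
sin : ℂ → ℂ
sin z = (-½ • 𝕚) *ᶜ (exp (𝕚 *ᶜ z) -ᶜ exp (-ᶜ (𝕚 *ᶜ z)))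

------------------------------------------------------------------------
-- π is 4 ∫₀¹ dx / (1 + x²), as the limit of the left Riemann sums over the
-- partitions of [0,1] into 2ⁿ equal parts

πIntegrand : ℚ → ℚ
πIntegrand x = fromℕ 4 * recip (1ℚ + x * x)

πSum : ℕ → ℚ
πSum n = ½ ^ℚ n * sumℚ (2 ℕ.^ n) (λ k → πIntegrand (fromℕ k * ½ ^ℚ n))

square-nonNeg : ∀ x → 0ℚ ≤ x * x
square-nonNeg x = subst (0ℚ ≤_) eq (nonNeg* (0≤∣p∣ x) (0≤∣p∣ x))
  where
  eq : ∣ x ∣ * ∣ x ∣ ≡ x * x
  eq = trans (sym (∣p*q∣≡∣p∣*∣q∣ x x)) (lem (∣p∣≡p∨∣p∣≡-p x))
    where
    lem : ∣ x ∣ ≡ x ⊎ ∣ x ∣ ≡ - x → ∣ x * x ∣ ≡ x * x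
    lem (inj₁ e) = trans (∣p*q∣≡∣p∣*∣q∣ x x) (cong₂ _*_ e e)
    lem (inj₂ e) = trans (∣p*q∣≡∣p∣*∣q∣ x x)
      (trans (cong₂ _*_ e e) (solve 1 (λ x → (:- x) :* (:- x) := x :* x) refl x))

0<1+x² : ∀ x → 0ℚ < 1ℚ + x * x
0<1+x² x = <-≤-trans 0<1 (p≤p+q 1ℚ (square-nonNeg x))

0≤f : ∀ x → 0ℚ ≤ πIntegrand x
0≤f x = nonNeg* (0≤fromℕ 4) (<⇒≤ (0<recip (0<1+x² x)))

f≤4 : ∀ x → πIntegrand x ≤ fromℕ 4
f≤4 x = subst (πIntegrand x ≤_) (*-identityʳ (fromℕ 4))
  (*-monoˡ₀ (fromℕ 4) (0≤fromℕ 4) (recip-anti 0<1 (p≤p+q 1ℚ (square-nonNeg x))))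

f-anti : ∀ {x y} → 0ℚ ≤ x → x ≤ y → πIntegrand y ≤ πIntegrand x
f-anti {x} {y} 0≤x x≤y = *-monoˡ₀ (fromℕ 4) (0≤fromℕ 4) (recip-anti (0<1+x² x)
  (+-monoʳ-≤ 1ℚ (*-mono₀ 0≤x (≤-trans 0≤x x≤y) x≤y x≤y)))

module Refine (n : ℕ) where
  h h′ : ℚ
  h  = ½ ^ℚ n
  h′ = ½ ^ℚ suc n

  0≤h′ : 0ℚ ≤ h′
  0≤h′ = <⇒≤ (0<½^ (suc n))

  a b : ℕ → ℚ
  a k = πIntegrand (fromℕ k * h)
  b k = πIntegrand (fromℕ k * h′)

  b2k : ∀ k → b (2 ℕ.* k) ≡ a k
  b2k k = cong πIntegrand (begin
    fromℕ (2 ℕ.* k) * (h * ½)           ≡⟨ cong (_* (h * ½)) (fromℕ-* 2 k) ⟩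
    fromℕ 2 * fromℕ k * (h * ½)
      ≡⟨ solve 4 (λ t x y z → t :* x :* (y :* z) := (t :* z) :* (x :* y)) refl (fromℕ 2) (fromℕ k) h ½ ⟩
    fromℕ 2 * ½ * (fromℕ k * h)         ≡⟨ cong (_* (fromℕ k * h)) 2*½ ⟩
    1ℚ * (fromℕ k * h)                  ≡⟨ *-identityˡ _ ⟩
    fromℕ k * h                         ∎)
    where open ≡-Reasoning

  b-anti : ∀ k → b (suc k) ≤ b k
  b-anti k = f-anti (nonNeg* (0≤fromℕ k) 0≤h′) (*-monoʳ₀ h′ 0≤h′ (fromℕ-mono (ℕₚ.n≤1+n k)))

  D : ℕ → ℚ
  D K = (sumℚ K a + sumℚ K a) - sumℚ (2 ℕ.* K) b

  D-suc : ∀ K → D (suc K) ≡ D K + (a K - b (suc (2 ℕ.* K)))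
  D-suc K = begin
    S′ + S′ - sumℚ (2 ℕ.* suc K) b                 ≡⟨ cong (λ j → S′ + S′ - sumℚ j b) (ℕₚ.*-suc 2 K) ⟩
    S′ + S′ - (T + b (2 ℕ.* K) + y)                ≡⟨ cong (λ x → S′ + S′ - (T + x + y)) (b2k K) ⟩
    (S + a K) + (S + a K) - (T + a K + y)
      ≡⟨ solve 4 (λ s x t y → ((s :+ x) :+ (s :+ x)) :- ((t :+ x) :+ y) := ((s :+ s) :- t) :+ (x :- y))
           refl S (a K) T y ⟩
    D K + (a K - y)                                ∎
    where
    open ≡-Reasoning
    S S′ T y : ℚ
    S  = sumℚ K a
    S′ = sumℚ (suc K) a
    T  = sumℚ (2 ℕ.* K) b
    y  = b (suc (2 ℕ.* K))

  upper : ∀ K → b (suc (2 ℕ.* K)) ≤ a K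
  upper K = subst (b (suc (2 ℕ.* K)) ≤_) (b2k K) (b-anti (2 ℕ.* K))

  lower : ∀ K → a (suc K) ≤ b (suc (2 ℕ.* K))
  lower K = subst (_≤ b (suc (2 ℕ.* K)))
    (trans (cong b (sym (ℕₚ.*-suc 2 K))) (b2k (suc K))) (b-anti (suc (2 ℕ.* K)))

  0≤D : ∀ K → 0ℚ ≤ D K
  0≤D zero    = ≤-refl
  0≤D (suc K) = subst (0ℚ ≤_) (sym (D-suc K)) (nonNeg+ (0≤D K) (0≤q-p (upper K)))

  D≤ : ∀ K → D K ≤ a 0 - a K
  D≤ zero    = ≤-reflexive (sym (+-inverseʳ (a 0)))
  D≤ (suc K) = begin
    D (suc K)                                ≡⟨ D-suc K ⟩
    D K + (a K - b (suc (2 ℕ.* K)))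
      ≤⟨ +-mono-≤ (D≤ K) (+-monoʳ-≤ (a K) (neg-antimono-≤ (lower K))) ⟩
    (a 0 - a K) + (a K - a (suc K))
      ≡⟨ solve 3 (λ x y z → (x :- y) :+ (y :- z) := x :- z) refl (a 0) (a K) (a (suc K)) ⟩
    a 0 - a (suc K)                          ∎
    where open ≤-Reasoning

  D≤4 : ∀ K → D K ≤ fromℕ 4
  D≤4 K = ≤-trans (D≤ K) (≤-trans (p-q≤p (a 0) (0≤f (fromℕ K * h))) (f≤4 (fromℕ 0 * h)))

  diff : πSum n - πSum (suc n) ≡ h′ * D (2 ℕ.^ n)
  diff = begin
    h * S - h * ½ * T
      ≡⟨ cong (λ x → h * x - h * ½ * T) (sym (½+½ S)) ⟩
    h * (½ * S + ½ * S) - h * ½ * T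
      ≡⟨ solve 4 (λ h e s t → h :* (e :* s :+ e :* s) :- h :* e :* t := (h :* e) :* ((s :+ s) :- t))
           refl h ½ S T ⟩
    h * ½ * ((S + S) - T) ∎
    where
    open ≡-Reasoning
    S = sumℚ (2 ℕ.^ n) a
    T = sumℚ (2 ℕ.^ suc n) b

πu : ℕ → ℚ
πu n = ½ ^ℚ n * fromℕ 4

0≤πu : ∀ n → 0ℚ ≤ πu n
0≤πu n = nonNeg* (<⇒≤ (0<½^ n)) (0≤fromℕ 4)

πstep : ∀ n → 0 ℕ.≤ n → ∣ πSum (suc n) - πSum n ∣ ≤ πu n - πu (suc n)
πstep n _ = begin
  ∣ πSum (suc n) - πSum n ∣      ≡⟨ ∣∣-sym (πSum (suc n)) (πSum n) ⟩
  ∣ πSum n - πSum (suc n) ∣      ≡⟨ cong ∣_∣ diff ⟩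
  ∣ h′ * D (2 ℕ.^ n) ∣           ≡⟨ 0≤p⇒∣p∣≡p (nonNeg* 0≤h′ (0≤D (2 ℕ.^ n))) ⟩
  h′ * D (2 ℕ.^ n)               ≤⟨ *-monoˡ₀ h′ 0≤h′ (D≤4 (2 ℕ.^ n)) ⟩
  h * ½ * fromℕ 4
    ≡⟨ solve 3 (λ h e f → h :* e :* f := (e :* (h :* f) :+ e :* (h :* f)) :- h :* e :* f) refl h ½ (fromℕ 4) ⟩
  (½ * πu n + ½ * πu n) - πu (suc n)  ≡⟨ cong (_- πu (suc n)) (½+½ (πu n)) ⟩
  πu n - πu (suc n)              ∎
  where
  open ≤-Reasoning
  open Refine n

π-cauchy : IsCauchy πSum
π-cauchy ε 0<ε =
  let K , le = nullSeq (fromℕ 4) (0≤fromℕ 4) (½ * ε) (pos* 0<½ 0<ε)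
  in  K , λ m n K≤m K≤n → ≤-trans
        (telescope₂ πSum πu 0 0≤πu πstep K ℕ.z≤n m n K≤m K≤n)
        (bound K le)
  where
  bound : ∀ K → fromℕ 4 * ½ ^ℚ K ≤ ½ * ε → πu K + πu K ≤ ε
  bound K le = subst (πu K + πu K ≤_) (½+½ ε) (+-mono-≤ u≤ u≤)
    where
    u≤ : πu K ≤ ½ * ε
    u≤ = subst (_≤ ½ * ε) (*-comm (fromℕ 4) (½ ^ℚ K)) le

π : ℝ
π = mkℝ πSum π-cauchy

πᶜ : ℂ
πᶜ = ofℝ π

sum-≥ : ∀ c g K → (∀ k → k ℕ.< K → c ≤ g k) → fromℕ K * c ≤ sumℚ K g
sum-≥ c g zero    h = ≤-reflexive (trans (cong (_* c) fromℕ-0) (*-zeroˡ c))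
sum-≥ c g (suc K) h = begin
  fromℕ (suc K) * c            ≡⟨ cong (_* c) (trans (fromℕ-suc K) (+-comm 1ℚ (fromℕ K))) ⟩
  (fromℕ K + 1ℚ) * c           ≡⟨ *-distribʳ-+ c (fromℕ K) 1ℚ ⟩
  fromℕ K * c + 1ℚ * c         ≡⟨ cong (λ x → fromℕ K * c + x) (*-identityˡ c) ⟩
  fromℕ K * c + c              ≤⟨ +-mono-≤ (sum-≥ c g K λ k k<K → h k (ℕₚ.m<n⇒m<1+n k<K)) (h K ℕₚ.≤-refl) ⟩
  sumℚ K g + g K               ∎
  where open ≤-Reasoning

2^*½^ : ∀ n → fromℕ (2 ℕ.^ n) * ½ ^ℚ n ≡ 1ℚ
2^*½^ zero    = trans (cong (_* 1ℚ) fromℕ-1) (*-identityˡ 1ℚ)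
2^*½^ (suc n) = begin
  fromℕ (2 ℕ.* 2 ℕ.^ n) * (½ ^ℚ n * ½)         ≡⟨ cong (_* (½ ^ℚ n * ½)) (fromℕ-* 2 (2 ℕ.^ n)) ⟩
  fromℕ 2 * fromℕ (2 ℕ.^ n) * (½ ^ℚ n * ½)
    ≡⟨ solve 4 (λ t x y z → t :* x :* (y :* z) := (t :* z) :* (x :* y)) refl
         (fromℕ 2) (fromℕ (2 ℕ.^ n)) (½ ^ℚ n) ½ ⟩
  fromℕ 2 * ½ * (fromℕ (2 ℕ.^ n) * ½ ^ℚ n)     ≡⟨ cong (_* (fromℕ (2 ℕ.^ n) * ½ ^ℚ n)) 2*½ ⟩
  1ℚ * (fromℕ (2 ℕ.^ n) * ½ ^ℚ n)              ≡⟨ trans (*-identityˡ _) (2^*½^ n) ⟩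
  1ℚ                                           ∎
  where open ≡-Reasoning

πSum-≥ : ∀ n → πIntegrand 1ℚ ≤ πSum n
πSum-≥ n = begin
  c                                  ≡⟨ sym (*-identityˡ c) ⟩
  1ℚ * c                             ≡⟨ cong (_* c) (sym (trans (*-comm (½ ^ℚ n) _) (2^*½^ n))) ⟩
  ½ ^ℚ n * fromℕ (2 ℕ.^ n) * c       ≡⟨ *-assoc (½ ^ℚ n) _ c ⟩
  ½ ^ℚ n * (fromℕ (2 ℕ.^ n) * c)
    ≤⟨ *-monoˡ₀ (½ ^ℚ n) 0≤h (sum-≥ c _ (2 ℕ.^ n) λ k k<K →
         f-anti (nonNeg* (0≤fromℕ k) 0≤h)
           (subst (fromℕ k * ½ ^ℚ n ≤_) (2^*½^ n)
             (*-monoʳ₀ (½ ^ℚ n) 0≤h (fromℕ-mono (ℕₚ.<⇒≤ k<K))))) ⟩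
  πSum n                             ∎
  where
  open ≤-Reasoning
  c = πIntegrand 1ℚ
  0≤h = <⇒≤ (0<½^ n)

0<π : 0ʳ <ʳ π
0<π = c , pos* 0<fromℕ4 (0<recip (0<1+x² 1ℚ)) , 0 ,
  λ n _ → subst (_≤ πSum n) (sym (+-identityˡ c)) (πSum-≥ n)
  where c = πIntegrand 1ℚ

*-pos : ∀ {x y z} → (∀ n → seq x n * seq y n ≡ seq z n) → 0ʳ <ʳ x → 0ʳ <ʳ y → 0ʳ <ʳ z
*-pos {x} {y} {z} eq (ε , 0<ε , M , hM) (δ , 0<δ , N , hN) =
  ε * δ , pos* 0<ε 0<δ , M ℕ.⊔ N , λ n p →
    let ε≤x = subst (_≤ seq x n) (+-identityˡ ε) (hM n (≤⊔ˡ p))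
        δ≤y = subst (_≤ seq y n) (+-identityˡ δ) (hN n (≤⊔ʳ {M} p))
    in  subst₂ _≤_ (sym (+-identityˡ (ε * δ))) (eq n)
          (*-mono₀ {ε} {seq x n} {δ} {seq y n} (<⇒≤ 0<δ) (≤-trans (<⇒≤ 0<ε) ε≤x) ε≤x δ≤y)

1#0 : 1ᶜ #0
1#0 = 1ℚ , 0<1 , 0 , λ _ _ → ≤-refl

π#0 : πᶜ #0
π#0 = *-pos {π} {π} {∣ πᶜ ∣²} (λ n → sym (+-identityʳ (πSum n * πSum n))) 0<π 0<π

neg#0 : ∀ {z} → z #0 → (-ᶜ z) #0
neg#0 {z} (ε , 0<ε , N , h) = ε , 0<ε , N , λ n N≤n → subst (0ℚ + ε ≤_)
  (solve 2 (λ a b → a :* a :+ b :* b := (:- a) :* (:- a) :+ (:- b) :* (:- b)) refl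
    (seq (re z) n) (seq (im z) n))
  (h n N≤n)

*#0 : ∀ {z w} → z #0 → w #0 → (z *ᶜ w) #0
*#0 {z} {w} = *-pos {∣ z ∣²} {∣ w ∣²} {∣ z *ᶜ w ∣²} λ n →
  solve 4 (λ a b c d → (a :* a :+ b :* b) :* (c :* c :+ d :* d)
      := (a :* c :- b :* d) :* (a :* c :- b :* d) :+ (a :* d :+ b :* c) :* (a :* d :+ b :* c)) refl
    (seq (re z) n) (seq (im z) n) (seq (re w) n) (seq (im w) n)

^#0 : ∀ {z} n → z #0 → (z ^ᶜ n) #0
^#0     zero    z#0 = 1#0
^#0 {z} (suc n) z#0 = *#0 {z ^ᶜ n} {z} (^#0 {z} n z#0) z#0

------------------------------------------------------------------------

coprimesUpTo : ℕ → ℕ → List ℕ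
coprimesUpTo n m = filter (λ j → gcd j m ℕₚ.≟ 1) (map suc (upTo n))

φ : ℕ → ℕ
φ m = length (coprimesUpTo m m)

-- e^{2πij/m}
rootOfUnity : (m : ℕ) .{{_ : ℕ.NonZero m}} → ℕ → ℂ
rootOfUnity m j = exp ((fromℕ (2 ℕ.* j) * inv m) • (πᶜ *ᶜ 𝕚))

Φ : (m : ℕ) .{{_ : ℕ.NonZero m}} → ℂ → ℂ
Φ m x = ∏ (coprimesUpTo m m) λ j → x -ᶜ rootOfUnity m j

Exceptional : ℕ → Set
Exceptional m = m ≡ 8 ⊎
  ∃ λ p → ∃ λ α → Prime p × p ℕ.% 4 ≡ 3 × 1 ℕ.≤ α × m ≡ 4 ℕ.* p ℕ.^ α

exceptional? : ∀ m → Dec (Exceptional m)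
exceptional? m = (m ℕₚ.≟ 8) ⊎-dec map′ forget bound
  (ℕₚ.anyUpTo? (λ p → ℕₚ.anyUpTo? (λ α →
    prime? p ×-dec (p ℕ.% 4 ℕₚ.≟ 3) ×-dec (1 ℕₚ.≤? α) ×-dec (m ℕₚ.≟ 4 ℕ.* p ℕ.^ α))
    (suc m)) (suc m))
  where
  P : ℕ → ℕ → Set
  P p α = Prime p × p ℕ.% 4 ≡ 3 × 1 ℕ.≤ α × m ≡ 4 ℕ.* p ℕ.^ α

  forget : (∃ λ p → p ℕ.< suc m × ∃ λ α → α ℕ.< suc m × P p α) → ∃ λ p → ∃ λ α → P p α
  forget (p , _ , α , _ , h) = p , α , h

  α<p^α : ∀ {p} → 1 ℕ.< p → ∀ α → α ℕ.< p ℕ.^ α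
  α<p^α 1<p zero = ℕ.s≤s ℕ.z≤n
  α<p^α {p} 1<p (suc α) = begin-strict
    suc α              ≤⟨ ih ⟩
    p ℕ.^ α            <⟨ ℕₚ.m<m*n (p ℕ.^ α) p {{ℕ.>-nonZero (ℕₚ.≤-<-trans ℕ.z≤n ih)}} 1<p ⟩
    p ℕ.^ α ℕ.* p      ≡⟨ ℕₚ.*-comm (p ℕ.^ α) p ⟩
    p ℕ.* p ℕ.^ α      ∎
    where
    open ℕₚ.≤-Reasoning
    ih = α<p^α 1<p α

  bound : (∃ λ p → ∃ λ α → P p α) → ∃ λ p → p ℕ.< suc m × ∃ λ α → α ℕ.< suc m × P p α
  bound (p , suc α , p-prime , p%4 , 1≤α , refl) =
    p , ℕ.s≤s (ℕₚ.≤-trans p≤p^α p^α≤m) ,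
    suc α , ℕ.s≤s (ℕₚ.≤-trans (ℕₚ.<⇒≤ (α<p^α 1<p (suc α))) p^α≤m) ,
    p-prime , p%4 , 1≤α , refl
    where
    1<p = ℕ.nonTrivial⇒n>1 p {{prime⇒nonTrivial p-prime}}
    p≤p^α = ℕₚ.m≤m*n p (p ℕ.^ α) {{ℕₚ.m^n≢0 p α {{prime⇒nonZero p-prime}}}}
    p^α≤m = ℕₚ.m≤n*m (p ℕ.^ suc α) 4

δ : ℕ → ℂ
δ m with m ℕₚ.≟ 4
... | yes _ = 𝕚
... | no  _ with exceptional? m
...   | yes _ = -ᶜ 1ᶜ
...   | no  _ = 1ᶜ

-- Pairing the residues j and j + m/2, and then j and m/2 − j, turns Φ_m(z/k) into the product of the factors
-- 1 − (zωʲ/k)² over the j < m/2 prime to m, where ω = e^{2πi/m}.  So the theorem is Euler's product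
-- sin πw = πw ∏ (1 − w²/k²) at the points w = zωʲ, together with δ(m) = ∏ ωʲ.  For m > 4 the factors of the latter
-- pair off to −1, so that it is (−1)^{φ(m)/4}, and the parity of φ(m)/4 is found from φ(d) ∣ φ(m) for d ∣ m.
--
-- Euler's product is the limit of sin x = N sin (x/N) cos (x/N) ∏_{0<k<N/2} (1 − sin² (x/N) / sin² (kπ/N)) along the
-- powers N of 2, where the identity follows from the duplication formula alone; the factors are dominated by 1 + C/k².
-- The number π enters only through e^{iπ/2} = i: the Riemann sums that define π are the exponents of an Euler scheme
-- for the curve (1 + ix)/(1 − ix), which leads from 1 to i.
--
-- All estimates are rational upper bounds ∥ z ∥≤ q for the ℓ¹ norm of a complex number.

module Submission where

open import Algebra.Bundles using (CommutativeRing)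
import Algebra.Solver.Ring as RingSolver
open import Algebra.Solver.Ring.AlmostCommutativeRing using (fromCommutativeRing; _-Raw-AlmostCommutative⟶_)
open import Data.List.Base using (List; []; _∷_; _++_; map; upTo; filter; length)
import Data.List.Properties as Listₚ
open import Data.List.Relation.Unary.All using (All; []; _∷_)
open import Data.Maybe.Base using (Maybe; just; nothing)
open import Data.Nat.Base as ℕ using (ℕ; zero; suc; NonZero; _∸_; _/_; _!)
import Data.Nat.Coprimality as Coprimality
import Data.Nat.DivMod as DivMod
open import Data.Nat.Divisibility using (_∣_)
import Data.Nat.Divisibility as ∣ₚ
open import Data.Nat.GCD using (gcd)
open import Data.Nat.ListAction using (product)
open import Data.Nat.Primality using (Prime; prime[2]; euclidsLemma; prime⇒irreducible; prime⇒nonZero; ¬prime[1])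
open import Data.Nat.Primality.Factorisation using (PrimeFactorisation; factorise; factors)
import Data.Nat.Properties as ℕₚ
open import Data.Nat.Solver using () renaming (module +-*-Solver to ℕ-Solver)
open import Data.Product using (∃; _×_; _,_; proj₁; proj₂)
open import Data.Rational.Base hiding (_/_; NonZero; _≄_; _≃_)
open import Data.Rational.Properties hiding (_≟_)
open import Data.Rational.Properties using () renaming (_≟_ to _≟q_)
open import Data.Rational.Solver using (module +-*-Solver)
open import Data.Sum.Base using (_⊎_; inj₁; inj₂; [_,_]′)
open import Function.Base using (_∘_; id)
open import Level using (0ℓ)
open import Relation.Binary.PropositionalEquality using (_≡_; refl; sym; trans; cong; cong₂; subst; subst₂; module ≡-Reasoning)
import Relation.Binary.Reasoning.Setoid as SetoidReasoning
open import Relation.Nullary using (Dec; yes; no; ¬_; contradiction)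

open import Defs

open Coprimality using (Coprime; coprime⇒gcd≡1; gcd≡1⇒coprime; coprime-divisor)
open ℕ-Solver using () renaming (solve to solveⁿ; _:+_ to _⊕ⁿ_; _:*_ to _⊗ⁿ_; con to conⁿ; _:=_ to _≔ⁿ_)
open +-*-Solver using (solve; _:+_; _:*_; :-_; _:-_; _:=_; con)

-- ℂ as a normed ring

-- The sign in (-πz)^{φ(m)/2} comes from the reflection j ↦ m/2 - j. Since ωʲ ω^{m/2-j} = -1, the
-- quotient sin (πw) / (πw) at w = zωʲ contains 1/ωʲ = -ω^{m/2-j}; the product over j thus has ∏ ωʲ
-- = δ(m) as numerator and (-πz)^{φ(m)/2} as denominator. The same relation gives ∏ (-ω²ʲ) = 1,
-- which normalises the factors y² - ω²ʲ to 1 - (yωʲ)². The obstacle in the analysis is that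
-- division is constructive: 1 / sin (kπ/N) exists only together with a lower bound for the sine. A
-- bound of Jordan's type, 1 / sin (πq) = O(1/q) for 0 < q ≤ ½, supplies both the inverse and the
-- domination by C/k². Powers of 2 serve because duplication splits each factor of one level into
-- two of the next, at the angles b and ½ - b, so that no polynomial with known zeros is needed. The
-- addition theorem of the exponential and e^{iπ/2} = i are both proved by telescoping: a quantity
-- that should be constant changes by O(N⁻²) in each of N steps. The estimates are therefore carried
-- to second order, from the series alone.

≤-via-ε : ∀ {p q} → (∀ ε → 0ℚ < ε → p ≤ q + ε) → p ≤ q
≤-via-ε {p} {q} h = ≮⇒≥ λ q<p →
  <-irrefl refl (≤-<-trans (h (½ * (p - q)) (pos* 0<½ (0<d q<p))) (mid q<p))
  where
  0<d : q < p → 0ℚ < p - q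
  0<d q<p = subst (_< p - q) (+-inverseʳ q) (+-monoˡ-< (- q) q<p)
  mid : q < p → q + ½ * (p - q) < p
  mid q<p = subst (q + ½ * (p - q) <_)
    (trans (+-assoc q _ _) (trans (cong (q +_) (½+½ (p - q))) (p+[q-p]≡q q p)))
    (subst (_< q + ½ * (p - q) + ½ * (p - q)) (+-identityʳ _)
      (+-monoʳ-< (q + ½ * (p - q)) (pos* 0<½ (0<d q<p))))

infix 4 ∥_∥≤_

-- The slack ε and the cutoff N make this a statement about the complex number and not about the
-- sequences that represent it. It therefore respects `_≈_` and passes to limits.
record ∥_∥≤_ (z : ℂ) (q : ℚ) : Set where
  constructor mkBound
  field eventually : ∀ ε → 0ℚ < ε → ∃ λ N → ∀ k → N ℕ.≤ k → norm z k ≤ q + ε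

open ∥_∥≤_ public

infix  8 ⊝_
infixl 7 _⊗_
infixl 6 _⊕_ _⊖_
infix  4 _≈_

-- Opaque copies of the operations of Defs, since unfolding them is costly.
opaque
  _⊕_ _⊗_ : ℂ → ℂ → ℂ
  _⊕_ = _+ᶜ_
  _⊗_ = _*ᶜ_

  ⊝_ : ℂ → ℂ
  ⊝_ = -ᶜ_

  ⌜_⌝ : ℚ → ℂ
  ⌜ q ⌝ = ofℝ (ofℚ q)

  ι : ℂ
  ι = 𝕚

_⊖_ : ℂ → ℂ → ℂ
z ⊖ w = z ⊕ (⊝ w)

record _≈_ (z w : ℂ) : Set where
  constructor mk≈
  field gap : ∥ z ⊖ w ∥≤ 0ℚ

open _≈_ public

∥∥-pointwise : ∀ {z q} → (∀ k → norm z k ≤ q) → ∥ z ∥≤ q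
∥∥-pointwise h = mkBound λ ε 0<ε → 0 , λ k _ → ≤-trans (h k) (p≤p+q _ (<⇒≤ 0<ε))

∥∥-via : ∀ {z w p} → (∀ k → norm w k ≤ norm z k) → ∥ z ∥≤ p → ∥ w ∥≤ p
∥∥-via le (mkBound h) = mkBound λ ε 0<ε → let N , b = h ε 0<ε in N , λ k N≤k → ≤-trans (le k) (b k N≤k)

∥∥-via₂ : ∀ {z w v} → (∀ k → norm v k ≤ norm z k + norm w k) → ∀ {p q} → ∥ z ∥≤ p → ∥ w ∥≤ q → ∥ v ∥≤ p + q
∥∥-via₂ le {p} {q} (mkBound h) (mkBound g) = mkBound λ ε 0<ε →
  let N , b = h (½ * ε) (pos* 0<½ 0<ε)
      M , c = g (½ * ε) (pos* 0<½ 0<ε)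
  in N ℕ.⊔ M , λ k l → ≤-trans (le k) (≤-trans (+-mono-≤ (b k (≤⊔ˡ l)) (c k (≤⊔ʳ {N} l)))
       (≤-reflexive (trans
         (solve 3 (λ p q e → (p :+ e) :+ (q :+ e) := (p :+ q) :+ (e :+ e)) refl p q (½ * ε))
         (cong (p + q +_) (½+½ ε)))))

module ℓ¹ where
  plus : ∀ a b c d → ∣ a + c ∣ + ∣ b + d ∣ ≤ ∣ a ∣ + ∣ b ∣ + (∣ c ∣ + ∣ d ∣)
  plus a b c d = ≤-trans (+-mono-≤ (∣p+q∣≤∣p∣+∣q∣ a c) (∣p+q∣≤∣p∣+∣q∣ b d))
    (≤-reflexive (solve 4 (λ a b c d → (a :+ c) :+ (b :+ d) := (a :+ b) :+ (c :+ d))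
      refl (∣ a ∣) (∣ b ∣) (∣ c ∣) (∣ d ∣)))

  split : ∀ {a b} c d c′ d′ → a ≡ c + c′ → b ≡ d + d′ → ∣ a ∣ + ∣ b ∣ ≤ ∣ c ∣ + ∣ d ∣ + (∣ c′ ∣ + ∣ d′ ∣)
  split c d c′ d′ refl refl = plus c d c′ d′

  zero-gap : ∀ {a b c d} → a ≡ c → b ≡ d → ∣ a - c ∣ + ∣ b - d ∣ ≡ 0ℚ
  zero-gap {a} {b} refl refl = cong₂ (λ x y → ∣ x ∣ + ∣ y ∣) {x = a - a} {y = 0ℚ} {u = b - b} {v = 0ℚ} (+-inverseʳ a) (+-inverseʳ b)

  chain : ∀ a b c → a - c ≡ (a - b) + (b - c)
  chain = solve 3 (λ a b c → a :- c := (a :- b) :+ (b :- c)) refl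

  shift : ∀ a b → a ≡ (a - b) + b
  shift = solve 2 (λ a b → a := (a :- b) :+ b) refl

  swap : ∀ a b c d → (a + c) - (b + d) ≡ (a - b) + (c - d)
  swap = solve 4 (λ a b c d → (a :+ c) :- (b :+ d) := (a :- b) :+ (c :- d)) refl

  mul-re : ∀ a a′ b b′ c c′ d d′ → (a * c - b * d) - (a′ * c′ - b′ * d′) ≡ ((a - a′) * c - (b - b′) * d) + (a′ * (c - c′) - b′ * (d - d′))
  mul-re = solve 8 (λ a a′ b b′ c c′ d d′ → (a :* c :- b :* d) :- (a′ :* c′ :- b′ :* d′) :=
    ((a :- a′) :* c :- (b :- b′) :* d) :+ (a′ :* (c :- c′) :- b′ :* (d :- d′))) refl

  mul-im : ∀ a a′ b b′ c c′ d d′ → (a * d + b * c) - (a′ * d′ + b′ * c′) ≡ ((a - a′) * d + (b - b′) * c) + (a′ * (d - d′) + b′ * (c - c′))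
  mul-im = solve 8 (λ a a′ b b′ c c′ d d′ → (a :* d :+ b :* c) :- (a′ :* d′ :+ b′ :* c′) :=
    ((a :- a′) :* d :+ (b :- b′) :* c) :+ (a′ :* (d :- d′) :+ b′ :* (c :- c′))) refl

  negate : ∀ a b → ∣ (- a) - (- b) ∣ ≡ ∣ a - b ∣
  negate a b = trans (cong ∣_∣ (solve 2 (λ a b → (:- a) :- (:- b) := :- (a :- b)) refl a b)) (∣-p∣≡∣p∣ (a - b))

opaque
  unfolding _⊕_

  norm-⊕ : ∀ z w k → norm (z ⊕ w) k ≤ norm z k + norm w k
  norm-⊕ z w k = ℓ¹.plus (seq (re z) k) (seq (im z) k) (seq (re w) k) (seq (im w) k)

  norm-⊗ : ∀ z w k → norm (z ⊗ w) k ≤ norm z k * norm w k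
  norm-⊗ = norm-*

  norm-⊝ : ∀ z k → norm (⊝ z) k ≡ norm z k
  norm-⊝ z k = cong₂ _+_ (∣-p∣≡∣p∣ (seq (re z) k)) (∣-p∣≡∣p∣ (seq (im z) k))

  norm-⌜⌝ : ∀ q k → norm ⌜ q ⌝ k ≡ ∣ q ∣
  norm-⌜⌝ q k = +-identityʳ (∣ q ∣)

  norm-ι : ∀ k → norm ι k ≡ 1ℚ
  norm-ι k = refl

  norm-exact : ∀ z w k → seq (re z) k ≡ seq (re w) k → seq (im z) k ≡ seq (im w) k → norm (z ⊖ w) k ≡ 0ℚ
  norm-exact z w k p q = ℓ¹.zero-gap p q

  norm-⊖-sym : ∀ z w k → norm (z ⊖ w) k ≡ norm (w ⊖ z) k
  norm-⊖-sym z w k = cong₂ _+_ (∣∣-sym (seq (re z) k) (seq (re w) k)) (∣∣-sym (seq (im z) k) (seq (im w) k))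

  norm-⊖-triangle : ∀ z w v k → norm (z ⊖ v) k ≤ norm (z ⊖ w) k + norm (w ⊖ v) k
  norm-⊖-triangle z w v k = ℓ¹.split (seq (re z) k - seq (re w) k) (seq (im z) k - seq (im w) k) (seq (re w) k - seq (re v) k) (seq (im w) k - seq (im v) k)
    (ℓ¹.chain (seq (re z) k) (seq (re w) k) (seq (re v) k)) (ℓ¹.chain (seq (im z) k) (seq (im w) k) (seq (im v) k))

  norm-⊖-shift : ∀ z w k → norm w k ≤ norm (w ⊖ z) k + norm z k
  norm-⊖-shift z w k = ℓ¹.split (seq (re w) k - seq (re z) k) (seq (im w) k - seq (im z) k) (seq (re z) k) (seq (im z) k)
    (ℓ¹.shift (seq (re w) k) (seq (re z) k)) (ℓ¹.shift (seq (im w) k) (seq (im z) k))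

  norm-⊕-cong : ∀ z z′ w w′ k → norm ((z ⊕ w) ⊖ (z′ ⊕ w′)) k ≤ norm (z ⊖ z′) k + norm (w ⊖ w′) k
  norm-⊕-cong z z′ w w′ k =
    ℓ¹.split (seq (re z) k - seq (re z′) k) (seq (im z) k - seq (im z′) k) (seq (re w) k - seq (re w′) k) (seq (im w) k - seq (im w′) k)
      (ℓ¹.swap (seq (re z) k) (seq (re z′) k) (seq (re w) k) (seq (re w′) k)) (ℓ¹.swap (seq (im z) k) (seq (im z′) k) (seq (im w) k) (seq (im w′) k))

  norm-⊗-cong : ∀ z z′ w w′ k → norm ((z ⊗ w) ⊖ (z′ ⊗ w′)) k ≤ norm ((z ⊖ z′) ⊗ w) k + norm (z′ ⊗ (w ⊖ w′)) k
  norm-⊗-cong z z′ w w′ k = ℓ¹.split (seq (re ((z ⊖ z′) ⊗ w)) k) (seq (im ((z ⊖ z′) ⊗ w)) k) (seq (re (z′ ⊗ (w ⊖ w′))) k) (seq (im (z′ ⊗ (w ⊖ w′))) k)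
    (ℓ¹.mul-re (seq (re z) k) (seq (re z′) k) (seq (im z) k) (seq (im z′) k) (seq (re w) k) (seq (re w′) k) (seq (im w) k) (seq (im w′) k))
    (ℓ¹.mul-im (seq (re z) k) (seq (re z′) k) (seq (im z) k) (seq (im z′) k) (seq (re w) k) (seq (re w′) k) (seq (im w) k) (seq (im w′) k))

  norm-⊝-cong : ∀ z w k → norm ((⊝ z) ⊖ (⊝ w)) k ≡ norm (z ⊖ w) k
  norm-⊝-cong z w k = cong₂ _+_ (ℓ¹.negate (seq (re z) k) (seq (re w) k)) (ℓ¹.negate (seq (im z) k) (seq (im w) k))

exact : ∀ {z w} → (∀ k → seq (re z) k ≡ seq (re w) k) → (∀ k → seq (im z) k ≡ seq (im w) k) → z ≈ w
exact {z} {w} p q = mk≈ (∥∥-pointwise λ k → ≤-reflexive (norm-exact z w k (p k) (q k)))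

∥∥-nonNeg : ∀ {z q} → ∥ z ∥≤ q → 0ℚ ≤ q
∥∥-nonNeg {z} (mkBound h) = ≤-via-ε λ ε 0<ε → let N , b = h ε 0<ε in ≤-trans (0≤norm z N) (b N ℕₚ.≤-refl)

∥∥-weaken : ∀ {z p q} → ∥ z ∥≤ p → p ≤ q → ∥ z ∥≤ q
∥∥-weaken (mkBound h) p≤q = mkBound λ ε 0<ε → let N , b = h ε 0<ε in
  N , λ k N≤k → ≤-trans (b k N≤k) (+-monoˡ-≤ ε p≤q)

∥∥-closed : ∀ {z q} → (∀ ε → 0ℚ < ε → ∥ z ∥≤ q + ε) → ∥ z ∥≤ q
∥∥-closed {z} {q} h = mkBound λ ε 0<ε → let N , b = eventually (h (½ * ε) (pos* 0<½ 0<ε)) (½ * ε) (pos* 0<½ 0<ε) in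
  N , λ k N≤k → subst (norm z k ≤_) (trans (+-assoc q _ _) (cong (q +_) (½+½ ε))) (b k N≤k)

∥∥-⊕ : ∀ {z w p q} → ∥ z ∥≤ p → ∥ w ∥≤ q → ∥ z ⊕ w ∥≤ p + q
∥∥-⊕ {z} {w} = ∥∥-via₂ (norm-⊕ z w)

∥∥-⊝ : ∀ {z p} → ∥ z ∥≤ p → ∥ ⊝ z ∥≤ p
∥∥-⊝ {z} = ∥∥-via λ k → ≤-reflexive (norm-⊝ z k)

∥∥-⊖ : ∀ {z w p q} → ∥ z ∥≤ p → ∥ w ∥≤ q → ∥ z ⊖ w ∥≤ p + q
∥∥-⊖ a b = ∥∥-⊕ a (∥∥-⊝ b)

∥∥-⌜⌝ : ∀ q → ∥ ⌜ q ⌝ ∥≤ ∣ q ∣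
∥∥-⌜⌝ q = ∥∥-pointwise λ k → ≤-reflexive (norm-⌜⌝ q k)

∥∥-⌜⌝⁺ : ∀ {q} → 0ℚ ≤ q → ∥ ⌜ q ⌝ ∥≤ q
∥∥-⌜⌝⁺ {q} 0≤q = subst (∥ ⌜ q ⌝ ∥≤_) (0≤p⇒∣p∣≡p 0≤q) (∥∥-⌜⌝ q)

∥∥-ι : ∥ ι ∥≤ 1ℚ
∥∥-ι = ∥∥-pointwise λ k → ≤-reflexive (norm-ι k)

∥∥-bounded : ∀ z → ∃ λ b → ∥ z ∥≤ fromℕ b
∥∥-bounded z = let b , h = norm-bounded z in b , ∥∥-pointwise h

opaque
  -- The cap d ≤ 1 lets the square of an error be bounded by the error itself in products; C + 1
  -- replaces C so that the division is safe also for C = 0.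
  small : ∀ C → 0ℚ ≤ C → ∀ ε → 0ℚ < ε → ∃ λ d → 0ℚ < d × d ≤ 1ℚ × C * d ≤ ε
  small C 0≤C ε 0<ε = d , 0<d , p⊓q≤q (recip C′ * ε) 1ℚ , (begin
    C * d                  ≤⟨ *-monoʳ₀ {C} {C′} d (<⇒≤ 0<d) (p≤p+q C 0≤1) ⟩
    C′ * d                 ≤⟨ *-monoˡ₀ C′ (<⇒≤ 0<C′) (p⊓q≤p (recip C′ * ε) 1ℚ) ⟩
    C′ * (recip C′ * ε)    ≡⟨ sym (*-assoc C′ (recip C′) ε) ⟩
    C′ * recip C′ * ε      ≡⟨ cong (_* ε) (trans (*-comm C′ (recip C′)) (recip* 0<C′)) ⟩
    1ℚ * ε                 ≡⟨ *-identityˡ ε ⟩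
    ε                      ∎)
    where
    open ≤-Reasoning
    C′ d : ℚ
    C′ = C + 1ℚ
    d = (recip C′ * ε) ⊓ 1ℚ
    0<C′ : 0ℚ < C′
    0<C′ = pos+ {C} {1ℚ} 0≤C 0<1
    0<d : 0ℚ < d
    0<d = [ (λ e → subst (0ℚ <_) (sym e) (pos* (0<recip 0<C′) 0<ε)) , (λ e → subst (0ℚ <_) (sym e) 0<1) ]′
            (⊓-sel (recip C′ * ε) 1ℚ)

∥∥-⊗ : ∀ {z w p q} → ∥ z ∥≤ p → ∥ w ∥≤ q → ∥ z ⊗ w ∥≤ p * q
∥∥-⊗ {z} {w} {p} {q} hz@(mkBound h) hw@(mkBound g) = mkBound go
  where
  0≤p = ∥∥-nonNeg hz
  0≤q = ∥∥-nonNeg hw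
  go : ∀ ε → 0ℚ < ε → ∃ λ N → ∀ k → N ℕ.≤ k → norm (z ⊗ w) k ≤ p * q + ε
  go ε 0<ε =
    let d , 0<d , d≤1 , Cd≤ε = small (p + q + 1ℚ) (nonNeg+ (nonNeg+ 0≤p 0≤q) 0≤1) ε 0<ε
        N , b = h d 0<d
        M , c = g d 0<d
    in N ℕ.⊔ M , λ k le → near k d (<⇒≤ 0<d) d≤1 Cd≤ε (b k (≤⊔ˡ le)) (c k (≤⊔ʳ {N} le))
    where
    open ≤-Reasoning
    near : ∀ k d → 0ℚ ≤ d → d ≤ 1ℚ → (p + q + 1ℚ) * d ≤ ε → norm z k ≤ p + d → norm w k ≤ q + d → norm (z ⊗ w) k ≤ p * q + ε
    near k d 0≤d d≤1 Cd≤ε b c = begin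
      norm (z ⊗ w) k                ≤⟨ norm-⊗ z w k ⟩
      norm z k * norm w k           ≤⟨ *-mono₀ {norm z k} {p + d} {norm w k} {q + d} (0≤norm w k) (nonNeg+ 0≤p 0≤d) b c ⟩
      (p + d) * (q + d)             ≡⟨ solve 3 (λ p q d → (p :+ d) :* (q :+ d) := p :* q :+ (p :+ q :+ d) :* d) refl p q d ⟩
      p * q + (p + q + d) * d       ≤⟨ +-monoʳ-≤ (p * q) (*-monoʳ₀ {p + q + d} {p + q + 1ℚ} d 0≤d (+-monoʳ-≤ (p + q) d≤1)) ⟩
      p * q + (p + q + 1ℚ) * d      ≤⟨ +-monoʳ-≤ (p * q) Cd≤ε ⟩
      p * q + ε                     ∎

≈-refl : ∀ {z} → z ≈ z
≈-refl = exact (λ _ → refl) (λ _ → refl)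

≈-reflexive : ∀ {z w} → z ≡ w → z ≈ w
≈-reflexive refl = ≈-refl

≈-sym : ∀ {z w} → z ≈ w → w ≈ z
≈-sym {z} {w} (mk≈ h) = mk≈ (∥∥-via (λ k → ≤-reflexive (norm-⊖-sym w z k)) h)

≈-trans : ∀ {z w v} → z ≈ w → w ≈ v → z ≈ v
≈-trans {z} {w} {v} (mk≈ h) (mk≈ g) = mk≈ (∥∥-via₂ (norm-⊖-triangle z w v) h g)

⊕-cong : ∀ {z z′ w w′} → z ≈ z′ → w ≈ w′ → z ⊕ w ≈ z′ ⊕ w′
⊕-cong {z} {z′} {w} {w′} (mk≈ h) (mk≈ g) = mk≈ (∥∥-via₂ (norm-⊕-cong z z′ w w′) h g)

⊗-cong : ∀ {z z′ w w′} → z ≈ z′ → w ≈ w′ → z ⊗ w ≈ z′ ⊗ w′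
⊗-cong {z} {z′} {w} {w′} (mk≈ h) (mk≈ g) =
  let b , hb = ∥∥-bounded w
      c , hc = ∥∥-bounded z′
  in mk≈ (subst (∥ (z ⊗ w) ⊖ (z′ ⊗ w′) ∥≤_)
       (solve 2 (λ b c → con 0ℚ :* b :+ c :* con 0ℚ := con 0ℚ) refl (fromℕ b) (fromℕ c))
       (∥∥-via₂ (norm-⊗-cong z z′ w w′) (∥∥-⊗ h hb) (∥∥-⊗ hc g)))

⊝-cong : ∀ {z w} → z ≈ w → ⊝ z ≈ ⊝ w
⊝-cong {z} {w} (mk≈ h) = mk≈ (∥∥-via (λ k → ≤-reflexive (norm-⊝-cong z w k)) h)

⊕-congˡ : ∀ {z w w′} → w ≈ w′ → z ⊕ w ≈ z ⊕ w′
⊕-congˡ = ⊕-cong ≈-refl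

⊗-congˡ : ∀ {z w w′} → w ≈ w′ → z ⊗ w ≈ z ⊗ w′
⊗-congˡ = ⊗-cong ≈-refl

⊖-congˡ : ∀ {z w w′} → w ≈ w′ → z ⊖ w ≈ z ⊖ w′
⊖-congˡ h = ⊕-congˡ (⊝-cong h)

module ℂ-laws where
  comm-re : ∀ a b c d → a * c - b * d ≡ c * a - d * b
  comm-re = solve 4 (λ a b c d → a :* c :- b :* d := c :* a :- d :* b) refl

  comm-im : ∀ a b c d → a * d + b * c ≡ c * b + d * a
  comm-im = solve 4 (λ a b c d → a :* d :+ b :* c := c :* b :+ d :* a) refl

  one-re : ∀ a b → 1ℚ * a - 0ℚ * b ≡ a
  one-re = solve 2 (λ a b → con 1ℚ :* a :- con 0ℚ :* b := a) refl

  one-im : ∀ a b → 1ℚ * b + 0ℚ * a ≡ b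
  one-im = solve 2 (λ a b → con 1ℚ :* b :+ con 0ℚ :* a := b) refl

  assoc-re : ∀ a b c d e f → (a * c - b * d) * e - (a * d + b * c) * f ≡ a * (c * e - d * f) - b * (c * f + d * e)
  assoc-re = solve 6 (λ a b c d e f → (a :* c :- b :* d) :* e :- (a :* d :+ b :* c) :* f := a :* (c :* e :- d :* f) :- b :* (c :* f :+ d :* e)) refl

  assoc-im : ∀ a b c d e f → (a * c - b * d) * f + (a * d + b * c) * e ≡ a * (c * f + d * e) + b * (c * e - d * f)
  assoc-im = solve 6 (λ a b c d e f → (a :* c :- b :* d) :* f :+ (a :* d :+ b :* c) :* e := a :* (c :* f :+ d :* e) :+ b :* (c :* e :- d :* f)) refl

  distrib-re : ∀ a b c d e f → (a + c) * e - (b + d) * f ≡ (a * e - b * f) + (c * e - d * f)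
  distrib-re = solve 6 (λ a b c d e f → (a :+ c) :* e :- (b :+ d) :* f := (a :* e :- b :* f) :+ (c :* e :- d :* f)) refl

  distrib-im : ∀ a b c d e f → (a + c) * f + (b + d) * e ≡ (a * f + b * e) + (c * f + d * e)
  distrib-im = solve 6 (λ a b c d e f → (a :+ c) :* f :+ (b :+ d) :* e := (a :* f :+ b :* e) :+ (c :* f :+ d :* e)) refl

  embed-re : ∀ p q → p * q ≡ p * q - 0ℚ * 0ℚ
  embed-re = solve 2 (λ p q → p :* q := p :* q :- con 0ℚ :* con 0ℚ) refl

  embed-im : ∀ p q → 0ℚ ≡ p * 0ℚ + 0ℚ * q
  embed-im = solve 2 (λ p q → con 0ℚ := p :* con 0ℚ :+ con 0ℚ :* q) refl

opaque
  unfolding _⊕_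

  ⊕-assoc : ∀ z w v → (z ⊕ w) ⊕ v ≈ z ⊕ (w ⊕ v)
  ⊕-assoc z w v = exact (λ k → +-assoc (seq (re z) k) (seq (re w) k) (seq (re v) k)) (λ k → +-assoc (seq (im z) k) (seq (im w) k) (seq (im v) k))

  ⊕-comm : ∀ z w → z ⊕ w ≈ w ⊕ z
  ⊕-comm z w = exact (λ k → +-comm (seq (re z) k) (seq (re w) k)) (λ k → +-comm (seq (im z) k) (seq (im w) k))

  ⊕-identityˡ : ∀ z → ⌜ 0ℚ ⌝ ⊕ z ≈ z
  ⊕-identityˡ z = exact (λ k → +-identityˡ (seq (re z) k)) (λ k → +-identityˡ (seq (im z) k))

  ⊕-inverseˡ : ∀ z → (⊝ z) ⊕ z ≈ ⌜ 0ℚ ⌝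
  ⊕-inverseˡ z = exact (λ k → +-inverseˡ (seq (re z) k)) (λ k → +-inverseˡ (seq (im z) k))

  ⊗-comm : ∀ z w → z ⊗ w ≈ w ⊗ z
  ⊗-comm z w = exact
    (λ k → ℂ-laws.comm-re (seq (re z) k) (seq (im z) k) (seq (re w) k) (seq (im w) k))
    (λ k → ℂ-laws.comm-im (seq (re z) k) (seq (im z) k) (seq (re w) k) (seq (im w) k))

  ⊗-identityˡ : ∀ z → ⌜ 1ℚ ⌝ ⊗ z ≈ z
  ⊗-identityˡ z = exact (λ k → ℂ-laws.one-re (seq (re z) k) (seq (im z) k)) (λ k → ℂ-laws.one-im (seq (re z) k) (seq (im z) k))

  ⊗-assoc : ∀ z w v → (z ⊗ w) ⊗ v ≈ z ⊗ (w ⊗ v)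
  ⊗-assoc z w v = exact
    (λ k → ℂ-laws.assoc-re (seq (re z) k) (seq (im z) k) (seq (re w) k) (seq (im w) k) (seq (re v) k) (seq (im v) k))
    (λ k → ℂ-laws.assoc-im (seq (re z) k) (seq (im z) k) (seq (re w) k) (seq (im w) k) (seq (re v) k) (seq (im v) k))

  ⊗-distribʳ : ∀ v z w → (z ⊕ w) ⊗ v ≈ (z ⊗ v) ⊕ (w ⊗ v)
  ⊗-distribʳ v z w = exact
    (λ k → ℂ-laws.distrib-re (seq (re z) k) (seq (im z) k) (seq (re w) k) (seq (im w) k) (seq (re v) k) (seq (im v) k))
    (λ k → ℂ-laws.distrib-im (seq (re z) k) (seq (im z) k) (seq (re w) k) (seq (im w) k) (seq (re v) k) (seq (im v) k))

  ⌜⌝-+ : ∀ p q → ⌜ p + q ⌝ ≈ ⌜ p ⌝ ⊕ ⌜ q ⌝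
  ⌜⌝-+ p q = exact (λ _ → refl) (λ _ → refl)

  ⌜⌝-* : ∀ p q → ⌜ p * q ⌝ ≈ ⌜ p ⌝ ⊗ ⌜ q ⌝
  ⌜⌝-* p q = exact (λ _ → ℂ-laws.embed-re p q) (λ _ → ℂ-laws.embed-im p q)

  ⌜⌝-neg : ∀ p → ⌜ - p ⌝ ≈ ⊝ ⌜ p ⌝
  ⌜⌝-neg p = exact (λ _ → refl) (λ _ → refl)

  ι² : ι ⊗ ι ≈ ⊝ ⌜ 1ℚ ⌝
  ι² = exact (λ _ → refl) (λ _ → refl)

ℂ-ring : CommutativeRing 0ℓ 0ℓ
ℂ-ring = record
  { Carrier = ℂ ; _≈_ = _≈_ ; _+_ = _⊕_ ; _*_ = _⊗_ ; -_ = ⊝_ ; 0# = ⌜ 0ℚ ⌝ ; 1# = ⌜ 1ℚ ⌝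
  ; isCommutativeRing = record
    { isRing = record
      { +-isAbelianGroup = record
        { isGroup = record
          { isMonoid = record
            { isSemigroup = record
              { isMagma = record
                { isEquivalence = record { refl = ≈-refl ; sym = ≈-sym ; trans = ≈-trans }
                ; ∙-cong = ⊕-cong }
              ; assoc = ⊕-assoc }
            ; identity = ⊕-identityˡ , λ z → ≈-trans (⊕-comm z ⌜ 0ℚ ⌝) (⊕-identityˡ z) }
          ; inverse = ⊕-inverseˡ , λ z → ≈-trans (⊕-comm z (⊝ z)) (⊕-inverseˡ z)
          ; ⁻¹-cong = ⊝-cong }
        ; comm = ⊕-comm }
      ; *-cong = ⊗-cong
      ; *-assoc = ⊗-assoc
      ; *-identity = ⊗-identityˡ , λ z → ≈-trans (⊗-comm z ⌜ 1ℚ ⌝) (⊗-identityˡ z)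
      ; distrib = (λ v z w → ≈-trans (⊗-comm v (z ⊕ w)) (≈-trans (⊗-distribʳ v z w) (⊕-cong (⊗-comm z v) (⊗-comm w v)))) , ⊗-distribʳ }
    ; *-comm = ⊗-comm } }

module ≈-Reasoning = SetoidReasoning (CommutativeRing.setoid ℂ-ring)

-- Rational coefficients let the ring solver compute with constants such as ⌜ ½ ⌝. To the solver ι
-- is a mere variable, so that `ι²` has to be applied by hand.
⌜⌝-morphism : CommutativeRing.rawRing +-*-commutativeRing -Raw-AlmostCommutative⟶ fromCommutativeRing ℂ-ring
⌜⌝-morphism = record
  { ⟦_⟧ = ⌜_⌝ ; +-homo = ⌜⌝-+ ; *-homo = ⌜⌝-* ; -‿homo = ⌜⌝-neg ; 0-homo = ≈-refl ; 1-homo = ≈-refl }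

⌜⌝-≈? : ∀ p q → Maybe (⌜ p ⌝ ≈ ⌜ q ⌝)
⌜⌝-≈? p q with p ≟q q
... | yes p≡q = just (≈-reflexive (cong ⌜_⌝ p≡q))
... | no _    = nothing

module ℂ-Solver = RingSolver (CommutativeRing.rawRing +-*-commutativeRing) (fromCommutativeRing ℂ-ring) ⌜⌝-morphism ⌜⌝-≈?

open ℂ-Solver public using () renaming
  (solve to solveᶜ; _:+_ to _⊞_; _:*_ to _⊠_; _:-_ to _⊟_; :-_ to ⊟_; con to conᶜ; _:=_ to _≔_)

∥∥-resp : ∀ {z w q} → z ≈ w → ∥ z ∥≤ q → ∥ w ∥≤ q
∥∥-resp {z} {w} {q} (mk≈ e) h = subst (∥ w ∥≤_) (+-identityˡ q)
  (∥∥-via₂ (λ k → subst (λ t → norm w k ≤ t + norm z k) (norm-⊖-sym w z k) (norm-⊖-shift z w k)) e h)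

∥∥-≡ : ∀ {z p q} → p ≡ q → ∥ z ∥≤ p → ∥ z ∥≤ q
∥∥-≡ refl h = h

≈-closed : ∀ {z w} → (∀ ε → 0ℚ < ε → ∥ z ⊖ w ∥≤ ε) → z ≈ w
≈-closed {z} {w} h = mk≈ (∥∥-closed λ ε 0<ε → ∥∥-weaken (h ε 0<ε) (≤-reflexive (sym (+-identityˡ ε))))

∥∥-0 : ∥ ⌜ 0ℚ ⌝ ∥≤ 0ℚ
∥∥-0 = ∥∥-⌜⌝ 0ℚ

∥∥-1 : ∥ ⌜ 1ℚ ⌝ ∥≤ 1ℚ
∥∥-1 = ∥∥-⌜⌝ 1ℚ

∥z⊖z∥ : ∀ {z w} → z ≈ w → ∀ {q} → 0ℚ ≤ q → ∥ z ⊖ w ∥≤ q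
∥z⊖z∥ (mk≈ h) = ∥∥-weaken h

∥∥-⊖-sym : ∀ {z w q} → ∥ z ⊖ w ∥≤ q → ∥ w ⊖ z ∥≤ q
∥∥-⊖-sym {z} {w} = ∥∥-via λ k → ≤-reflexive (norm-⊖-sym w z k)

∥∥-triangle : ∀ {z w v p q} → ∥ z ⊖ w ∥≤ p → ∥ w ⊖ v ∥≤ q → ∥ z ⊖ v ∥≤ p + q
∥∥-triangle {z} {w} {v} = ∥∥-via₂ (norm-⊖-triangle z w v)

-- Convergence of complex sequences in the ℓ¹ norm

infix 4 _⇒_

-- Working form of `_⟶_` with rational bounds in place of the squared modulus; `⇒-⟶` converts at the
-- very end.
record _⇒_ (x : ℕ → ℂ) (L : ℂ) : Set where
  constructor mk⇒
  field within : ∀ ε → 0ℚ < ε → ∃ λ N → ∀ n → N ℕ.≤ n → ∥ x n ⊖ L ∥≤ ε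

open _⇒_ public

⇒-const : ∀ {z w} → z ≈ w → (λ _ → z) ⇒ w
⇒-const e = mk⇒ λ ε 0<ε → 0 , λ _ _ → ∥z⊖z∥ e (<⇒≤ 0<ε)

⇒-resp : ∀ {x y L M} K → (∀ n → K ℕ.≤ n → x n ≈ y n) → L ≈ M → x ⇒ L → y ⇒ M
⇒-resp {x} {y} {L} {M} K e L≈M (mk⇒ h) = mk⇒ λ ε 0<ε → let N , b = h ε 0<ε in
  K ℕ.⊔ N , λ n le → ∥∥-resp (⊕-cong (e n (≤⊔ˡ le)) (⊝-cong L≈M)) (b n (≤⊔ʳ {K} le))

⇒-unique : ∀ {x L M} → x ⇒ L → x ⇒ M → L ≈ M
⇒-unique {x} {L} {M} (mk⇒ h) (mk⇒ g) = ≈-closed λ ε 0<ε →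
  let N , b = h (½ * ε) (pos* 0<½ 0<ε)
      K , c = g (½ * ε) (pos* 0<½ 0<ε)
      n = N ℕ.⊔ K
  in ∥∥-≡ (½+½ ε) (∥∥-triangle (∥∥-⊖-sym (b n (ℕₚ.m≤m⊔n N K))) (c n (ℕₚ.m≤n⊔m N K)))

⇒-⊕ : ∀ {x y L M} → x ⇒ L → y ⇒ M → (λ n → x n ⊕ y n) ⇒ L ⊕ M
⇒-⊕ {x} {y} {L} {M} (mk⇒ h) (mk⇒ g) = mk⇒ λ ε 0<ε →
  let N , b = h (½ * ε) (pos* 0<½ 0<ε)
      K , c = g (½ * ε) (pos* 0<½ 0<ε)
  in N ℕ.⊔ K , λ n le → ∥∥-≡ (½+½ ε) (∥∥-via₂ (norm-⊕-cong (x n) L (y n) M) (b n (≤⊔ˡ le)) (c n (≤⊔ʳ {N} le)))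

⇒-⊝ : ∀ {x L} → x ⇒ L → (λ n → ⊝ x n) ⇒ ⊝ L
⇒-⊝ {x} {L} (mk⇒ h) = mk⇒ λ ε 0<ε → let N , b = h ε 0<ε in
  N , λ n le → ∥∥-via (λ k → ≤-reflexive (norm-⊝-cong (x n) L k)) (b n le)

⇒-⊗ : ∀ {x y L M} → x ⇒ L → y ⇒ M → (λ n → x n ⊗ y n) ⇒ L ⊗ M
⇒-⊗ {x} {y} {L} {M} (mk⇒ h) (mk⇒ g) = mk⇒ go
  where
  B C : ℚ
  B = fromℕ (proj₁ (∥∥-bounded L))
  C = fromℕ (proj₁ (∥∥-bounded M))
  0≤C : 0ℚ ≤ C
  0≤C = 0≤fromℕ (proj₁ (∥∥-bounded M))
  near : ∀ ε d {x y} → 0ℚ ≤ d → d ≤ 1ℚ → (1ℚ + C + B) * d ≤ ε → ∥ x ⊖ L ∥≤ d → ∥ y ⊖ M ∥≤ d → ∥ x ⊗ y ⊖ L ⊗ M ∥≤ ε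
  near ε d {x} {y} 0≤d d≤1 le b c = ∥∥-weaken
    -- Writing y as (y - M) + M bounds y by means of its limit, so that no separate bound on the
    -- sequence is needed.
    (∥∥-resp (solveᶜ 4 (λ x y L M → (x ⊟ L) ⊠ (y ⊟ M ⊞ M) ⊞ L ⊠ (y ⊟ M) ≔ x ⊠ y ⊟ L ⊠ M) ≈-refl x y L M)
      (∥∥-⊕ (∥∥-⊗ b (∥∥-⊕ c (proj₂ (∥∥-bounded M)))) (∥∥-⊗ (proj₂ (∥∥-bounded L)) c)))
    (begin
      d * (d + C) + B * d   ≤⟨ +-monoˡ-≤ (B * d) (*-monoˡ₀ {d + C} {1ℚ + C} d 0≤d (+-monoˡ-≤ C d≤1)) ⟩
      d * (1ℚ + C) + B * d  ≡⟨ solve 3 (λ d C B → d :* (con 1ℚ :+ C) :+ B :* d := (con 1ℚ :+ C :+ B) :* d) refl d C B ⟩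
      (1ℚ + C + B) * d      ≤⟨ le ⟩
      ε                     ∎)
    where open ≤-Reasoning
  go : ∀ ε → 0ℚ < ε → ∃ λ N → ∀ n → N ℕ.≤ n → ∥ x n ⊗ y n ⊖ L ⊗ M ∥≤ ε
  go ε 0<ε =
    let d , 0<d , d≤1 , le₁ = small (1ℚ + C + B) (nonNeg+ (nonNeg+ 0≤1 0≤C) (0≤fromℕ _)) ε 0<ε
        N , b = h d 0<d
        K , c = g d 0<d
    in N ℕ.⊔ K , λ n le → near ε d (<⇒≤ 0<d) d≤1 le₁ (b n (≤⊔ˡ le)) (c n (≤⊔ʳ {N} le))

⇒-bound : ∀ {x L q} N → x ⇒ L → (∀ n → N ℕ.≤ n → ∥ x n ∥≤ q) → ∥ L ∥≤ q
⇒-bound {x} {L} {q} N (mk⇒ h) b = ∥∥-closed λ ε 0<ε →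
  let K , c = h ε 0<ε
      n = N ℕ.⊔ K
  in ∥∥-resp (solveᶜ 2 (λ x L → x ⊟ (x ⊟ L) ≔ L) ≈-refl (x n) L)
       (∥∥-⊖ (b n (ℕₚ.m≤m⊔n N K)) (c n (ℕₚ.m≤n⊔m N K)))

½^-anti : ∀ {m n} → m ℕ.≤ n → ½ ^ℚ n ≤ ½ ^ℚ m
½^-anti {m} {n} m≤n = subst (λ n → ½ ^ℚ n ≤ ½ ^ℚ m) (ℕₚ.m+[n∸m]≡n m≤n) (go (n ∸ m))
  where
  go : ∀ k → ½ ^ℚ (m ℕ.+ k) ≤ ½ ^ℚ m
  go zero rewrite ℕₚ.+-identityʳ m = ≤-refl
  go (suc k) rewrite ℕₚ.+-suc m k = ≤-trans
    (subst (½ ^ℚ (m ℕ.+ k) * ½ ≤_) (*-identityʳ _) (*-monoˡ₀ {½} {1ℚ} (½ ^ℚ (m ℕ.+ k)) (<⇒≤ (0<½^ (m ℕ.+ k))) (p≤p+q ½ (<⇒≤ 0<½))))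
    (go k)

⇒-½^ : ∀ {x L} C → 0ℚ ≤ C → ∀ N → (∀ n → N ℕ.≤ n → ∥ x n ⊖ L ∥≤ C * ½ ^ℚ n) → x ⇒ L
⇒-½^ C 0≤C N b = mk⇒ λ ε 0<ε → let j , le = nullSeq C 0≤C ε 0<ε in
  N ℕ.⊔ j , λ n l → ∥∥-weaken (b n (≤⊔ˡ l)) (≤-trans (*-monoˡ₀ C 0≤C (½^-anti (≤⊔ʳ {N} l))) le)

⇒-inv : ∀ {x L} C → 0ℚ ≤ C → ∀ N → (∀ n → N ℕ.≤ n → ∥ x n ⊖ L ∥≤ C * inv (suc n)) → x ⇒ L
⇒-inv C 0≤C N b = mk⇒ λ ε 0<ε → let j , le = archimedes C ε 0<ε in
  N ℕ.⊔ j , λ n l → ∥∥-weaken (b n (≤⊔ˡ l)) (≤-trans (*-monoˡ₀ C 0≤C (inv-anti (≤⊔ʳ {N} l))) le)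

-- With c = O(N⁻²) the total change is O(N⁻¹). This is the last step of both `Exp-⊕` and `Exp-iπ/2`.
telescopeᶜ : ∀ (f : ℕ → ℂ) {c} N → (∀ j → j ℕ.< N → ∥ f (suc j) ⊖ f j ∥≤ c) → ∥ f N ⊖ f 0 ∥≤ fromℕ N * c
telescopeᶜ f {c} zero h = ∥z⊖z∥ ≈-refl (≤-reflexive (sym (trans (cong (_* c) fromℕ-0) (*-zeroˡ c))))
telescopeᶜ f {c} (suc N) h = ∥∥-≡ eq
  (∥∥-triangle (h N ℕₚ.≤-refl) (telescopeᶜ f N λ j j<N → h j (ℕₚ.m<n⇒m<1+n j<N)))
  where
  eq : c + fromℕ N * c ≡ fromℕ (suc N) * c
  eq = trans (solve 2 (λ c n → c :+ n :* c := (con 1ℚ :+ n) :* c) refl c (fromℕ N)) (cong (_* c) (sym (fromℕ-suc N)))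

-- The path goes through a late common index j: from `x n` at k to `x n` at j, then to `x k` at j,
-- then to the diagonal at k. The three errors come from the Cauchy property of `x n`, from that of
-- the sequence of reals, and from `diagonal-close`.
lim-close : ∀ x (cx : IsCauchyʳ x) e → 0ℚ < e → ∃ λ N → ∀ n → N ℕ.≤ n → ∃ λ K → ∀ k → K ℕ.≤ k →
            ∣ seq (x n) k - diagonal x k ∣ ≤ e + e + e
lim-close x cx e 0<e = N , λ n N≤n → near n N≤n (cauchy (x n) e 0<e)
  where
  D N : ℕ
  D = proj₁ (floorInv e 0<e)
  D≤e : inv (suc D) ≤ e
  D≤e = proj₂ (floorInv e 0<e)
  N = proj₁ (cx e 0<e)
  h : ∀ m n → N ℕ.≤ m → N ℕ.≤ n → ∣ x m -ʳ x n ∣ʳ <ʳ ofℚ e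
  h = proj₂ (cx e 0<e)
  near : ∀ n → N ℕ.≤ n → (∃ λ K → ∀ i j → K ℕ.≤ i → K ℕ.≤ j → ∣ seq (x n) i - seq (x n) j ∣ ≤ e) →
         ∃ λ K → ∀ k → K ℕ.≤ k → ∣ seq (x n) k - diagonal x k ∣ ≤ e + e + e
  near n N≤n (K , hK) = K ℕ.⊔ (N ℕ.⊔ D) , λ k le → close k (≤⊔ˡ le) (≤⊔ʳ {N} (≤⊔ʳ {K} le)) (h n k N≤n (≤⊔ˡ (≤⊔ʳ {K} le)))
    where
    close : ∀ k → K ℕ.≤ k → D ℕ.≤ k → ∣ x n -ʳ x k ∣ʳ <ʳ ofℚ e → ∣ seq (x n) k - diagonal x k ∣ ≤ e + e + e
    close k K≤k D≤k (δ , 0<δ , M , hM) =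
      ≤-trans (triangle (seq (x n) k) (seq (x k) j) (diagonal x k))
        (+-mono-≤
          (≤-trans (triangle (seq (x n) k) (seq (x n) j) (seq (x k) j))
            (+-mono-≤ (hK k j K≤k (ℕₚ.≤-trans (ℕₚ.m≤m⊔n K M) (ℕₚ.m≤m⊔n _ _)))
                      (≤-trans (p≤p+q _ (<⇒≤ 0<δ)) (hM j (ℕₚ.≤-trans (ℕₚ.m≤n⊔m K M) (ℕₚ.m≤m⊔n _ _))))))
          (subst (_≤ e) (∣∣-sym (diagonal x k) (seq (x k) j))
            (≤-trans (diagonal-close x k j (ℕₚ.m≤n⊔m (K ℕ.⊔ M) _)) (≤-trans (inv-anti D≤k) D≤e))))
      where
      j : ℕ
      j = K ℕ.⊔ M ℕ.⊔ modulus (x k) k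

opaque
  unfolding _⊕_

  limᶜ-⇒ : ∀ x cr ci → x ⇒ limᶜ x cr ci
  limᶜ-⇒ x cr ci = mk⇒ λ ε 0<ε →
    -- The real and the imaginary part contribute 3e each, and 6e ≤ 8e = ε.
    let e = ½ * (½ * (½ * ε))
        0<e = pos* 0<½ (pos* 0<½ (pos* 0<½ 0<ε))
        N , h = lim-close (λ n → re (x n)) cr e 0<e
        M , g = lim-close (λ n → im (x n)) ci e 0<e
    in N ℕ.⊔ M , λ n le →
         let K , hK = h n (≤⊔ˡ le)
             L , gL = g n (≤⊔ʳ {N} le)
         in mkBound λ δ 0<δ → K ℕ.⊔ L , λ k l →
              ≤-trans (+-mono-≤ (hK k (≤⊔ˡ l)) (gL k (≤⊔ʳ {K} l))) (≤-trans (collect ε 0<ε) (p≤p+q ε (<⇒≤ 0<δ)))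
    where
    collect : ∀ ε → 0ℚ < ε → let e = ½ * (½ * (½ * ε)) in (e + e + e) + (e + e + e) ≤ ε
    collect ε 0<ε = subst ((e + e + e) + (e + e + e) ≤_) eq (p≤p+q ((e + e + e) + (e + e + e)) (nonNeg+ 0≤e 0≤e))
      where
      e : ℚ
      e = ½ * (½ * (½ * ε))
      0≤e : 0ℚ ≤ e
      0≤e = <⇒≤ (pos* 0<½ (pos* 0<½ (pos* 0<½ 0<ε)))
      eq : ((e + e + e) + (e + e + e)) + (e + e) ≡ ε
      eq = solve 1 (λ ε → let e = con ½ :* (con ½ :* (con ½ :* ε)) in ((e :+ e :+ e) :+ (e :+ e :+ e)) :+ (e :+ e) := ε) refl ε

-- The exponential function

-- The terms zⁿ / n! by their ratio, which suits induction better than powers and factorials.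
term : ℂ → ℕ → ℂ
term z zero    = ⌜ 1ℚ ⌝
term z (suc n) = ⌜ inv (suc n) ⌝ ⊗ (z ⊗ term z n)

series : ℂ → ℕ → ℂ
series z zero    = ⌜ 0ℚ ⌝
series z (suc n) = series z n ⊕ term z n

opaque
  Exp : ℂ → ℂ
  Exp = exp

  infixl 7 _⊙_
  _⊙_ : ℚ → ℂ → ℂ
  _⊙_ = _•_

  infixr 8 _↑_
  _↑_ : ℂ → ℕ → ℂ
  _↑_ = _^ᶜ_

  expTerm′ expPartial′ : ℂ → ℕ → ℂ
  expTerm′ = expTerm
  expPartial′ = expPartial

module ⊙-laws where
  scale-re : ∀ q a b → q * a ≡ q * a - 0ℚ * b
  scale-re = solve 3 (λ q a b → q :* a := q :* a :- con 0ℚ :* b) refl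

  scale-im : ∀ q a b → q * b ≡ q * b + 0ℚ * a
  scale-im = solve 3 (λ q a b → q :* b := q :* b :+ con 0ℚ :* a) refl

opaque
  unfolding _⊕_ Exp

  ⊙-≈ : ∀ q z → q ⊙ z ≈ ⌜ q ⌝ ⊗ z
  ⊙-≈ q z = exact (λ k → ⊙-laws.scale-re q (seq (re z) k) (seq (im z) k)) (λ k → ⊙-laws.scale-im q (seq (re z) k) (seq (im z) k))

  ↑-zero : ∀ z → z ↑ zero ≈ ⌜ 1ℚ ⌝
  ↑-zero z = exact (λ _ → refl) (λ _ → refl)

  ↑-suc : ∀ z n → z ↑ suc n ≈ z ↑ n ⊗ z
  ↑-suc z n = exact (λ _ → refl) (λ _ → refl)

  expTerm-≈ : ∀ z n → expTerm′ z n ≈ (inv (n !) {{n ℕₚ.!≢0}}) ⊙ (z ↑ n)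
  expTerm-≈ z n = exact (λ _ → refl) (λ _ → refl)

  expPartial-zero : ∀ z → expPartial′ z zero ≈ ⌜ 0ℚ ⌝
  expPartial-zero z = exact (λ _ → refl) (λ _ → refl)

  expPartial-suc : ∀ z n → expPartial′ z (suc n) ≈ expPartial′ z n ⊕ expTerm′ z n
  expPartial-suc z n = exact (λ _ → refl) (λ _ → refl)

  expPartial-⇒ : ∀ z → expPartial′ z ⇒ Exp z
  expPartial-⇒ z = limᶜ-⇒ (expPartial z) (ExpCauchy.re-cauchy z) (ExpCauchy.im-cauchy z)

⌜⌝-cong : ∀ {p q} → p ≡ q → ⌜ p ⌝ ≈ ⌜ q ⌝
⌜⌝-cong e = ≈-reflexive (cong ⌜_⌝ e)

inv!-↑ : ∀ z n → ⌜ inv (n !) {{n ℕₚ.!≢0}} ⌝ ⊗ z ↑ n ≈ term z n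
inv!-↑ z zero    = ≈-trans (⊗-cong (⌜⌝-cong inv-1) (↑-zero z)) (⊗-identityˡ ⌜ 1ℚ ⌝)
inv!-↑ z (suc n) = begin
  ⌜ i′ ⌝ ⊗ z ↑ suc n                           ≈⟨ ⊗-cong (≈-trans (⌜⌝-cong (ExpCauchy.inv! z n)) (⌜⌝-* (inv (suc n)) i)) (↑-suc z n) ⟩
  ⌜ inv (suc n) ⌝ ⊗ ⌜ i ⌝ ⊗ (z ↑ n ⊗ z)
    ≈⟨ solveᶜ 4 (λ a b c d → a ⊠ b ⊠ (c ⊠ d) ≔ a ⊠ (d ⊠ (b ⊠ c))) ≈-refl ⌜ inv (suc n) ⌝ ⌜ i ⌝ (z ↑ n) z ⟩
  ⌜ inv (suc n) ⌝ ⊗ (z ⊗ (⌜ i ⌝ ⊗ z ↑ n))     ≈⟨ ⊗-congˡ (⊗-congˡ (inv!-↑ z n)) ⟩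
  term z (suc n)                               ∎
  where
  open ≈-Reasoning
  i i′ : ℚ
  i  = inv (n !) {{n ℕₚ.!≢0}}
  i′ = inv (suc n !) {{suc n ℕₚ.!≢0}}

expPartial-series : ∀ z n → expPartial′ z n ≈ series z n
expPartial-series z zero    = expPartial-zero z
expPartial-series z (suc n) = ≈-trans (expPartial-suc z n)
  (⊕-cong (expPartial-series z n) (≈-trans (expTerm-≈ z n) (≈-trans (⊙-≈ _ (z ↑ n)) (inv!-↑ z n))))

series-⇒ : ∀ z → series z ⇒ Exp z
series-⇒ z = ⇒-resp 0 (λ n _ → expPartial-series z n) ≈-refl (expPartial-⇒ z)

term-cong : ∀ {z w} → z ≈ w → ∀ n → term z n ≈ term w n
term-cong e zero    = ≈-refl
term-cong e (suc n) = ⊗-congˡ (⊗-cong e (term-cong e n))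

series-cong : ∀ {z w} → z ≈ w → ∀ n → series z n ≈ series w n
series-cong e zero    = ≈-refl
series-cong e (suc n) = ⊕-cong (series-cong e n) (term-cong e n)

Exp-cong : ∀ {z w} → z ≈ w → Exp z ≈ Exp w
Exp-cong {z} {w} e = ⇒-unique (⇒-resp 0 (λ n _ → series-cong e n) ≈-refl (series-⇒ z)) (series-⇒ w)

-- Bⁿ / n!, the majorant of `term z n` for ∥ z ∥≤ B.
τ : ℚ → ℕ → ℚ
τ B zero    = 1ℚ
τ B (suc n) = inv (suc n) * (B * τ B n)

0≤τ : ∀ {B} → 0ℚ ≤ B → ∀ n → 0ℚ ≤ τ B n
0≤τ 0≤B zero    = 0≤1
0≤τ 0≤B (suc n) = nonNeg* (0≤inv n) (nonNeg* 0≤B (0≤τ 0≤B n))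

∥term∥ : ∀ {z B} → ∥ z ∥≤ B → ∀ n → ∥ term z n ∥≤ τ B n
∥term∥ h zero    = ∥∥-1
∥term∥ h (suc n) = ∥∥-⊗ (∥∥-⌜⌝⁺ (0≤inv n)) (∥∥-⊗ h (∥term∥ h n))

series-gap : ∀ {z B} → ∥ z ∥≤ B → ∀ N k → ∥ series z (N ℕ.+ k) ⊖ series z N ∥≤ sumℚ (N ℕ.+ k) (τ B) - sumℚ N (τ B)
series-gap {z} {B} h N zero rewrite ℕₚ.+-identityʳ N = ∥z⊖z∥ ≈-refl (≤-reflexive (sym (+-inverseʳ (sumℚ N (τ B)))))
series-gap {z} {B} h N (suc k) rewrite ℕₚ.+-suc N k = ∥∥-≡
  (solve 3 (λ a b t → (a :- b) :+ t := (a :+ t) :- b) refl (sumℚ (N ℕ.+ k) (τ B)) (sumℚ N (τ B)) (τ B (N ℕ.+ k)))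
  (∥∥-resp (solveᶜ 3 (λ a b t → (a ⊟ b) ⊞ t ≔ (a ⊞ t) ⊟ b) ≈-refl (series z (N ℕ.+ k)) (series z N) (term z (N ℕ.+ k)))
    (∥∥-⊕ (series-gap h N k) (∥term∥ h (N ℕ.+ k))))

-- The condition on c makes n ↦ ∑_{k<n} τ B k + c τ B n decreasing from N on.
τ-tail : ∀ {B r c} → 0ℚ ≤ B → 0ℚ ≤ c → 1ℚ + c * r ≤ c → ∀ N → (∀ n → N ℕ.≤ n → inv (suc n) * B ≤ r) →
         ∀ k → sumℚ (N ℕ.+ k) (τ B) + c * τ B (N ℕ.+ k) ≤ sumℚ N (τ B) + c * τ B N
τ-tail 0≤B 0≤c 1+cr≤c N ratio zero rewrite ℕₚ.+-identityʳ N = ≤-refl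
τ-tail {B} {r} {c} 0≤B 0≤c 1+cr≤c N ratio (suc k) rewrite ℕₚ.+-suc N k = ≤-trans (begin
  s + t + c * (inv (suc n) * (B * t))    ≡⟨ solve 5 (λ s t c i B → s :+ t :+ c :* (i :* (B :* t)) := s :+ (con 1ℚ :+ c :* (i :* B)) :* t) refl s t c (inv (suc n)) B ⟩
  s + (1ℚ + c * (inv (suc n) * B)) * t
    ≤⟨ +-monoʳ-≤ s (*-monoʳ₀ {1ℚ + c * (inv (suc n) * B)} {c} t (0≤τ 0≤B n)
         (≤-trans (+-monoʳ-≤ 1ℚ (*-monoˡ₀ c 0≤c (ratio n (ℕₚ.m≤m+n N k)))) 1+cr≤c)) ⟩
  s + c * t                              ∎)
  (τ-tail 0≤B 0≤c 1+cr≤c N ratio k)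
  where
  open ≤-Reasoning
  n : ℕ
  n = N ℕ.+ k
  s t : ℚ
  s = sumℚ n (τ B)
  t = τ B n

sumℚ-mono : ∀ {f} → (∀ n → 0ℚ ≤ f n) → ∀ {m n} → m ℕ.≤ n → sumℚ m f ≤ sumℚ n f
sumℚ-mono {f} 0≤f {m} {n} m≤n = subst (λ n → sumℚ m f ≤ sumℚ n f) (ℕₚ.m+[n∸m]≡n m≤n) (go (n ∸ m))
  where
  go : ∀ k → sumℚ m f ≤ sumℚ (m ℕ.+ k) f
  go zero rewrite ℕₚ.+-identityʳ m = ≤-refl
  go (suc k) rewrite ℕₚ.+-suc m k = ≤-trans (go k) (p≤p+q _ (0≤f (m ℕ.+ k)))

opaque
  sumτ-bounded : ∀ B → 0ℚ ≤ B → ∃ λ S → ∀ n → sumℚ n (τ B) ≤ S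
  sumτ-bounded B 0≤B = S , λ n → ≤-trans (sumℚ-mono (0≤τ 0≤B) (ℕₚ.m≤n+m n N))
      (≤-trans (p≤p+q (sumℚ (N ℕ.+ n) (τ B)) (nonNeg* 0≤2 (0≤τ 0≤B (N ℕ.+ n)))) (τ-tail 0≤B 0≤2 ≤-refl N ratio n))
    where
    b N : ℕ
    b = proj₁ (ceilℕ B)
    -- From 2b ≥ 2B on, each term is at most half of the one before, and c = 2 solves 1 + c/2 = c.
    N = b ℕ.+ b
    S : ℚ
    S = sumℚ N (τ B) + (1ℚ + 1ℚ) * τ B N
    0≤2 : 0ℚ ≤ 1ℚ + 1ℚ
    0≤2 = nonNegative⁻¹ (1ℚ + 1ℚ)
    ratio : ∀ n → N ℕ.≤ n → inv (suc n) * B ≤ ½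
    ratio n N≤n = begin
      inv (suc n) * B                    ≤⟨ *-monoˡ₀ (inv (suc n)) (0≤inv n) (≤-trans (p≤∣p∣ B) (proj₂ (ceilℕ B))) ⟩
      inv (suc n) * fromℕ b              ≡⟨ cong (inv (suc n) *_) (sym (½+½ (fromℕ b))) ⟩
      inv (suc n) * (½ * fromℕ b + ½ * fromℕ b)
        ≡⟨ solve 3 (λ i h b → i :* (h :* b :+ h :* b) := h :* (i :* (b :+ b))) refl (inv (suc n)) ½ (fromℕ b) ⟩
      ½ * (inv (suc n) * (fromℕ b + fromℕ b))
        ≤⟨ *-monoˡ₀ ½ (<⇒≤ 0<½) (*-monoˡ₀ (inv (suc n)) (0≤inv n) (subst (_≤ fromℕ (suc n)) (fromℕ-+ b b) (fromℕ-mono (ℕₚ.m≤n⇒m≤1+n N≤n)))) ⟩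
      ½ * (inv (suc n) * fromℕ (suc n))  ≡⟨ trans (cong (½ *_) (inv*fromℕ n)) (*-identityʳ ½) ⟩
      ½                                  ∎
      where open ≤-Reasoning

expBound : ∀ B → 0ℚ ≤ B → ℚ
expBound B 0≤B = proj₁ (sumτ-bounded B 0≤B)

1≤expBound : ∀ B 0≤B → 1ℚ ≤ expBound B 0≤B
1≤expBound B 0≤B = ≤-trans (≤-reflexive (sym (+-identityˡ 1ℚ))) (proj₂ (sumτ-bounded B 0≤B) 1)

0≤expBound : ∀ B 0≤B → 0ℚ ≤ expBound B 0≤B
0≤expBound B 0≤B = ≤-trans 0≤1 (1≤expBound B 0≤B)

∥Exp∥ : ∀ {z B} (0≤B : 0ℚ ≤ B) → ∥ z ∥≤ B → ∥ Exp z ∥≤ expBound B 0≤B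
∥Exp∥ {z} {B} 0≤B h = ⇒-bound 0 (series-⇒ z) λ n _ → ∥∥-weaken (go n) (proj₂ (sumτ-bounded B 0≤B) n)
  where
  go : ∀ n → ∥ series z n ∥≤ sumℚ n (τ B)
  go zero    = ∥∥-0
  go (suc n) = ∥∥-⊕ (go n) (∥term∥ h n)

-- For q ≤ 1 the ratio of consecutive terms is at most 1/3 from index 2 on, and 1½ is the sum of
-- that geometric series. Hence the remainder after two terms is at most 1½ · q²/2 = ¾ q².
1½ ¾ : ℚ
1½ = 1ℚ + ½
¾ = 1½ * ½

opaque
  unfolding inv
  tail-ratio : 1ℚ + 1½ * inv 3 ≤ 1½
  tail-ratio = ≤-refl

0≤1½ : 0ℚ ≤ 1½
0≤1½ = nonNegative⁻¹ 1½

series-2 : ∀ h → series h 2 ≈ ⌜ 1ℚ ⌝ ⊕ h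
series-2 h = ≈-trans (⊕-cong (⊕-identityˡ ⌜ 1ℚ ⌝) (⊗-cong (⌜⌝-cong inv-1) ≈-refl))
  (solveᶜ 1 (λ h → conᶜ 1ℚ ⊞ conᶜ 1ℚ ⊠ (h ⊠ conᶜ 1ℚ) ≔ conᶜ 1ℚ ⊞ h) ≈-refl h)

Exp-remainder : ∀ {h q} → ∥ h ∥≤ q → q ≤ 1ℚ → ∥ Exp h ⊖ (⌜ 1ℚ ⌝ ⊕ h) ∥≤ ¾ * (q * q)
Exp-remainder {h} {q} b q≤1 = ⇒-bound 2 (⇒-⊕ (series-⇒ h) (⇒-const ≈-refl)) λ n 2≤n →
  ∥∥-resp (⊖-congˡ (series-2 h)) (subst (λ n → ∥ series h n ⊖ series h 2 ∥≤ ¾ * (q * q)) (ℕₚ.m+[n∸m]≡n 2≤n)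
    (∥∥-weaken (series-gap b 2 (n ∸ 2)) (gap≤ (n ∸ 2))))
  where
  0≤q = ∥∥-nonNeg b
  ratio : ∀ n → 2 ℕ.≤ n → inv (suc n) * q ≤ inv 3
  ratio n 2≤n = ≤-trans (*-mono₀ {inv (suc n)} {inv 3} {q} {1ℚ} 0≤q (0≤inv 2) (inv-anti 2≤n) q≤1) (≤-reflexive (*-identityʳ (inv 3)))
  gap≤ : ∀ k → sumℚ (2 ℕ.+ k) (τ q) - sumℚ 2 (τ q) ≤ ¾ * (q * q)
  gap≤ k = begin
    s - s₂                       ≤⟨ +-monoˡ-≤ (- s₂) (p≤p+q s (nonNeg* 0≤1½ (0≤τ 0≤q (2 ℕ.+ k)))) ⟩
    s + 1½ * τ q (2 ℕ.+ k) - s₂  ≤⟨ +-monoˡ-≤ (- s₂) (τ-tail 0≤q 0≤1½ tail-ratio 2 ratio k) ⟩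
    s₂ + 1½ * τ q 2 - s₂         ≡⟨ solve 2 (λ s t → s :+ t :- s := t) refl s₂ (1½ * τ q 2) ⟩
    1½ * τ q 2                   ≡⟨ cong₂ (λ i j → 1½ * (i * (q * (j * (q * 1ℚ))))) inv-2 inv-1 ⟩
    1½ * (½ * (q * (1ℚ * (q * 1ℚ)))) ≡⟨ solve 1 (λ q → con 1½ :* (con ½ :* (q :* (con 1ℚ :* (q :* con 1ℚ)))) := con ¾ :* (q :* q)) refl q ⟩
    ¾ * (q * q)                  ∎
    where
    open ≤-Reasoning
    s s₂ : ℚ
    s = sumℚ (2 ℕ.+ k) (τ q)
    s₂ = sumℚ 2 (τ q)

-- The remainder estimate at q = 0 is already an equality.
Exp-0 : Exp ⌜ 0ℚ ⌝ ≈ ⌜ 1ℚ ⌝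
Exp-0 = ≈-trans (mk≈ (∥∥-≡ refl (Exp-remainder ∥∥-0 0≤1)))
  (solveᶜ 0 (conᶜ 1ℚ ⊞ conᶜ 0ℚ ≔ conᶜ 1ℚ) ≈-refl)

-- Applied to `term z` with first entry 0 it yields the derivatives zⁿ⁻¹ / (n - 1)! of the terms.
shift : ∀ {A : Set} → A → (ℕ → A) → ℕ → A
shift a f zero    = a
shift a f (suc n) = f n

⇒-shift : ∀ {x L} a → x ⇒ L → shift a x ⇒ L
⇒-shift {x} {L} a (mk⇒ h) = mk⇒ λ ε 0<ε → suc (proj₁ (h ε 0<ε)) , late (proj₁ (h ε 0<ε)) (proj₂ (h ε 0<ε))
  where
  late : ∀ {ε} N → (∀ n → N ℕ.≤ n → ∥ x n ⊖ L ∥≤ ε) → ∀ n → suc N ℕ.≤ n → ∥ shift a x n ⊖ L ∥≤ ε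
  late N b (suc n) (ℕ.s≤s N≤n) = b n N≤n

-- First-order Taylor remainder of wⁿ / n! at z with increment h.
remainder : ℂ → ℂ → ℕ → ℂ
remainder z h n = term (z ⊕ h) n ⊖ (term z n ⊕ h ⊗ shift ⌜ 0ℚ ⌝ (term z) n)

inv⊗fromℕ : ∀ n → ⌜ inv (suc n) ⌝ ⊗ (⌜ 1ℚ ⌝ ⊕ ⌜ fromℕ n ⌝) ≈ ⌜ 1ℚ ⌝
inv⊗fromℕ n = ≈-trans (⊗-congˡ (≈-trans (≈-sym (⌜⌝-+ 1ℚ (fromℕ n))) (⌜⌝-cong (sym (fromℕ-suc n)))))
  (≈-trans (≈-sym (⌜⌝-* (inv (suc n)) (fromℕ (suc n)))) (⌜⌝-cong (inv*fromℕ n)))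

term-shift : ∀ z n → z ⊗ shift ⌜ 0ℚ ⌝ (term z) n ≈ ⌜ fromℕ n ⌝ ⊗ term z n
term-shift z zero    = ≈-trans (solveᶜ 1 (λ z → z ⊠ conᶜ 0ℚ ≔ conᶜ 0ℚ ⊠ conᶜ 1ℚ) ≈-refl z) (⊗-cong (⌜⌝-cong (sym fromℕ-0)) ≈-refl)
term-shift z (suc n) = begin
  z ⊗ term z n                                            ≈⟨ ≈-sym (⊗-identityˡ _) ⟩
  ⌜ 1ℚ ⌝ ⊗ (z ⊗ term z n)                                 ≈⟨ ⊗-cong (≈-sym (inv⊗fromℕ n)) ≈-refl ⟩
  ⌜ inv (suc n) ⌝ ⊗ (⌜ 1ℚ ⌝ ⊕ ⌜ fromℕ n ⌝) ⊗ (z ⊗ term z n)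
    ≈⟨ solveᶜ 3 (λ i m t → i ⊠ (conᶜ 1ℚ ⊞ m) ⊠ t ≔ (conᶜ 1ℚ ⊞ m) ⊠ (i ⊠ t)) ≈-refl ⌜ inv (suc n) ⌝ ⌜ fromℕ n ⌝ (z ⊗ term z n) ⟩
  (⌜ 1ℚ ⌝ ⊕ ⌜ fromℕ n ⌝) ⊗ term z (suc n)                 ≈⟨ ⊗-cong (≈-trans (≈-sym (⌜⌝-+ 1ℚ (fromℕ n))) (⌜⌝-cong (sym (fromℕ-suc n)))) ≈-refl ⟩
  ⌜ fromℕ (suc n) ⌝ ⊗ term z (suc n)                      ∎
  where open ≈-Reasoning

-- Multiplication by (z + h) / (n + 1) carries the n-th Taylor polynomial to the next one, except
-- for the product of h with the linear part, which is the second-order term on the left.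
remainder-suc : ∀ z h n → ⌜ inv (suc n) ⌝ ⊗ ((z ⊕ h) ⊗ remainder z h n ⊕ h ⊗ (h ⊗ shift ⌜ 0ℚ ⌝ (term z) n)) ≈ remainder z h (suc n)
remainder-suc z h n = begin
  i ⊗ ((z ⊕ h) ⊗ (T ⊖ (t ⊕ h ⊗ p)) ⊕ h ⊗ (h ⊗ p))
    ≈⟨ solveᶜ 6 (λ i z h T t p → i ⊠ ((z ⊞ h) ⊠ (T ⊟ (t ⊞ h ⊠ p)) ⊞ h ⊠ (h ⊠ p)) ≔
         i ⊠ ((z ⊞ h) ⊠ T) ⊟ (i ⊠ (z ⊠ t) ⊞ i ⊠ h ⊠ (t ⊞ z ⊠ p))) ≈-refl i z h T t p ⟩
  i ⊗ ((z ⊕ h) ⊗ T) ⊖ (i ⊗ (z ⊗ t) ⊕ i ⊗ h ⊗ (t ⊕ z ⊗ p))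
    ≈⟨ ⊖-congˡ (⊕-congˡ (⊗-congˡ (⊕-congˡ (term-shift z n)))) ⟩
  i ⊗ ((z ⊕ h) ⊗ T) ⊖ (i ⊗ (z ⊗ t) ⊕ i ⊗ h ⊗ (t ⊕ ⌜ fromℕ n ⌝ ⊗ t))
    ≈⟨ ⊖-congˡ (⊕-congˡ (solveᶜ 4 (λ i h t m → i ⊠ h ⊠ (t ⊞ m ⊠ t) ≔ i ⊠ (conᶜ 1ℚ ⊞ m) ⊠ (h ⊠ t)) ≈-refl i h t ⌜ fromℕ n ⌝)) ⟩
  i ⊗ ((z ⊕ h) ⊗ T) ⊖ (i ⊗ (z ⊗ t) ⊕ i ⊗ (⌜ 1ℚ ⌝ ⊕ ⌜ fromℕ n ⌝) ⊗ (h ⊗ t))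
    ≈⟨ ⊖-congˡ (⊕-congˡ (≈-trans (⊗-cong (inv⊗fromℕ n) ≈-refl) (⊗-identityˡ _))) ⟩
  remainder z h (suc n) ∎
  where
  open ≈-Reasoning
  i T t p : ℂ
  i = ⌜ inv (suc n) ⌝
  T = term (z ⊕ h) n
  t = term z n
  p = shift ⌜ 0ℚ ⌝ (term z) n

-- Bⁿ⁻¹ / (n - 1)! and Bⁿ⁻² / (n - 2)!, the majorants of the first and second derivatives of the
-- terms.
τ₁ τ₂ : ℚ → ℕ → ℚ
τ₁ B = shift 0ℚ (τ B)
τ₂ B = shift 0ℚ (τ₁ B)

-- For n ≥ 1 equality holds with n - 1 in place of n. The rounding gives n τ₁ + τ₁ = (n + 1) τ₁ in
-- `∥remainder∥`, where n + 1 cancels against 1 / (n + 1).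
B*τ₂≤ : ∀ {B} → 0ℚ ≤ B → ∀ n → B * τ₂ B n ≤ fromℕ n * τ₁ B n
B*τ₂≤ {B} 0≤B zero = ≤-reflexive (trans (*-zeroʳ B) (sym (*-zeroʳ (fromℕ 0))))
B*τ₂≤ {B} 0≤B (suc zero) = subst (_≤ fromℕ 1 * 1ℚ) (sym (*-zeroʳ B)) (nonNeg* (0≤fromℕ 1) 0≤1)
B*τ₂≤ {B} 0≤B (suc (suc n)) = begin
  B * τ B n                                        ≡⟨ sym (*-identityˡ _) ⟩
  1ℚ * (B * τ B n)                                 ≡⟨ cong (_* (B * τ B n)) (sym (inv*fromℕ n)) ⟩
  inv (suc n) * fromℕ (suc n) * (B * τ B n)        ≡⟨ solve 3 (λ i m t → i :* m :* t := m :* (i :* t)) refl (inv (suc n)) (fromℕ (suc n)) (B * τ B n) ⟩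
  fromℕ (suc n) * τ B (suc n)                      ≤⟨ *-monoʳ₀ (τ B (suc n)) (0≤τ 0≤B (suc n)) (fromℕ-mono (ℕₚ.n≤1+n (suc n))) ⟩
  fromℕ (suc (suc n)) * τ B (suc n)                ∎
  where open ≤-Reasoning

∥remainder∥ : ∀ {z h B η} → ∥ z ∥≤ B → ∥ z ⊕ h ∥≤ B → ∥ h ∥≤ η → ∀ n → ∥ remainder z h n ∥≤ η * η * τ₂ B n
∥remainder∥ {z} {h} {B} {η} bz bzh bh zero = ∥∥-resp
  (solveᶜ 1 (λ h → conᶜ 0ℚ ≔ conᶜ 1ℚ ⊟ (conᶜ 1ℚ ⊞ h ⊠ conᶜ 0ℚ)) ≈-refl h)
  (∥∥-weaken ∥∥-0 (≤-reflexive (sym (*-zeroʳ (η * η)))))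
∥remainder∥ {z} {h} {B} {η} bz bzh bh (suc n) = ∥∥-resp (remainder-suc z h n)
  (∥∥-weaken (∥∥-⊗ (∥∥-⌜⌝⁺ (0≤inv n)) (∥∥-⊕ (∥∥-⊗ bzh (∥remainder∥ bz bzh bh n)) (∥∥-⊗ bh (∥∥-⊗ bh (∥shift∥ n))))) (begin
    i * (B * (η * η * τ₂ B n) + η * (η * τ₁ B n))
      ≡⟨ solve 5 (λ i B e s t → i :* (B :* (e :* e :* s) :+ e :* (e :* t)) := e :* e :* (i :* (B :* s :+ t))) refl i B η (τ₂ B n) (τ₁ B n) ⟩
    η * η * (i * (B * τ₂ B n + τ₁ B n))
      ≤⟨ *-monoˡ₀ (η * η) (square-nonNeg η) (*-monoˡ₀ i (0≤inv n) (+-monoˡ-≤ (τ₁ B n) (B*τ₂≤ 0≤B n))) ⟩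
    η * η * (i * (fromℕ n * τ₁ B n + τ₁ B n))
      ≡⟨ cong (η * η *_) (solve 3 (λ i m t → i :* (m :* t :+ t) := i :* (con 1ℚ :+ m) :* t) refl i (fromℕ n) (τ₁ B n)) ⟩
    η * η * (i * (1ℚ + fromℕ n) * τ₁ B n)
      ≡⟨ cong (λ m → η * η * (i * m * τ₁ B n)) (sym (fromℕ-suc n)) ⟩
    η * η * (i * fromℕ (suc n) * τ₁ B n)
      ≡⟨ cong (η * η *_) (trans (cong (_* τ₁ B n) (inv*fromℕ n)) (*-identityˡ (τ₁ B n))) ⟩
    η * η * τ₁ B n ∎))
  where
  open ≤-Reasoning
  0≤B = ∥∥-nonNeg bz
  i : ℚ
  i = inv (suc n)
  ∥shift∥ : ∀ n → ∥ shift ⌜ 0ℚ ⌝ (term z) n ∥≤ τ₁ B n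
  ∥shift∥ zero    = ∥∥-0
  ∥shift∥ (suc n) = ∥term∥ bz n

sumℚ-shift : ∀ {f S} → 0ℚ ≤ S → (∀ n → sumℚ n f ≤ S) → ∀ n → sumℚ n (shift 0ℚ f) ≤ S
sumℚ-shift {f} {S} 0≤S h zero    = 0≤S
sumℚ-shift {f} {S} 0≤S h (suc n) = subst (_≤ S) (sym (eq n)) (h n)
  where
  eq : ∀ n → sumℚ (suc n) (shift 0ℚ f) ≡ sumℚ n f
  eq zero    = refl
  eq (suc n) = cong (_+ f n) (eq n)

-- The Taylor remainders of the terms are summed, and the sum of the shifted terms again tends to
-- `Exp z`. The addition theorem is not involved, so that it can be deduced from this estimate.
Exp-step : ∀ {z h B η} (0≤B : 0ℚ ≤ B) → ∥ z ∥≤ B → ∥ z ⊕ h ∥≤ B → ∥ h ∥≤ η →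
           ∥ Exp (z ⊕ h) ⊖ (⌜ 1ℚ ⌝ ⊕ h) ⊗ Exp z ∥≤ η * η * expBound B 0≤B
Exp-step {z} {h} {B} {η} 0≤B bz bzh bh = ⇒-bound 0 limit λ n _ → ∥∥-weaken (∑ n) (bound n)
  where
  x : ℕ → ℂ
  x n = series (z ⊕ h) n ⊖ (series z n ⊕ h ⊗ shift ⌜ 0ℚ ⌝ (series z) n)
  limit : x ⇒ Exp (z ⊕ h) ⊖ (⌜ 1ℚ ⌝ ⊕ h) ⊗ Exp z
  limit = ⇒-resp 0 (λ _ _ → ≈-refl)
    (solveᶜ 3 (λ h E e → E ⊟ (e ⊞ h ⊠ e) ≔ E ⊟ (conᶜ 1ℚ ⊞ h) ⊠ e) ≈-refl h (Exp (z ⊕ h)) (Exp z))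
    (⇒-⊕ (series-⇒ (z ⊕ h)) (⇒-⊝ (⇒-⊕ (series-⇒ z) (⇒-⊗ (⇒-const ≈-refl) (⇒-shift ⌜ 0ℚ ⌝ (series-⇒ z))))))
  series-shift : ∀ n → shift ⌜ 0ℚ ⌝ (series z) (suc n) ≈ shift ⌜ 0ℚ ⌝ (series z) n ⊕ shift ⌜ 0ℚ ⌝ (term z) n
  series-shift zero    = solveᶜ 0 (conᶜ 0ℚ ≔ conᶜ 0ℚ ⊞ conᶜ 0ℚ) ≈-refl
  series-shift (suc n) = ≈-refl
  ∑ : ∀ n → ∥ x n ∥≤ η * η * sumℚ n (τ₂ B)
  ∑ zero = ∥∥-resp (solveᶜ 1 (λ h → conᶜ 0ℚ ≔ conᶜ 0ℚ ⊟ (conᶜ 0ℚ ⊞ h ⊠ conᶜ 0ℚ)) ≈-refl h) (∥∥-weaken ∥∥-0 (≤-reflexive (sym (*-zeroʳ (η * η)))))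
  ∑ (suc n) = ∥∥-≡ (sym (*-distribˡ-+ (η * η) (sumℚ n (τ₂ B)) (τ₂ B n))) (∥∥-resp
    (≈-trans
      (solveᶜ 7 (λ h E e s T t p → E ⊟ (e ⊞ h ⊠ s) ⊞ (T ⊟ (t ⊞ h ⊠ p)) ≔ (E ⊞ T) ⊟ ((e ⊞ t) ⊞ h ⊠ (s ⊞ p))) ≈-refl
        h (series (z ⊕ h) n) (series z n) (shift ⌜ 0ℚ ⌝ (series z) n) (term (z ⊕ h) n) (term z n) (shift ⌜ 0ℚ ⌝ (term z) n))
      (⊖-congˡ (⊕-congˡ (⊗-congˡ (≈-sym (series-shift n))))))
    (∥∥-⊕ (∑ n) (∥remainder∥ bz bzh bh n)))
  bound : ∀ n → η * η * sumℚ n (τ₂ B) ≤ η * η * expBound B 0≤B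
  bound n = *-monoˡ₀ (η * η) (square-nonNeg η)
    (sumℚ-shift (0≤expBound B 0≤B) (sumℚ-shift (0≤expBound B 0≤B) (proj₂ (sumτ-bounded B 0≤B))) n)

N*inv² : ∀ n a b → fromℕ (suc n) * (inv (suc n) * a * (inv (suc n) * a) * b) ≡ a * a * b * inv (suc n)
N*inv² n a b = trans
  (solve 4 (λ m i a b → m :* (i :* a :* (i :* a) :* b) := (i :* m) :* (a :* a :* b :* i)) refl (fromℕ (suc n)) (inv (suc n)) a b)
  (trans (cong (_* (a * a * b * inv (suc n))) (inv*fromℕ n)) (*-identityˡ _))

-- Along z + jw/N and w − jw/N the product of the two exponentials changes by O(N⁻²) in each of the N steps.
Exp-⊕ : ∀ z w → Exp (z ⊕ w) ≈ Exp z ⊗ Exp w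
Exp-⊕ z w = ⇒-unique (⇒-const ≈-refl) (⇒-resp 0 (λ _ _ → ≈-refl) ≈-refl close)
  where
  b c : ℚ
  b = fromℕ (proj₁ (∥∥-bounded z))
  c = fromℕ (proj₁ (∥∥-bounded w))
  bz = proj₂ (∥∥-bounded z)
  bw = proj₂ (∥∥-bounded w)
  0≤b : 0ℚ ≤ b
  0≤b = 0≤fromℕ (proj₁ (∥∥-bounded z))
  0≤c : 0ℚ ≤ c
  0≤c = 0≤fromℕ (proj₁ (∥∥-bounded w))
  B S : ℚ
  B = b + (c + c)
  0≤B : 0ℚ ≤ B
  0≤B = nonNeg+ 0≤b (nonNeg+ 0≤c 0≤c)
  S = expBound B 0≤B
  module Steps (n : ℕ) where
    N : ℕ
    N = suc n
    q : ℕ → ℚ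
    q j = fromℕ j * inv N
    0≤q : ∀ j → 0ℚ ≤ q j
    0≤q j = nonNeg* (0≤fromℕ j) (0≤inv n)
    q≤1 : ∀ {j} → j ℕ.≤ N → q j ≤ 1ℚ
    q≤1 {j} j≤N = subst (q j ≤_) (trans (*-comm (fromℕ N) (inv N)) (inv*fromℕ n)) (*-monoʳ₀ (inv N) (0≤inv n) (fromℕ-mono j≤N))
    q-suc : ∀ j → q (suc j) ≡ q j + inv N
    q-suc j = trans (cong (_* inv N) (fromℕ-suc j)) (solve 2 (λ m i → (con 1ℚ :+ m) :* i := m :* i :+ i) refl (fromℕ j) (inv N))
    h : ℂ
    h = ⌜ inv N ⌝ ⊗ w
    u v : ℕ → ℂ
    u j = z ⊕ ⌜ q j ⌝ ⊗ w
    v j = w ⊖ ⌜ q j ⌝ ⊗ w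
    u-suc : ∀ j → u (suc j) ≈ u j ⊕ h
    u-suc j = ≈-trans (⊕-congˡ (⊗-cong (≈-trans (⌜⌝-cong (q-suc j)) (⌜⌝-+ (q j) (inv N))) ≈-refl))
      (solveᶜ 4 (λ z w q i → z ⊞ (q ⊞ i) ⊠ w ≔ z ⊞ q ⊠ w ⊞ i ⊠ w) ≈-refl z w ⌜ q j ⌝ ⌜ inv N ⌝)
    v-suc : ∀ j → v j ≈ v (suc j) ⊕ h
    v-suc j = ≈-trans
      (solveᶜ 3 (λ w q i → w ⊟ q ⊠ w ≔ (w ⊟ (q ⊞ i) ⊠ w) ⊞ i ⊠ w) ≈-refl w ⌜ q j ⌝ ⌜ inv N ⌝)
      (⊕-cong (⊖-congˡ (⊗-cong (≈-sym (≈-trans (⌜⌝-cong (q-suc j)) (⌜⌝-+ (q j) (inv N)))) ≈-refl)) ≈-refl)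
    ∥qw∥ : ∀ {j} → j ℕ.≤ N → ∥ ⌜ q j ⌝ ⊗ w ∥≤ c
    ∥qw∥ {j} j≤N = ∥∥-weaken (∥∥-⊗ (∥∥-⌜⌝⁺ (0≤q j)) bw) (subst (q j * c ≤_) (*-identityˡ c) (*-monoʳ₀ c 0≤c (q≤1 j≤N)))
    ∥u∥ : ∀ {j} → j ℕ.≤ N → ∥ u j ∥≤ B
    ∥u∥ j≤N = ∥∥-weaken (∥∥-⊕ bz (∥qw∥ j≤N)) (+-monoʳ-≤ b (p≤p+q c 0≤c))
    ∥v∥ : ∀ {j} → j ℕ.≤ N → ∥ v j ∥≤ B
    ∥v∥ j≤N = ∥∥-weaken (∥∥-⊖ bw (∥qw∥ j≤N)) (q≤p+q (c + c) 0≤b)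
    ∥h∥ : ∥ h ∥≤ inv N * c
    ∥h∥ = ∥∥-⊗ (∥∥-⌜⌝⁺ (0≤inv n)) bw
    f : ℕ → ℂ
    f j = Exp (u j) ⊗ Exp (v j)
    step : ∀ j → j ℕ.< N → ∥ f (suc j) ⊖ f j ∥≤ inv N * c * (inv N * c) * (S * S + S * S)
    step j j<N = ∥∥-≡
      (solve 2 (λ e S → e :* e :* S :* S :+ S :* (e :* e :* S) := e :* e :* (S :* S :+ S :* S)) refl (inv N * c) S)
      (∥∥-resp (≈-trans
         -- Both first-order approximations contain (1 + h) A b′, which cancels and leaves two
         -- second-order errors.
         (solveᶜ 5 (λ h A A′ b b′ → (A′ ⊟ (conᶜ 1ℚ ⊞ h) ⊠ A) ⊠ b′ ⊟ A ⊠ (b ⊟ (conᶜ 1ℚ ⊞ h) ⊠ b′) ≔ A′ ⊠ b′ ⊟ A ⊠ b) ≈-refl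
           h (Exp (u j)) (Exp (u j ⊕ h)) (Exp (v (suc j) ⊕ h)) (Exp (v (suc j))))
         (⊕-cong (⊗-cong (Exp-cong (≈-sym (u-suc j))) ≈-refl) (⊝-cong (⊗-congˡ (Exp-cong (≈-sym (v-suc j)))))))
       (∥∥-⊖ (∥∥-⊗ (Exp-step 0≤B (∥u∥ (ℕₚ.<⇒≤ j<N)) (∥∥-resp (u-suc j) (∥u∥ j<N)) ∥h∥) (∥Exp∥ 0≤B (∥v∥ j<N)))
              (∥∥-⊗ (∥Exp∥ 0≤B (∥u∥ (ℕₚ.<⇒≤ j<N))) (Exp-step 0≤B (∥v∥ j<N) (∥∥-resp (v-suc j) (∥v∥ (ℕₚ.<⇒≤ j<N))) ∥h∥))))
    q-0 : ⌜ q 0 ⌝ ≈ ⌜ 0ℚ ⌝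
    q-0 = ⌜⌝-cong (trans (cong (_* inv N) fromℕ-0) (*-zeroˡ (inv N)))
    q-N : ⌜ q N ⌝ ≈ ⌜ 1ℚ ⌝
    q-N = ⌜⌝-cong (trans (*-comm (fromℕ N) (inv N)) (inv*fromℕ n))
    f-0 : f 0 ≈ Exp z ⊗ Exp w
    f-0 = ⊗-cong
      (Exp-cong (≈-trans (⊕-congˡ (⊗-cong q-0 ≈-refl)) (solveᶜ 2 (λ z w → z ⊞ conᶜ 0ℚ ⊠ w ≔ z) ≈-refl z w)))
      (Exp-cong (≈-trans (⊖-congˡ (⊗-cong q-0 ≈-refl)) (solveᶜ 1 (λ w → w ⊟ conᶜ 0ℚ ⊠ w ≔ w) ≈-refl w)))
    f-N : f N ≈ Exp (z ⊕ w)
    f-N = ≈-trans (⊗-cong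
      (Exp-cong (⊕-congˡ (≈-trans (⊗-cong q-N ≈-refl) (⊗-identityˡ w))))
      (≈-trans (Exp-cong (≈-trans (⊖-congˡ (⊗-cong q-N ≈-refl)) (solveᶜ 1 (λ w → w ⊟ conᶜ 1ℚ ⊠ w ≔ conᶜ 0ℚ) ≈-refl w))) Exp-0))
      (solveᶜ 1 (λ e → e ⊠ conᶜ 1ℚ ≔ e) ≈-refl (Exp (z ⊕ w)))
    total : ∥ Exp (z ⊕ w) ⊖ Exp z ⊗ Exp w ∥≤ c * c * (S * S + S * S) * inv (suc n)
    total = ∥∥-≡ (N*inv² n c (S * S + S * S)) (∥∥-resp (⊕-cong f-N (⊝-cong f-0)) (telescopeᶜ f N step))
  close : (λ _ → Exp (z ⊕ w)) ⇒ Exp z ⊗ Exp w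
  close = ⇒-inv (c * c * (S * S + S * S)) (nonNeg* (square-nonNeg c) (nonNeg+ (square-nonNeg S) (square-nonNeg S))) 0 λ n _ → Steps.total n

-- e^{iπ/2} = i

Exp-⊝ : ∀ z → Exp z ⊗ Exp (⊝ z) ≈ ⌜ 1ℚ ⌝
Exp-⊝ z = ≈-trans (≈-sym (Exp-⊕ z (⊝ z)))
  (≈-trans (Exp-cong (solveᶜ 1 (λ z → z ⊟ z ≔ conᶜ 0ℚ) ≈-refl z)) Exp-0)

¾≤1 : ¾ ≤ 1ℚ
¾≤1 = p≤p+q ¾ (nonNegative⁻¹ (½ * ½))

Exp-near-1 : ∀ {h q} → ∥ h ∥≤ q → q ≤ 1ℚ → ∥ Exp h ⊖ ⌜ 1ℚ ⌝ ∥≤ q + q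
Exp-near-1 {h} {q} b q≤1 = ∥∥-resp (solveᶜ 2 (λ E h → (E ⊟ (conᶜ 1ℚ ⊞ h)) ⊞ h ≔ E ⊟ conᶜ 1ℚ) ≈-refl (Exp h) h)
  (∥∥-weaken (∥∥-⊕ (Exp-remainder b q≤1) b) (+-monoˡ-≤ q (begin
    ¾ * (q * q)   ≤⟨ *-monoʳ₀ {¾} {1ℚ} (q * q) (square-nonNeg q) ¾≤1 ⟩
    1ℚ * (q * q)  ≡⟨ *-identityˡ (q * q) ⟩
    q * q         ≤⟨ *-monoˡ₀ q (∥∥-nonNeg b) q≤1 ⟩
    q * 1ℚ        ≡⟨ *-identityʳ q ⟩
    q             ∎)))
  where open ≤-Reasoning

-- By the addition theorem, continuity at L reduces to continuity at 0.
Exp-continuous : ∀ {x L} → x ⇒ L → (λ n → Exp (x n)) ⇒ Exp L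
Exp-continuous {x} {L} (mk⇒ h) = mk⇒ λ ε 0<ε →
  let d , 0<d , d≤1 , le = small (S + S) (nonNeg+ 0≤S 0≤S) ε 0<ε
      N , b = h d 0<d
  in N , λ n N≤n → ∥∥-weaken
       (∥∥-resp (≈-trans (solveᶜ 2 (λ E e → E ⊠ (e ⊟ conᶜ 1ℚ) ≔ E ⊠ e ⊟ E) ≈-refl (Exp L) (Exp (x n ⊖ L)))
           (⊕-cong (≈-trans (≈-sym (Exp-⊕ L (x n ⊖ L))) (Exp-cong (solveᶜ 2 (λ x L → L ⊞ (x ⊟ L) ≔ x) ≈-refl (x n) L))) ≈-refl))
         (∥∥-⊗ (∥Exp∥ 0≤B (proj₂ (∥∥-bounded L))) (Exp-near-1 (b n N≤n) d≤1)))
       (≤-trans (≤-reflexive (solve 2 (λ S d → S :* (d :+ d) := (S :+ S) :* d) refl S d)) le)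
  where
  0≤B = 0≤fromℕ (proj₁ (∥∥-bounded L))
  S : ℚ
  S = expBound (fromℕ (proj₁ (∥∥-bounded L))) 0≤B
  0≤S : 0ℚ ≤ S
  0≤S = 0≤expBound (fromℕ (proj₁ (∥∥-bounded L))) 0≤B

opaque
  Π : ℂ
  Π = πᶜ

opaque
  unfolding _⊕_ Π

  norm-gap-Π : ∀ n k → norm (⌜ πSum n ⌝ ⊖ Π) k ≡ ∣ πSum n - πSum k ∣
  norm-gap-Π n k = +-identityʳ (∣ πSum n - πSum k ∣)

  norm-Π : ∀ k → norm Π k ≡ ∣ πSum k ∣
  norm-Π k = +-identityʳ (∣ πSum k ∣)

πSum-⇒ : (λ n → ⌜ πSum n ⌝) ⇒ Π
πSum-⇒ = mk⇒ λ ε 0<ε → proj₁ (π-cauchy ε 0<ε) , λ n N≤n → mkBound λ δ 0<δ → proj₁ (π-cauchy ε 0<ε) , λ k N≤k →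
  ≤-trans (≤-reflexive (norm-gap-Π n k)) (≤-trans (proj₂ (π-cauchy ε 0<ε) n k N≤n N≤k) (p≤p+q ε (<⇒≤ 0<δ)))

2ℚ 4ℚ : ℚ
2ℚ = 1ℚ + 1ℚ
4ℚ = 2ℚ + 2ℚ

0≤2 : 0ℚ ≤ 2ℚ
0≤2 = nonNegative⁻¹ 2ℚ

0≤4 : 0ℚ ≤ 4ℚ
0≤4 = nonNegative⁻¹ 4ℚ

opaque
  unfolding fromℕ
  fromℕ-4 : fromℕ 4 ≡ 4ℚ
  fromℕ-4 = refl

ρ : ℚ → ℚ
ρ x = recip (1ℚ + x * x)

ρ* : ∀ x → ρ x * (1ℚ + x * x) ≡ 1ℚ
ρ* x = recip* (0<1+x² x)

0≤ρ : ∀ x → 0ℚ ≤ ρ x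
0≤ρ x = <⇒≤ (0<recip (0<1+x² x))

ρ≤1 : ∀ x → ρ x ≤ 1ℚ
ρ≤1 x = recip-anti {1ℚ} {1ℚ + x * x} 0<1 (p≤p+q 1ℚ (square-nonNeg x))

-- κ x = 1/(1 − ix), so that (1 + ix)/(1 − ix) = 2 κ x − 1 = cayley x.
κ cayley : ℚ → ℂ
κ x = ⌜ ρ x ⌝ ⊗ (⌜ 1ℚ ⌝ ⊕ ι ⊗ ⌜ x ⌝)
cayley x = ⌜ 2ℚ ⌝ ⊗ κ x ⊖ ⌜ 1ℚ ⌝

κ-inverse : ∀ x → κ x ⊗ (⌜ 1ℚ ⌝ ⊖ ι ⊗ ⌜ x ⌝) ≈ ⌜ 1ℚ ⌝
κ-inverse x = begin
  κ x ⊗ (⌜ 1ℚ ⌝ ⊖ ι ⊗ ⌜ x ⌝)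
    ≈⟨ solveᶜ 3 (λ r i x → r ⊠ (conᶜ 1ℚ ⊞ i ⊠ x) ⊠ (conᶜ 1ℚ ⊟ i ⊠ x) ≔ r ⊠ (conᶜ 1ℚ ⊟ (i ⊠ i) ⊠ (x ⊠ x))) ≈-refl ⌜ ρ x ⌝ ι ⌜ x ⌝ ⟩
  ⌜ ρ x ⌝ ⊗ (⌜ 1ℚ ⌝ ⊖ (ι ⊗ ι) ⊗ (⌜ x ⌝ ⊗ ⌜ x ⌝))
    ≈⟨ ⊗-congˡ (≈-trans (⊖-congˡ (⊗-cong ι² ≈-refl))
         (solveᶜ 1 (λ x → conᶜ 1ℚ ⊟ (⊟ conᶜ 1ℚ) ⊠ (x ⊠ x) ≔ conᶜ 1ℚ ⊞ x ⊠ x) ≈-refl ⌜ x ⌝)) ⟩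
  ⌜ ρ x ⌝ ⊗ (⌜ 1ℚ ⌝ ⊕ ⌜ x ⌝ ⊗ ⌜ x ⌝)
    ≈⟨ ⊗-congˡ (≈-sym (≈-trans (⌜⌝-+ 1ℚ (x * x)) (⊕-congˡ (⌜⌝-* x x)))) ⟩
  ⌜ ρ x ⌝ ⊗ ⌜ 1ℚ + x * x ⌝
    ≈⟨ ≈-trans (≈-sym (⌜⌝-* (ρ x) (1ℚ + x * x))) (⌜⌝-cong (ρ* x)) ⟩
  ⌜ 1ℚ ⌝ ∎
  where open ≈-Reasoning

∥κ∥ : ∀ {x} → 0ℚ ≤ x → x ≤ 1ℚ → ∥ κ x ∥≤ 2ℚ
∥κ∥ {x} 0≤x x≤1 = ∥∥-weaken (∥∥-⊗ (∥∥-⌜⌝⁺ (0≤ρ x)) (∥∥-⊕ ∥∥-1 (∥∥-⊗ ∥∥-ι (∥∥-⌜⌝⁺ 0≤x)))) (begin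
  ρ x * (1ℚ + 1ℚ * x)  ≤⟨ *-mono₀ {ρ x} {1ℚ} {1ℚ + 1ℚ * x} {2ℚ} (nonNeg+ 0≤1 (nonNeg* 0≤1 0≤x)) 0≤1 (ρ≤1 x)
                             (+-monoʳ-≤ 1ℚ (subst (_≤ 1ℚ) (sym (*-identityˡ x)) x≤1)) ⟩
  1ℚ * 2ℚ              ≡⟨ *-identityˡ 2ℚ ⟩
  2ℚ                   ∎)
  where open ≤-Reasoning

∥cayley∥ : ∀ {x} → 0ℚ ≤ x → x ≤ 1ℚ → ∥ cayley x ∥≤ 4ℚ + 1ℚ
∥cayley∥ 0≤x x≤1 = ∥∥-⊖ (∥∥-⊗ (∥∥-⌜⌝⁺ 0≤2) (∥κ∥ 0≤x x≤1)) ∥∥-1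

-- With κ* the conjugate of κ, ρ = κ κ* and the Cayley transform is κ / κ*.
ρ⊗cayley : ∀ x → ⌜ ρ x ⌝ ⊗ cayley x ≈ κ x ⊗ κ x
ρ⊗cayley x = begin
  r ⊗ (⌜ 2ℚ ⌝ ⊗ κ x ⊖ ⌜ 1ℚ ⌝)                              ≈⟨ ⊗-congˡ (⊖-congˡ (≈-sym (κ-inverse x))) ⟩
  r ⊗ (⌜ 2ℚ ⌝ ⊗ κ x ⊖ κ x ⊗ (⌜ 1ℚ ⌝ ⊖ ι ⊗ ⌜ x ⌝))
    ≈⟨ solveᶜ 3 (λ r a y → r ⊠ (conᶜ 2ℚ ⊠ a ⊟ a ⊠ (conᶜ 1ℚ ⊟ y)) ≔ (r ⊠ (conᶜ 1ℚ ⊞ y)) ⊠ a) ≈-refl r (κ x) (ι ⊗ ⌜ x ⌝) ⟩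
  κ x ⊗ κ x                                                ∎
  where
  open ≈-Reasoning
  r : ℂ
  r = ⌜ ρ x ⌝

-- Resolvent identity: reciprocals differ by their product with the difference of the denominators,
-- here ih.
κ-diff : ∀ x h → κ (x + h) ⊖ κ x ≈ κ x ⊗ κ (x + h) ⊗ (ι ⊗ ⌜ h ⌝)
κ-diff x h = begin
  κ′ ⊖ κ x
    ≈⟨ solveᶜ 2 (λ a a′ → a′ ⊟ a ≔ conᶜ 1ℚ ⊠ a′ ⊟ conᶜ 1ℚ ⊠ a) ≈-refl (κ x) κ′ ⟩
  ⌜ 1ℚ ⌝ ⊗ κ′ ⊖ ⌜ 1ℚ ⌝ ⊗ κ x
    ≈⟨ ⊕-cong (⊗-cong (≈-sym (κ-inverse x)) ≈-refl) (⊝-cong (⊗-cong (≈-sym (≈-trans (⊗-congˡ (⊖-congˡ (⊗-congˡ (≈-sym (⌜⌝-+ x h))))) (κ-inverse (x + h)))) ≈-refl)) ⟩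
  κ x ⊗ (⌜ 1ℚ ⌝ ⊖ ι ⊗ ⌜ x ⌝) ⊗ κ′ ⊖ κ′ ⊗ (⌜ 1ℚ ⌝ ⊖ ι ⊗ (⌜ x ⌝ ⊕ ⌜ h ⌝)) ⊗ κ x
    ≈⟨ solveᶜ 5 (λ a a′ i x h → a ⊠ (conᶜ 1ℚ ⊟ i ⊠ x) ⊠ a′ ⊟ a′ ⊠ (conᶜ 1ℚ ⊟ i ⊠ (x ⊞ h)) ⊠ a ≔ a ⊠ a′ ⊠ (i ⊠ h)) ≈-refl (κ x) κ′ ι ⌜ x ⌝ ⌜ h ⌝ ⟩
  κ x ⊗ κ′ ⊗ (ι ⊗ ⌜ h ⌝) ∎
  where
  open ≈-Reasoning
  κ′ : ℂ
  κ′ = κ (x + h)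

-- cayley solves y′ = 2iρy, and the error of one Euler step is of second order.
cayley-euler : ∀ x h → cayley (x + h) ⊖ (⌜ 1ℚ ⌝ ⊕ ι ⊗ (⌜ 2ℚ ⌝ ⊗ ⌜ h ⌝ ⊗ ⌜ ρ x ⌝)) ⊗ cayley x
          ≈ ⌜ 2ℚ ⌝ ⊗ (ι ⊗ ⌜ h ⌝) ⊗ κ x ⊗ (κ x ⊗ κ (x + h) ⊗ (ι ⊗ ⌜ h ⌝))
cayley-euler x h = begin
  cayley (x + h) ⊖ (⌜ 1ℚ ⌝ ⊕ ι ⊗ (⌜ 2ℚ ⌝ ⊗ ⌜ h ⌝ ⊗ ⌜ ρ x ⌝)) ⊗ cayley x
    ≈⟨ solveᶜ 5 (λ a a′ i h r → (conᶜ 2ℚ ⊠ a′ ⊟ conᶜ 1ℚ) ⊟ (conᶜ 1ℚ ⊞ i ⊠ (conᶜ 2ℚ ⊠ h ⊠ r)) ⊠ (conᶜ 2ℚ ⊠ a ⊟ conᶜ 1ℚ) ≔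
         conᶜ 2ℚ ⊠ (a′ ⊟ a) ⊟ conᶜ 2ℚ ⊠ (i ⊠ h) ⊠ (r ⊠ (conᶜ 2ℚ ⊠ a ⊟ conᶜ 1ℚ))) ≈-refl (κ x) κ′ ι ⌜ h ⌝ ⌜ ρ x ⌝ ⟩
  ⌜ 2ℚ ⌝ ⊗ (κ′ ⊖ κ x) ⊖ ⌜ 2ℚ ⌝ ⊗ (ι ⊗ ⌜ h ⌝) ⊗ (⌜ ρ x ⌝ ⊗ cayley x)
    ≈⟨ ⊕-cong (⊗-congˡ (κ-diff x h)) (⊝-cong (⊗-congˡ (ρ⊗cayley x))) ⟩
  ⌜ 2ℚ ⌝ ⊗ (κ x ⊗ κ′ ⊗ (ι ⊗ ⌜ h ⌝)) ⊖ ⌜ 2ℚ ⌝ ⊗ (ι ⊗ ⌜ h ⌝) ⊗ (κ x ⊗ κ x)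
    ≈⟨ solveᶜ 3 (λ a a′ y → conᶜ 2ℚ ⊠ (a ⊠ a′ ⊠ y) ⊟ conᶜ 2ℚ ⊠ y ⊠ (a ⊠ a) ≔ conᶜ 2ℚ ⊠ y ⊠ a ⊠ (a′ ⊟ a)) ≈-refl (κ x) κ′ (ι ⊗ ⌜ h ⌝) ⟩
  ⌜ 2ℚ ⌝ ⊗ (ι ⊗ ⌜ h ⌝) ⊗ κ x ⊗ (κ′ ⊖ κ x)
    ≈⟨ ⊗-congˡ (κ-diff x h) ⟩
  ⌜ 2ℚ ⌝ ⊗ (ι ⊗ ⌜ h ⌝) ⊗ κ x ⊗ (κ x ⊗ κ′ ⊗ (ι ⊗ ⌜ h ⌝)) ∎
  where
  open ≈-Reasoning
  κ′ : ℂ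
  κ′ = κ (x + h)

cayley-0 : cayley 0ℚ ≈ ⌜ 1ℚ ⌝
cayley-0 = solveᶜ 1 (λ i → conᶜ 2ℚ ⊠ (conᶜ 1ℚ ⊠ (conᶜ 1ℚ ⊞ i ⊠ conᶜ 0ℚ)) ⊟ conᶜ 1ℚ ≔ conᶜ 1ℚ) ≈-refl ι

cayley-1 : cayley 1ℚ ≈ ι
cayley-1 = solveᶜ 1 (λ i → conᶜ 2ℚ ⊠ (conᶜ ½ ⊠ (conᶜ 1ℚ ⊞ i ⊠ conᶜ 1ℚ)) ⊟ conᶜ 1ℚ ≔ i) ≈-refl ι

-- The step is ½ to the power n + 1 and not n, because `Exp-remainder` is applied to increments of
-- size 2h, which must not exceed 1.
module EulerSteps (n : ℕ) where
  h : ℚ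
  h = ½ ^ℚ suc n
  0≤h : 0ℚ ≤ h
  0≤h = <⇒≤ (0<½^ (suc n))
  N : ℕ
  N = 2 ℕ.^ suc n
  x : ℕ → ℚ
  x j = fromℕ j * h
  0≤x : ∀ j → 0ℚ ≤ x j
  0≤x j = nonNeg* (0≤fromℕ j) 0≤h
  x-N : x N ≡ 1ℚ
  x-N = 2^*½^ (suc n)
  x≤1 : ∀ {j} → j ℕ.≤ N → x j ≤ 1ℚ
  x≤1 {j} j≤N = subst (x j ≤_) x-N (*-monoʳ₀ h 0≤h (fromℕ-mono j≤N))
  x-suc : ∀ j → x (suc j) ≡ x j + h
  x-suc j = trans (cong (_* h) (fromℕ-suc j)) (solve 2 (λ m i → (con 1ℚ :+ m) :* i := m :* i :+ i) refl (fromℕ j) h)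
  -- θ j is half the Riemann sum over the first j subintervals, so that θ N is half of
  -- `πSum (suc n)`. As the integrand is 4ρ, the increment g j is 2hρ, the very factor of the Euler
  -- step in `cayley-euler`.
  g θ : ℕ → ℚ
  g j = 2ℚ * h * ρ (x j)
  θ j = ½ * (h * sumℚ j (λ k → πIntegrand (x k)))
  θ-suc : ∀ j → θ (suc j) ≡ θ j + g j
  θ-suc j = trans (cong (λ c → ½ * (h * (s + c * ρ (x j)))) fromℕ-4)
    (solve 3 (λ h s r → con ½ :* (h :* (s :+ con 4ℚ :* r)) := con ½ :* (h :* s) :+ con 2ℚ :* h :* r) refl h s (ρ (x j)))
    where
    s : ℚ
    s = sumℚ j (λ k → πIntegrand (x k))
  0≤g : ∀ j → 0ℚ ≤ g j
  0≤g j = nonNeg* (nonNeg* 0≤2 0≤h) (0≤ρ (x j))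
  g≤2h : ∀ j → g j ≤ 2ℚ * h
  g≤2h j = subst (g j ≤_) (*-identityʳ (2ℚ * h)) (*-monoˡ₀ (2ℚ * h) (nonNeg* 0≤2 0≤h) (ρ≤1 (x j)))
  2h≤1 : 2ℚ * h ≤ 1ℚ
  2h≤1 = subst (_≤ 1ℚ) (solve 1 (λ h → h := con 2ℚ :* (h :* con ½)) refl (½ ^ℚ n)) (½^-anti {0} {n} ℕ.z≤n)
  θ≤2x : ∀ j → θ j ≤ 2ℚ * x j
  θ≤2x zero = ≤-reflexive (trans (solve 1 (λ h → con ½ :* (h :* con 0ℚ) := con 2ℚ :* (con 0ℚ :* h)) refl h) (cong (λ t → 2ℚ * (t * h)) (sym fromℕ-0)))
  θ≤2x (suc j) = subst₂ _≤_ (sym (θ-suc j)) (trans (solve 2 (λ x h → con 2ℚ :* x :+ con 2ℚ :* h := con 2ℚ :* (x :+ h)) refl (x j) h) (cong (2ℚ *_) (sym (x-suc j))))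
    (+-mono-≤ (θ≤2x j) (g≤2h j))
  0≤θ : ∀ j → 0ℚ ≤ θ j
  0≤θ zero = ≤-reflexive (solve 1 (λ h → con 0ℚ := con ½ :* (h :* con 0ℚ)) refl h)
  0≤θ (suc j) = subst (0ℚ ≤_) (sym (θ-suc j)) (nonNeg+ (0≤θ j) (0≤g j))
  ∥iθ∥ : ∀ {j} → j ℕ.≤ N → ∥ ⊝ (ι ⊗ ⌜ θ j ⌝) ∥≤ 2ℚ
  ∥iθ∥ {j} j≤N = ∥∥-⊝ (∥∥-weaken (∥∥-⊗ ∥∥-ι (∥∥-⌜⌝⁺ (0≤θ j))) (≤-trans (≤-reflexive (*-identityˡ (θ j)))
    (≤-trans (θ≤2x j) (*-monoˡ₀ 2ℚ 0≤2 (x≤1 j≤N)))))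
  K : ℚ
  K = expBound 2ℚ 0≤2
  c : ℕ → ℂ
  c j = Exp (⊝ (ι ⊗ ⌜ θ j ⌝)) ⊗ cayley (x j)
  ig : ℕ → ℂ
  ig j = ι ⊗ ⌜ g j ⌝
  ∥ig∥ : ∀ j → ∥ ig j ∥≤ 2ℚ * h
  ∥ig∥ j = ∥∥-weaken (∥∥-⊗ ∥∥-ι (∥∥-⌜⌝⁺ (0≤g j))) (≤-trans (≤-reflexive (*-identityˡ (g j))) (g≤2h j))
  E : ℕ → ℂ
  E j = Exp (⊝ (ι ⊗ ⌜ θ j ⌝))
  E-suc : ∀ j → E j ≈ E (suc j) ⊗ Exp (ig j)
  E-suc j = ≈-trans (Exp-cong (≈-trans (solveᶜ 3 (λ i t g → ⊟ (i ⊠ t) ≔ (⊟ (i ⊠ (t ⊞ g))) ⊞ i ⊠ g) ≈-refl ι ⌜ θ j ⌝ ⌜ g j ⌝)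
      (⊕-cong (⊝-cong (⊗-congˡ (≈-trans (≈-sym (⌜⌝-+ (θ j) (g j))) (⌜⌝-cong (sym (θ-suc j)))))) ≈-refl)))
    (Exp-⊕ _ (ig j))
  -- 4 · 4 is the error of the Euler step, ¾′ that of replacing `Exp (ig)` by 1 + ig for ∥ ig ∥≤ 2h,
  -- and 4 + 1 bounds the Cayley transform; K bounds the turning factor.
  ¾′ C : ℚ
  ¾′ = ¾ * (2ℚ * 2ℚ)
  C = K * (4ℚ * 4ℚ + ¾′ * (4ℚ + 1ℚ))
  euler : ∀ j → j ℕ.< N → ∥ cayley (x (suc j)) ⊖ (⌜ 1ℚ ⌝ ⊕ ig j) ⊗ cayley (x j) ∥≤ 4ℚ * 4ℚ * (h * h)
  euler j j<N = ∥∥-≡ (solve 1 (λ h → con 2ℚ :* (con 1ℚ :* h) :* con 2ℚ :* (con 2ℚ :* con 2ℚ :* (con 1ℚ :* h)) := con 4ℚ :* con 4ℚ :* (h :* h)) refl h)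
    (∥∥-resp (≈-sym (≈-trans (⊕-cong (≈-reflexive (cong cayley (x-suc j))) (⊝-cong (⊗-cong (⊕-congˡ (⊗-congˡ
        (≈-trans (⌜⌝-* (2ℚ * h) (ρ (x j))) (⊗-cong (⌜⌝-* 2ℚ h) ≈-refl)))) ≈-refl))) (cayley-euler (x j) h)))
      (∥∥-⊗ (∥∥-⊗ (∥∥-⊗ (∥∥-⌜⌝⁺ 0≤2) ∥ih∥) ∥κⱼ∥) (∥∥-⊗ (∥∥-⊗ ∥κⱼ∥ (subst (λ y → ∥ κ y ∥≤ 2ℚ) (x-suc j) (∥κ∥ (0≤x (suc j)) (x≤1 j<N)))) ∥ih∥)))
    where
    ∥ih∥ = ∥∥-⊗ ∥∥-ι (∥∥-⌜⌝⁺ 0≤h)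
    ∥κⱼ∥ = ∥κ∥ (0≤x j) (x≤1 (ℕₚ.<⇒≤ j<N))
  step : ∀ j → j ℕ.< N → ∥ c (suc j) ⊖ c j ∥≤ C * (h * h)
  step j j<N = ∥∥-≡ (solve 2 (λ K h → K :* (con 4ℚ :* con 4ℚ :* (h :* h) :+ con ¾ :* (con 2ℚ :* h :* (con 2ℚ :* h)) :* (con 4ℚ :+ con 1ℚ))
        := K :* (con 4ℚ :* con 4ℚ :+ con ¾ :* (con 2ℚ :* con 2ℚ) :* (con 4ℚ :+ con 1ℚ)) :* (h :* h)) refl K h)
    (∥∥-resp (≈-trans
        (solveᶜ 5 (λ E r r′ e g → E ⊠ ((r′ ⊟ (conᶜ 1ℚ ⊞ g) ⊠ r) ⊟ (e ⊟ (conᶜ 1ℚ ⊞ g)) ⊠ r) ≔ E ⊠ r′ ⊟ (E ⊠ e) ⊠ r) ≈-refl (E (suc j)) (cayley (x j)) (cayley (x (suc j))) (Exp (ig j)) (ig j))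
        (⊖-congˡ (⊗-cong (≈-sym (E-suc j)) ≈-refl)))
      (∥∥-⊗ (∥Exp∥ 0≤2 (∥iθ∥ j<N)) (∥∥-⊖ (euler j j<N) (∥∥-⊗ (Exp-remainder (∥ig∥ j) 2h≤1) (∥cayley∥ (0≤x j) (x≤1 (ℕₚ.<⇒≤ j<N)))))))
  c-0 : c 0 ≈ ⌜ 1ℚ ⌝
  c-0 = ≈-trans (⊗-cong
      (≈-trans (Exp-cong (≈-trans (⊝-cong (⊗-congˡ (⌜⌝-cong (solve 1 (λ h → con ½ :* (h :* con 0ℚ) := con 0ℚ) refl h)))) (solveᶜ 1 (λ i → ⊟ (i ⊠ conᶜ 0ℚ) ≔ conᶜ 0ℚ) ≈-refl ι))) Exp-0)
      (≈-trans (≈-reflexive (cong cayley (trans (cong (_* h) fromℕ-0) (*-zeroˡ h)))) cayley-0))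
    (⊗-identityˡ ⌜ 1ℚ ⌝)
  c-N : c N ≈ Exp (⊝ (ι ⊗ (⌜ ½ ⌝ ⊗ ⌜ πSum (suc n) ⌝))) ⊗ ι
  c-N = ⊗-cong (Exp-cong (⊝-cong (⊗-congˡ (⌜⌝-* ½ (πSum (suc n)))))) (≈-trans (≈-reflexive (cong cayley x-N)) cayley-1)
  total : ∥ Exp (⊝ (ι ⊗ (⌜ ½ ⌝ ⊗ ⌜ πSum (suc n) ⌝))) ⊗ ι ⊖ ⌜ 1ℚ ⌝ ∥≤ C * ½ ^ℚ suc n
  total = ∥∥-≡ (trans (solve 3 (λ m C h → m :* (C :* (h :* h)) := (m :* h) :* (C :* h)) refl (fromℕ N) C h)
      (trans (cong (_* (C * h)) x-N) (*-identityˡ (C * h))))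
    (∥∥-resp (⊕-cong c-N (⊝-cong c-0)) (telescopeᶜ c N step))

Exp-iπ/2 : Exp (ι ⊗ (⌜ ½ ⌝ ⊗ Π)) ≈ ι
Exp-iπ/2 = begin
  Exp z                       ≈⟨ solveᶜ 1 (λ e → e ≔ e ⊠ conᶜ 1ℚ) ≈-refl (Exp z) ⟩
  Exp z ⊗ ⌜ 1ℚ ⌝              ≈⟨ ⊗-congˡ (≈-sym main) ⟩
  Exp z ⊗ (Exp (⊝ z) ⊗ ι)     ≈⟨ ≈-sym (⊗-assoc _ _ _) ⟩
  Exp z ⊗ Exp (⊝ z) ⊗ ι       ≈⟨ ⊗-cong (Exp-⊝ z) ≈-refl ⟩
  ⌜ 1ℚ ⌝ ⊗ ι                  ≈⟨ ⊗-identityˡ ι ⟩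
  ι                           ∎
  where
  open ≈-Reasoning
  z : ℂ
  z = ι ⊗ (⌜ ½ ⌝ ⊗ Π)
  x : ℕ → ℂ
  x n = Exp (⊝ (ι ⊗ (⌜ ½ ⌝ ⊗ ⌜ πSum n ⌝))) ⊗ ι
  -- The constant C does not depend on n, so that its value at 0 serves all step sizes.
  0≤C : 0ℚ ≤ EulerSteps.C 0
  0≤C = nonNeg* (0≤expBound 2ℚ 0≤2) (nonNegative⁻¹ (4ℚ * 4ℚ + ¾ * (2ℚ * 2ℚ) * (4ℚ + 1ℚ)))
  main : Exp (⊝ z) ⊗ ι ≈ ⌜ 1ℚ ⌝
  main = ⇒-unique
    (⇒-⊗ (Exp-continuous (⇒-⊝ (⇒-⊗ (⇒-const ≈-refl) (⇒-⊗ (⇒-const ≈-refl) πSum-⇒)))) (⇒-const ≈-refl))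
    (⇒-½^ (EulerSteps.C 0) 0≤C 1 λ where
      zero ()
      (suc n) _ → EulerSteps.total n)

-- Euler's product for the sine

prod : ℕ → (ℕ → ℂ) → ℂ
prod zero    f = ⌜ 1ℚ ⌝
prod (suc n) f = prod n f ⊗ f n

prod-cong : ∀ n {f g} → (∀ k → k ℕ.< n → f k ≈ g k) → prod n f ≈ prod n g
prod-cong zero    e = ≈-refl
prod-cong (suc n) e = ⊗-cong (prod-cong n λ k k<n → e k (ℕₚ.m<n⇒m<1+n k<n)) (e n ℕₚ.≤-refl)

prod-head : ∀ n f → prod (suc n) f ≈ f 0 ⊗ prod n (f ∘ suc)
prod-head zero    f = ⊗-comm ⌜ 1ℚ ⌝ (f 0)
prod-head (suc n) f = ≈-trans (⊗-cong (prod-head n f) ≈-refl) (⊗-assoc _ _ _)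

prod-+ : ∀ m n f → prod (m ℕ.+ n) f ≈ prod m f ⊗ prod n (λ k → f (m ℕ.+ k))
prod-+ m zero    f rewrite ℕₚ.+-identityʳ m = solveᶜ 1 (λ p → p ≔ p ⊠ conᶜ 1ℚ) ≈-refl (prod m f)
prod-+ m (suc n) f rewrite ℕₚ.+-suc m n = ≈-trans (⊗-cong (prod-+ m n f) ≈-refl) (⊗-assoc _ _ _)

-- Both the halving of angles in `finite-product` and the pairing of the residues in `δ≈S-ω` fold an
-- odd number of factors around the middle one.
prod-fold : ∀ n f → prod (suc (n ℕ.+ n)) f ≈ prod n (λ k → f k ⊗ f (n ℕ.+ n ∸ k)) ⊗ f n
prod-fold zero    f = ≈-refl
prod-fold (suc n) f rewrite ℕₚ.+-suc n n = begin
  prod (suc (suc (n ℕ.+ n))) f ⊗ f (suc (suc (n ℕ.+ n)))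
    ≈⟨ ⊗-cong (prod-head (suc (n ℕ.+ n)) f) ≈-refl ⟩
  f 0 ⊗ prod (suc (n ℕ.+ n)) (f ∘ suc) ⊗ f (suc (suc (n ℕ.+ n)))
    ≈⟨ ⊗-cong (⊗-congˡ (prod-fold n (f ∘ suc))) ≈-refl ⟩
  f 0 ⊗ (prod n (λ k → f (suc k) ⊗ f (suc (n ℕ.+ n ∸ k))) ⊗ f (suc n)) ⊗ f (suc (suc (n ℕ.+ n)))
    ≈⟨ solveᶜ 4 (λ a p b c → a ⊠ (p ⊠ b) ⊠ c ≔ (a ⊠ c) ⊠ p ⊠ b) ≈-refl (f 0) (prod n (λ k → f (suc k) ⊗ f (suc (n ℕ.+ n ∸ k)))) (f (suc n)) (f (suc (suc (n ℕ.+ n)))) ⟩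
  (f 0 ⊗ f (suc (suc (n ℕ.+ n)))) ⊗ prod n (λ k → f (suc k) ⊗ f (suc (n ℕ.+ n ∸ k))) ⊗ f (suc n)
    ≈⟨ ⊗-cong (≈-trans (⊗-congˡ (prod-cong n λ k k<n → ⊗-congˡ (≈-reflexive (cong f (sym (ℕₚ.+-∸-assoc 1 (ℕₚ.≤-trans (ℕₚ.<⇒≤ k<n) (ℕₚ.m≤m+n n n))))))))
         (≈-sym (prod-head n (λ k → f k ⊗ f (suc (suc (n ℕ.+ n)) ∸ k))))) ≈-refl ⟩
  prod (suc n) (λ k → f k ⊗ f (suc (suc (n ℕ.+ n)) ∸ k)) ⊗ f (suc n) ∎
  where open ≈-Reasoning

-- e w = e^{iπw}, so that D w = 2i sin πw and C w = 2 cos πw.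
iπ : ℂ
iπ = ι ⊗ Π

e D C : ℂ → ℂ
e w = Exp (iπ ⊗ w)
D w = e w ⊖ e (⊝ w)
C w = e w ⊕ e (⊝ w)

e-cong : ∀ {w v} → w ≈ v → e w ≈ e v
e-cong h = Exp-cong (⊗-congˡ h)

D-cong : ∀ {w v} → w ≈ v → D w ≈ D v
D-cong h = ⊕-cong (e-cong h) (⊝-cong (e-cong (⊝-cong h)))

e-⊕ : ∀ w v → e (w ⊕ v) ≈ e w ⊗ e v
e-⊕ w v = ≈-trans (Exp-cong (solveᶜ 3 (λ p w v → p ⊠ (w ⊞ v) ≔ p ⊠ w ⊞ p ⊠ v) ≈-refl iπ w v)) (Exp-⊕ (iπ ⊗ w) (iπ ⊗ v))

e-⊝ : ∀ w → e w ⊗ e (⊝ w) ≈ ⌜ 1ℚ ⌝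
e-⊝ w = ≈-trans (⊗-congˡ (Exp-cong (solveᶜ 2 (λ p w → p ⊠ (⊟ w) ≔ ⊟ (p ⊠ w)) ≈-refl iπ w))) (Exp-⊝ (iπ ⊗ w))

e-½ : e ⌜ ½ ⌝ ≈ ι
e-½ = ≈-trans (Exp-cong (solveᶜ 2 (λ i p → i ⊠ p ⊠ conᶜ ½ ≔ i ⊠ (conᶜ ½ ⊠ p)) ≈-refl ι Π)) Exp-iπ/2

inverse-unique : ∀ {z v v′} → z ⊗ v ≈ ⌜ 1ℚ ⌝ → z ⊗ v′ ≈ ⌜ 1ℚ ⌝ → v ≈ v′
inverse-unique {z} {v} {v′} h h′ = begin
  v                 ≈⟨ solveᶜ 1 (λ v → v ≔ v ⊠ conᶜ 1ℚ) ≈-refl v ⟩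
  v ⊗ ⌜ 1ℚ ⌝        ≈⟨ ⊗-congˡ (≈-sym h′) ⟩
  v ⊗ (z ⊗ v′)      ≈⟨ solveᶜ 3 (λ v z v′ → v ⊠ (z ⊠ v′) ≔ z ⊠ v ⊠ v′) ≈-refl v z v′ ⟩
  z ⊗ v ⊗ v′        ≈⟨ ⊗-cong h ≈-refl ⟩
  ⌜ 1ℚ ⌝ ⊗ v′       ≈⟨ ⊗-identityˡ v′ ⟩
  v′                ∎
  where open ≈-Reasoning

ι⊗-ι : ι ⊗ (⊝ ι) ≈ ⌜ 1ℚ ⌝
ι⊗-ι = ≈-trans (solveᶜ 1 (λ i → i ⊠ (⊟ i) ≔ ⊟ (i ⊠ i)) ≈-refl ι) (≈-trans (⊝-cong ι²) (solveᶜ 0 (⊟ (⊟ conᶜ 1ℚ) ≔ conᶜ 1ℚ) ≈-refl))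

e--½ : e (⊝ ⌜ ½ ⌝) ≈ ⊝ ι
e--½ = inverse-unique {ι} (≈-trans (⊗-cong (≈-sym e-½) ≈-refl) (e-⊝ ⌜ ½ ⌝)) ι⊗-ι

sq : ℂ → ℂ
sq z = z ⊗ z

sq-cong : ∀ {z w} → z ≈ w → sq z ≈ sq w
sq-cong h = ⊗-cong h h

D-double : ∀ y → D (y ⊕ y) ≈ D y ⊗ C y
D-double y = begin
  e (y ⊕ y) ⊖ e (⊝ (y ⊕ y))
    ≈⟨ ⊕-cong (e-⊕ y y) (⊝-cong (≈-trans (e-cong (solveᶜ 1 (λ y → ⊟ (y ⊞ y) ≔ (⊟ y) ⊞ (⊟ y)) ≈-refl y)) (e-⊕ (⊝ y) (⊝ y)))) ⟩
  e y ⊗ e y ⊖ e (⊝ y) ⊗ e (⊝ y)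
    ≈⟨ solveᶜ 2 (λ a b → a ⊠ a ⊟ b ⊠ b ≔ (a ⊟ b) ⊠ (a ⊞ b)) ≈-refl (e y) (e (⊝ y)) ⟩
  D y ⊗ C y ∎
  where open ≈-Reasoning

C-double : ∀ y → C (y ⊕ y) ≈ sq (D y) ⊕ ⌜ 2ℚ ⌝
C-double y = begin
  e (y ⊕ y) ⊕ e (⊝ (y ⊕ y))
    ≈⟨ ⊕-cong (e-⊕ y y) (≈-trans (e-cong (solveᶜ 1 (λ y → ⊟ (y ⊞ y) ≔ (⊟ y) ⊞ (⊟ y)) ≈-refl y)) (e-⊕ (⊝ y) (⊝ y))) ⟩
  e y ⊗ e y ⊕ e (⊝ y) ⊗ e (⊝ y)
    ≈⟨ solveᶜ 2 (λ a b → a ⊠ a ⊞ b ⊠ b ≔ (a ⊟ b) ⊠ (a ⊟ b) ⊞ conᶜ 2ℚ ⊠ (a ⊠ b)) ≈-refl (e y) (e (⊝ y)) ⟩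
  sq (D y) ⊕ ⌜ 2ℚ ⌝ ⊗ (e y ⊗ e (⊝ y))
    ≈⟨ ⊕-congˡ (≈-trans (⊗-congˡ (e-⊝ y)) (solveᶜ 0 (conᶜ 2ℚ ⊠ conᶜ 1ℚ ≔ conᶜ 2ℚ) ≈-refl)) ⟩
  sq (D y) ⊕ ⌜ 2ℚ ⌝ ∎
  where open ≈-Reasoning

sq-C : ∀ y → sq (C y) ≈ sq (D y) ⊕ ⌜ 4ℚ ⌝
sq-C y = ≈-trans (solveᶜ 2 (λ a b → (a ⊞ b) ⊠ (a ⊞ b) ≔ (a ⊟ b) ⊠ (a ⊟ b) ⊞ conᶜ 4ℚ ⊠ (a ⊠ b)) ≈-refl (e y) (e (⊝ y)))
  (⊕-congˡ (≈-trans (⊗-congˡ (e-⊝ y)) (solveᶜ 0 (conᶜ 4ℚ ⊠ conᶜ 1ℚ ≔ conᶜ 4ℚ) ≈-refl)))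

D-complement : ∀ y → D (⌜ ½ ⌝ ⊖ y) ≈ ι ⊗ C y
D-complement y = begin
  e (⌜ ½ ⌝ ⊖ y) ⊖ e (⊝ (⌜ ½ ⌝ ⊖ y))
    ≈⟨ ⊕-cong (≈-trans (e-⊕ ⌜ ½ ⌝ (⊝ y)) (⊗-cong e-½ ≈-refl))
         (⊝-cong (≈-trans (e-cong (solveᶜ 1 (λ y → ⊟ (conᶜ ½ ⊟ y) ≔ (⊟ conᶜ ½) ⊞ y) ≈-refl y)) (≈-trans (e-⊕ (⊝ ⌜ ½ ⌝) y) (⊗-cong e--½ ≈-refl)))) ⟩
  ι ⊗ e (⊝ y) ⊖ (⊝ ι) ⊗ e y
    ≈⟨ solveᶜ 3 (λ i a b → i ⊠ b ⊟ (⊟ i) ⊠ a ≔ i ⊠ (a ⊞ b)) ≈-refl ι (e y) (e (⊝ y)) ⟩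
  ι ⊗ C y ∎
  where open ≈-Reasoning

sq-D-complement : ∀ y → sq (D (⌜ ½ ⌝ ⊖ y)) ≈ ⊝ (sq (D y) ⊕ ⌜ 4ℚ ⌝)
sq-D-complement y = begin
  sq (D (⌜ ½ ⌝ ⊖ y))          ≈⟨ sq-cong (D-complement y) ⟩
  sq (ι ⊗ C y)                ≈⟨ solveᶜ 2 (λ i c → i ⊠ c ⊠ (i ⊠ c) ≔ i ⊠ i ⊠ (c ⊠ c)) ≈-refl ι (C y) ⟩
  ι ⊗ ι ⊗ sq (C y)            ≈⟨ ⊗-cong ι² (sq-C y) ⟩
  (⊝ ⌜ 1ℚ ⌝) ⊗ (sq (D y) ⊕ ⌜ 4ℚ ⌝)  ≈⟨ solveᶜ 1 (λ s → (⊟ conᶜ 1ℚ) ⊠ s ≔ ⊟ s) ≈-refl _ ⟩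
  ⊝ (sq (D y) ⊕ ⌜ 4ℚ ⌝)       ∎
  where open ≈-Reasoning

sq-inverse : ∀ {z v} → z ⊗ v ≈ ⌜ 1ℚ ⌝ → sq z ⊗ sq v ≈ ⌜ 1ℚ ⌝
sq-inverse {z} {v} h = ≈-trans (solveᶜ 2 (λ z v → z ⊠ z ⊠ (v ⊠ v) ≔ (z ⊠ v) ⊠ (z ⊠ v)) ≈-refl z v) (≈-trans (⊗-cong h h) (⊗-identityˡ ⌜ 1ℚ ⌝))

-- Both sides are polynomials of degree 2 in s = `sq (D y)`, since `sq (D (y ⊕ y))` is s (s + 4).
-- The coefficients of s agree by 1 / sin² + 1 / cos² = 1 / (sin² cos²) at πb, which is `sum`, and
-- those of s² by the duplication formula at b, which is `sqV`.
pair-factor : ∀ y b {V v v′} → D (b ⊕ b) ⊗ V ≈ ⌜ 1ℚ ⌝ → D b ⊗ v ≈ ⌜ 1ℚ ⌝ → D (⌜ ½ ⌝ ⊖ b) ⊗ v′ ≈ ⌜ 1ℚ ⌝ →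
              ⌜ 1ℚ ⌝ ⊖ sq (D (y ⊕ y) ⊗ V) ≈ (⌜ 1ℚ ⌝ ⊖ sq (D y ⊗ v)) ⊗ (⌜ 1ℚ ⌝ ⊖ sq (D y ⊗ v′))
pair-factor y b {V} {v} {v′} hV hv hv′ = begin
  ⌜ 1ℚ ⌝ ⊖ sq (D (y ⊕ y) ⊗ V)
    ≈⟨ ⊖-congˡ (≈-trans (sq-cong (⊗-cong (D-double y) ≈-refl)) (solveᶜ 3 (λ d c v → d ⊠ c ⊠ v ⊠ (d ⊠ c ⊠ v) ≔ d ⊠ d ⊠ (c ⊠ c) ⊠ (v ⊠ v)) ≈-refl (D y) (C y) V)) ⟩
  ⌜ 1ℚ ⌝ ⊖ sq (D y) ⊗ sq (C y) ⊗ sq V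
    ≈⟨ ⊖-congˡ (⊗-cong (⊗-congˡ (sq-C y)) sqV) ⟩
  ⌜ 1ℚ ⌝ ⊖ sq (D y) ⊗ (sq (D y) ⊕ ⌜ 4ℚ ⌝) ⊗ (⊝ (sq v ⊗ sq v′))
    ≈⟨ solveᶜ 2 (λ s p → conᶜ 1ℚ ⊟ s ⊠ (s ⊞ conᶜ 4ℚ) ⊠ (⊟ p) ≔ conᶜ 1ℚ ⊟ s ⊠ (conᶜ (- 4ℚ) ⊠ p) ⊞ s ⊠ s ⊠ p) ≈-refl (sq (D y)) (sq v ⊗ sq v′) ⟩
  ⌜ 1ℚ ⌝ ⊖ sq (D y) ⊗ (⌜ - 4ℚ ⌝ ⊗ (sq v ⊗ sq v′)) ⊕ sq (D y) ⊗ sq (D y) ⊗ (sq v ⊗ sq v′)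
    ≈⟨ ⊕-cong (⊖-congˡ (⊗-congˡ sum)) ≈-refl ⟩
  ⌜ 1ℚ ⌝ ⊖ sq (D y) ⊗ (sq v ⊕ sq v′) ⊕ sq (D y) ⊗ sq (D y) ⊗ (sq v ⊗ sq v′)
    ≈⟨ solveᶜ 3 (λ d v w → conᶜ 1ℚ ⊟ d ⊠ d ⊠ (v ⊠ v ⊞ w ⊠ w) ⊞ d ⊠ d ⊠ (d ⊠ d) ⊠ (v ⊠ v ⊠ (w ⊠ w)) ≔
         (conᶜ 1ℚ ⊟ d ⊠ v ⊠ (d ⊠ v)) ⊠ (conᶜ 1ℚ ⊟ d ⊠ w ⊠ (d ⊠ w))) ≈-refl (D y) v v′ ⟩
  (⌜ 1ℚ ⌝ ⊖ sq (D y ⊗ v)) ⊗ (⌜ 1ℚ ⌝ ⊖ sq (D y ⊗ v′)) ∎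
  where
  open ≈-Reasoning
  hs : sq (D b) ⊗ sq v ≈ ⌜ 1ℚ ⌝
  hs = sq-inverse hv
  hs′ : (⊝ (sq (D b) ⊕ ⌜ 4ℚ ⌝)) ⊗ sq v′ ≈ ⌜ 1ℚ ⌝
  hs′ = ≈-trans (⊗-cong (≈-sym (sq-D-complement b)) ≈-refl) (sq-inverse hv′)
  sqV : sq V ≈ ⊝ (sq v ⊗ sq v′)
  sqV = inverse-unique {sq (D (b ⊕ b))} (sq-inverse hV) (begin
    sq (D (b ⊕ b)) ⊗ (⊝ (sq v ⊗ sq v′))
      ≈⟨ ⊗-cong (≈-trans (sq-cong (D-double b)) (≈-trans (solveᶜ 2 (λ d c → d ⊠ c ⊠ (d ⊠ c) ≔ d ⊠ d ⊠ (c ⊠ c)) ≈-refl (D b) (C b)) (⊗-congˡ (sq-C b)))) ≈-refl ⟩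
    sq (D b) ⊗ (sq (D b) ⊕ ⌜ 4ℚ ⌝) ⊗ (⊝ (sq v ⊗ sq v′))
      ≈⟨ solveᶜ 4 (λ s t v w → s ⊠ t ⊠ (⊟ (v ⊠ w)) ≔ (s ⊠ v) ⊠ ((⊟ t) ⊠ w)) ≈-refl (sq (D b)) (sq (D b) ⊕ ⌜ 4ℚ ⌝) (sq v) (sq v′) ⟩
    (sq (D b) ⊗ sq v) ⊗ ((⊝ (sq (D b) ⊕ ⌜ 4ℚ ⌝)) ⊗ sq v′)
      ≈⟨ ≈-trans (⊗-cong hs hs′) (⊗-identityˡ ⌜ 1ℚ ⌝) ⟩
    ⌜ 1ℚ ⌝ ∎)
  sum : ⌜ - 4ℚ ⌝ ⊗ (sq v ⊗ sq v′) ≈ sq v ⊕ sq v′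
  sum = begin
    ⌜ - 4ℚ ⌝ ⊗ (sq v ⊗ sq v′)
      ≈⟨ solveᶜ 3 (λ s v w → conᶜ (- 4ℚ) ⊠ (v ⊠ w) ≔ v ⊠ ((⊟ (s ⊞ conᶜ 4ℚ)) ⊠ w) ⊞ (s ⊠ v) ⊠ w) ≈-refl (sq (D b)) (sq v) (sq v′) ⟩
    sq v ⊗ ((⊝ (sq (D b) ⊕ ⌜ 4ℚ ⌝)) ⊗ sq v′) ⊕ (sq (D b) ⊗ sq v) ⊗ sq v′
      ≈⟨ ⊕-cong (⊗-congˡ hs′) (⊗-cong hs ≈-refl) ⟩
    sq v ⊗ ⌜ 1ℚ ⌝ ⊕ ⌜ 1ℚ ⌝ ⊗ sq v′
      ≈⟨ solveᶜ 2 (λ v w → v ⊠ conᶜ 1ℚ ⊞ conᶜ 1ℚ ⊠ w ≔ v ⊞ w) ≈-refl (sq v) (sq v′) ⟩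
    sq v ⊕ sq v′ ∎

¼ : ℚ
¼ = ½ * ½

-- This is cos 2x = 1 - 2 sin² x at x = πy, where 2 is read as 1 / sin² (π/4).
middle-factor : ∀ y {v} → D ⌜ ¼ ⌝ ⊗ v ≈ ⌜ 1ℚ ⌝ → C (y ⊕ y) ≈ ⌜ 2ℚ ⌝ ⊗ (⌜ 1ℚ ⌝ ⊖ sq (D y ⊗ v))
middle-factor y {v} hv = begin
  C (y ⊕ y)                         ≈⟨ C-double y ⟩
  sq (D y) ⊕ ⌜ 2ℚ ⌝                 ≈⟨ solveᶜ 1 (λ s → s ⊞ conᶜ 2ℚ ≔ conᶜ 2ℚ ⊠ (conᶜ 1ℚ ⊟ s ⊠ conᶜ (- ½))) ≈-refl (sq (D y)) ⟩
  ⌜ 2ℚ ⌝ ⊗ (⌜ 1ℚ ⌝ ⊖ sq (D y) ⊗ ⌜ - ½ ⌝)  ≈⟨ ⊗-congˡ (⊖-congˡ (⊗-congˡ (inverse-unique {⌜ - 2ℚ ⌝} (≈-sym (⌜⌝-* (- 2ℚ) (- ½))) (≈-trans (⊗-cong (≈-sym sq-D-¼) ≈-refl) (sq-inverse hv))))) ⟩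
  ⌜ 2ℚ ⌝ ⊗ (⌜ 1ℚ ⌝ ⊖ sq (D y) ⊗ sq v)
    ≈⟨ solveᶜ 2 (λ d v → conᶜ 2ℚ ⊠ (conᶜ 1ℚ ⊟ d ⊠ d ⊠ (v ⊠ v)) ≔ conᶜ 2ℚ ⊠ (conᶜ 1ℚ ⊟ d ⊠ v ⊠ (d ⊠ v))) ≈-refl (D y) v ⟩
  ⌜ 2ℚ ⌝ ⊗ (⌜ 1ℚ ⌝ ⊖ sq (D y ⊗ v))  ∎
  where
  open ≈-Reasoning
  C-½ : C (⌜ ¼ ⌝ ⊕ ⌜ ¼ ⌝) ≈ ⌜ 0ℚ ⌝
  C-½ = ≈-trans (⊕-cong (≈-trans (e-cong quarter) e-½) (≈-trans (e-cong (⊝-cong quarter)) e--½)) (solveᶜ 1 (λ i → i ⊟ i ≔ conᶜ 0ℚ) ≈-refl ι)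
    where
    quarter : ⌜ ¼ ⌝ ⊕ ⌜ ¼ ⌝ ≈ ⌜ ½ ⌝
    quarter = ≈-sym (⌜⌝-+ ¼ ¼)
  sq-D-¼ : sq (D ⌜ ¼ ⌝) ≈ ⌜ - 2ℚ ⌝
  sq-D-¼ = begin
    sq (D ⌜ ¼ ⌝)                          ≈⟨ solveᶜ 1 (λ s → s ≔ s ⊞ conᶜ 2ℚ ⊞ conᶜ (- 2ℚ)) ≈-refl (sq (D ⌜ ¼ ⌝)) ⟩
    sq (D ⌜ ¼ ⌝) ⊕ ⌜ 2ℚ ⌝ ⊕ ⌜ - 2ℚ ⌝      ≈⟨ ⊕-cong (≈-trans (≈-sym (C-double ⌜ ¼ ⌝)) C-½) ≈-refl ⟩
    ⌜ 0ℚ ⌝ ⊕ ⌜ - 2ℚ ⌝                     ≈⟨ ⊕-identityˡ ⌜ - 2ℚ ⌝ ⟩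
    ⌜ - 2ℚ ⌝                              ∎

-- 2ʳ - 1, in the form suc (n + n) on which `prod-fold` works.
2^-1 : ℕ → ℕ
2^-1 zero    = 0
2^-1 (suc r) = suc (2^-1 r ℕ.+ 2^-1 r)

suc-2^-1 : ∀ r → suc (2^-1 r) ≡ 2 ℕ.^ r
suc-2^-1 zero    = refl
suc-2^-1 (suc r) = trans (cong suc (sym (ℕₚ.+-suc (2^-1 r) (2^-1 r))))
  (cong₂ ℕ._+_ (suc-2^-1 r) (trans (suc-2^-1 r) (sym (ℕₚ.+-identityʳ (2 ℕ.^ r)))))

-- (k + 1) / N for N = 2ʳ⁺¹; the index is shifted because products start at k = 0.
angle : ℕ → ℕ → ℚ
angle r k = fromℕ (suc k) * ½ ^ℚ suc r

angle-double : ∀ r k → angle (suc r) k + angle (suc r) k ≡ angle r k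
angle-double r k = solve 2 (λ m h → m :* (h :* con ½) :+ m :* (h :* con ½) := m :* h) refl (fromℕ (suc k)) (½ ^ℚ suc r)

angle-full : ∀ r → fromℕ (2 ℕ.^ r) * ½ ^ℚ suc r ≡ ½
angle-full r = trans (solve 2 (λ m h → m :* (h :* con ½) := (m :* h) :* con ½) refl (fromℕ (2 ℕ.^ r)) (½ ^ℚ r))
  (trans (cong (_* ½) (2^*½^ r)) (*-identityˡ ½))

angle-middle : ∀ r → angle (suc r) (2^-1 r) ≡ ¼
angle-middle r = trans (cong (λ m → fromℕ m * ½ ^ℚ suc (suc r)) (suc-2^-1 r))
  (trans (solve 2 (λ m h → m :* (h :* con ½ :* con ½) := (m :* h) :* con ¼) refl (fromℕ (2 ℕ.^ r)) (½ ^ℚ r))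
    (trans (cong (_* ¼) (2^*½^ r)) (*-identityˡ ¼)))

angle-complement : ∀ r k → k ℕ.< 2^-1 r → angle (suc r) (2^-1 r ℕ.+ 2^-1 r ∸ k) ≡ ½ - angle (suc r) k
angle-complement r k k<n = begin
  fromℕ (suc j) * h                              ≡⟨ solve 3 (λ a b h → a :* h := (b :+ a) :* h :- b :* h) refl (fromℕ (suc j)) (fromℕ (suc k)) h ⟩
  (fromℕ (suc k) + fromℕ (suc j)) * h - fromℕ (suc k) * h
    ≡⟨ cong (λ m → m * h - fromℕ (suc k) * h) (sym (fromℕ-+ (suc k) (suc j))) ⟩
  fromℕ (suc k ℕ.+ suc j) * h - fromℕ (suc k) * h
    ≡⟨ cong (λ m → fromℕ m * h - fromℕ (suc k) * h) (trans (cong suc (trans (ℕₚ.+-suc k j) (cong suc (ℕₚ.m+[n∸m]≡n (ℕₚ.≤-trans (ℕₚ.<⇒≤ k<n) (ℕₚ.m≤m+n n n)))))) (suc-2^-1 (suc r))) ⟩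
  fromℕ (2 ℕ.^ suc r) * h - fromℕ (suc k) * h    ≡⟨ cong (_- fromℕ (suc k) * h) (angle-full (suc r)) ⟩
  ½ - fromℕ (suc k) * h                          ∎
  where
  open ≡-Reasoning
  n j : ℕ
  n = 2^-1 r
  j = n ℕ.+ n ∸ k
  h : ℚ
  h = ½ ^ℚ suc (suc r)

angle-pos : ∀ r k → 0ℚ < angle r k
angle-pos r k = pos* (<-≤-trans 0<1 (subst (1ℚ ≤_) (sym (fromℕ-suc k)) (p≤p+q 1ℚ (0≤fromℕ k)))) (0<½^ (suc r))

angle≤½ : ∀ r {k} → k ℕ.≤ 2^-1 r → angle r k ≤ ½
angle≤½ r {k} k≤ = subst (angle r k ≤_) (angle-full r)
  (*-monoʳ₀ {fromℕ (suc k)} {fromℕ (2 ℕ.^ r)} (½ ^ℚ suc r) (<⇒≤ (0<½^ (suc r))) (fromℕ-mono (subst (suc k ℕ.≤_) (suc-2^-1 r) (ℕ.s≤s k≤))))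

-- sin x = N sin (x/N) cos (x/N) ∏_{0<k<N/2} (1 − sin² (x/N) / sin² (kπ/N)) for N = 2ʳ⁺¹, by duplication.
finite-product : (V : ℚ → ℂ) → (∀ q → 0ℚ < q → q ≤ ½ → D ⌜ q ⌝ ⊗ V q ≈ ⌜ 1ℚ ⌝) → ∀ w r →
  D w ≈ ⌜ fromℕ (2 ℕ.^ r) ⌝ ⊗ D (⌜ ½ ^ℚ r ⌝ ⊗ w) ⊗ prod (2^-1 r) (λ k → ⌜ 1ℚ ⌝ ⊖ sq (D (⌜ ½ ^ℚ suc r ⌝ ⊗ w) ⊗ V (angle r k)))
finite-product V hV w zero = ≈-trans (D-cong (≈-sym (⊗-identityˡ w))) (≈-trans (solveᶜ 1 (λ d → d ≔ conᶜ 1ℚ ⊠ d ⊠ conᶜ 1ℚ) ≈-refl (D (⌜ 1ℚ ⌝ ⊗ w)))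
  (⊗-cong (⊗-cong (⌜⌝-cong (sym fromℕ-1)) ≈-refl) ≈-refl))
finite-product V hV w (suc r) = begin
  D w                                                               ≈⟨ finite-product V hV w r ⟩
  M ⊗ D (⌜ ½ ^ℚ r ⌝ ⊗ w) ⊗ prod n (λ k → ⌜ 1ℚ ⌝ ⊖ sq (D (⌜ ½ ^ℚ suc r ⌝ ⊗ w) ⊗ V (angle r k)))
    -- Each factor of level r becomes a pair of level r + 1, and the sine in front becomes sine
    -- times cosine; the cosine will be the middle factor of level r + 1.
    ≈⟨ ⊗-cong (⊗-congˡ (≈-trans (D-cong (halve r)) (D-double x))) (prod-cong n pair) ⟩
  M ⊗ (D x ⊗ C x) ⊗ prod n (λ k → f k ⊗ f (n ℕ.+ n ∸ k))
    ≈⟨ ⊗-cong (⊗-congˡ (⊗-congˡ (≈-trans (C-cong (halve (suc r))) (≈-trans (middle-factor y {V ¼} (hV ¼ 0<¼ ¼≤½)) (⊗-congˡ mid))))) ≈-refl ⟩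
  M ⊗ (D x ⊗ (⌜ 2ℚ ⌝ ⊗ f n)) ⊗ prod n (λ k → f k ⊗ f (n ℕ.+ n ∸ k))
    ≈⟨ solveᶜ 4 (λ m d f p → m ⊠ (d ⊠ (conᶜ 2ℚ ⊠ f)) ⊠ p ≔ conᶜ 2ℚ ⊠ m ⊠ d ⊠ (p ⊠ f)) ≈-refl M (D x) (f n) (prod n (λ k → f k ⊗ f (n ℕ.+ n ∸ k))) ⟩
  ⌜ 2ℚ ⌝ ⊗ M ⊗ D x ⊗ (prod n (λ k → f k ⊗ f (n ℕ.+ n ∸ k)) ⊗ f n)
    ≈⟨ ⊗-cong (⊗-cong twice ≈-refl) (≈-sym (prod-fold n f)) ⟩
  ⌜ fromℕ (2 ℕ.^ suc r) ⌝ ⊗ D x ⊗ prod (suc (n ℕ.+ n)) f ∎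
  where
  open ≈-Reasoning
  n : ℕ
  n = 2^-1 r
  M x y : ℂ
  M = ⌜ fromℕ (2 ℕ.^ r) ⌝
  x = ⌜ ½ ^ℚ suc r ⌝ ⊗ w
  y = ⌜ ½ ^ℚ suc (suc r) ⌝ ⊗ w
  f : ℕ → ℂ
  f k = ⌜ 1ℚ ⌝ ⊖ sq (D y ⊗ V (angle (suc r) k))
  0<¼ : 0ℚ < ¼
  0<¼ = pos* 0<½ 0<½
  ¼≤½ : ¼ ≤ ½
  ¼≤½ = p≤p+q ¼ (<⇒≤ 0<¼)
  C-cong : ∀ {w v} → w ≈ v → C w ≈ C v
  C-cong h = ⊕-cong (e-cong h) (e-cong (⊝-cong h))
  halve : ∀ r → ⌜ ½ ^ℚ r ⌝ ⊗ w ≈ ⌜ ½ ^ℚ suc r ⌝ ⊗ w ⊕ ⌜ ½ ^ℚ suc r ⌝ ⊗ w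
  halve r = ≈-trans (⊗-cong (≈-trans (⌜⌝-cong (solve 1 (λ h → h := h :* con ½ :+ h :* con ½) refl (½ ^ℚ r))) (⌜⌝-+ (½ ^ℚ suc r) (½ ^ℚ suc r))) ≈-refl)
    (⊗-distribʳ w _ _)
  twice : ⌜ 2ℚ ⌝ ⊗ M ≈ ⌜ fromℕ (2 ℕ.^ suc r) ⌝
  twice = ≈-trans (≈-sym (⌜⌝-* 2ℚ (fromℕ (2 ℕ.^ r)))) (⌜⌝-cong (sym (trans (fromℕ-* 2 (2 ℕ.^ r)) (cong (_* fromℕ (2 ℕ.^ r)) fromℕ-2))))
    where
    fromℕ-2 : fromℕ 2 ≡ 2ℚ
    fromℕ-2 = trans (fromℕ-suc 1) (cong (1ℚ +_) fromℕ-1)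
  mid : ⌜ 1ℚ ⌝ ⊖ sq (D y ⊗ V ¼) ≈ f n
  mid = ≈-reflexive (cong (λ q → ⌜ 1ℚ ⌝ ⊖ sq (D y ⊗ V q)) (sym (angle-middle r)))
  pair : ∀ k → k ℕ.< n → ⌜ 1ℚ ⌝ ⊖ sq (D x ⊗ V (angle r k)) ≈ f k ⊗ f (n ℕ.+ n ∸ k)
  pair k k<n = ≈-trans (⊖-congˡ (sq-cong (⊗-cong (D-cong (halve (suc r))) ≈-refl)))
    (pair-factor y ⌜ q ⌝
      (≈-trans (⊗-cong (D-cong (≈-trans (≈-sym (⌜⌝-+ q q)) (⌜⌝-cong (angle-double r k)))) ≈-refl) (hV (angle r k) (angle-pos r k) (angle≤½ r (ℕₚ.<⇒≤ k<n))))
      (hV q (angle-pos (suc r) k) (angle≤½ (suc r) (ℕₚ.≤-trans (ℕₚ.<⇒≤ k<n) (ℕₚ.≤-trans (ℕₚ.m≤m+n n n) (ℕₚ.n≤1+n _)))))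
      (≈-trans (⊗-cong (D-cong (≈-trans (⊕-congˡ (≈-sym (⌜⌝-neg q))) (≈-trans (≈-sym (⌜⌝-+ ½ (- q))) (⌜⌝-cong (sym (angle-complement r k k<n)))))) ≈-refl)
        (hV q′ (angle-pos (suc r) _) (angle≤½ (suc r) (ℕₚ.≤-trans (ℕₚ.m∸n≤m (n ℕ.+ n) k) (ℕₚ.n≤1+n _))))))
    where
    q q′ : ℚ
    q  = angle (suc r) k
    q′ = angle (suc r) (n ℕ.+ n ∸ k)

-- Inverses of sines and cosines with explicit bounds

exact-eventually : ∀ N {z w} → (∀ k → N ℕ.≤ k → seq (re z) k ≡ seq (re w) k) → (∀ k → N ℕ.≤ k → seq (im z) k ≡ seq (im w) k) → z ≈ w
exact-eventually N {z} {w} p q = mk≈ (mkBound λ ε 0<ε → N , λ k N≤k →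
  ≤-trans (≤-reflexive (norm-exact z w k (p k N≤k) (q k N≤k))) (nonNeg+ ≤-refl (<⇒≤ 0<ε)))

-- The bound is carried along because an upper bound for z says nothing about its inverse.
record Inverse (z : ℂ) (B : ℚ) : Set where
  constructor mkInverse
  field
    inverse   : ℂ
    isInverse : z ⊗ inverse ≈ ⌜ 1ℚ ⌝
    ∥inverse∥ : ∥ inverse ∥≤ B

open Inverse public

module Recip where
  cancel-re : ∀ a b r → r * (a * a + b * b) ≡ 1ℚ → a * (a * r) - b * (- b * r) ≡ 1ℚ
  cancel-re a b r h = trans (solve 3 (λ a b r → a :* (a :* r) :- b :* ((:- b) :* r) := r :* (a :* a :+ b :* b)) refl a b r) h

  cancel-im : ∀ a b r → a * (- b * r) + b * (a * r) ≡ 0ℚ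
  cancel-im = solve 3 (λ a b r → a :* ((:- b) :* r) :+ b :* (a :* r) := con 0ℚ) refl

opaque
  unfolding _⊕_

  recipᶜ-inverse : ∀ z z#0 → z ⊗ recipᶜ z z#0 ≈ ⌜ 1ℚ ⌝
  recipᶜ-inverse z (ε , 0<ε , N , h) = exact-eventually N
    (λ k N≤k → Recip.cancel-re (seq (re z) k) (seq (im z) k) (recip (seq (re z) k * seq (re z) k + seq (im z) k * seq (im z) k))
      (recip* (<-≤-trans 0<ε (subst (_≤ seq (re z) k * seq (re z) k + seq (im z) k * seq (im z) k) (+-identityˡ ε) (h k N≤k)))))
    (λ k _ → Recip.cancel-im (seq (re z) k) (seq (im z) k) (recip (seq (re z) k * seq (re z) k + seq (im z) k * seq (im z) k)))

  re-near-1 : ∀ z k → 1ℚ - seq (re z) k ≤ norm (z ⊖ ⌜ 1ℚ ⌝) k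
  re-near-1 z k = ≤-trans (≤-trans (p≤∣p∣ (1ℚ - seq (re z) k)) (≤-reflexive (∣∣-sym 1ℚ (seq (re z) k)))) (p≤p+q (∣ seq (re z) k - 1ℚ ∣) (0≤∣p∣ (seq (im z) k - 0ℚ)))

  -- From some index on the distance to 1 is at most ¾ + ⅛, so that the real part is at least ⅛.
  near-1-#0 : ∀ z → ∥ z ⊖ ⌜ 1ℚ ⌝ ∥≤ ¾ → z #0
  near-1-#0 z (mkBound h) = ⅛ * ⅛ , pos* 0<⅛ 0<⅛ , proj₁ (h ⅛ 0<⅛) , λ k N≤k →
      square (seq (re z) k) (seq (im z) k) (≤-trans (re-near-1 z k) (proj₂ (h ⅛ 0<⅛) k N≤k))
    where
    ⅛ : ℚ
    ⅛ = ½ * (½ * ½)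
    0<⅛ : 0ℚ < ⅛
    0<⅛ = positive⁻¹ ⅛
    square : ∀ a b → 1ℚ - a ≤ ¾ + ⅛ → 0ℚ + ⅛ * ⅛ ≤ a * a + b * b
    square a b h = ≤-trans (≤-reflexive (+-identityˡ (⅛ * ⅛))) (≤-trans (*-mono₀ {⅛} {a} {⅛} {a} (<⇒≤ 0<⅛) (≤-trans (<⇒≤ 0<⅛) ⅛≤a) ⅛≤a ⅛≤a) (p≤p+q (a * a) (square-nonNeg b)))
      where
      ⅛≤a : ⅛ ≤ a
      ⅛≤a = subst₂ _≤_ (solve 1 (λ a → (con 1ℚ :- a) :+ (a :- con (¾ + ⅛)) := con ⅛) refl a) (solve 1 (λ a → con (¾ + ⅛) :+ (a :- con (¾ + ⅛)) := a) refl a)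
        (+-monoˡ-≤ (a - (¾ + ⅛)) h)

8ℚ 9ℚ : ℚ
8ℚ = 4ℚ + 4ℚ
9ℚ = 8ℚ + 1ℚ

-- v = 1 - (z - 1) v. For x = `norm v k` and slack t = ⅛ this gives x ≤ t + 1 + (¾ + t) x, that is,
-- ⅛ x ≤ 9/8.
near-1-bound : ∀ {z v} → ∥ z ⊖ ⌜ 1ℚ ⌝ ∥≤ ¾ → z ⊗ v ≈ ⌜ 1ℚ ⌝ → ∥ v ∥≤ 9ℚ
near-1-bound {z} {v} (mkBound h) zv = mkBound λ ε 0<ε →
  proj₁ (h t 0<t) ℕ.⊔ proj₁ (eventually (gap v≈) t 0<t) , λ k le → ≤-trans
    (solve-for (norm v k) (≤-trans (norm-⊖-shift (⌜ 1ℚ ⌝ ⊖ (z ⊖ ⌜ 1ℚ ⌝) ⊗ v) v k)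
      (+-mono-≤ (proj₂ (eventually (gap v≈) t 0<t) k (≤⊔ʳ {proj₁ (h t 0<t)} le))
        (≤-trans (norm-⊕ ⌜ 1ℚ ⌝ (⊝ ((z ⊖ ⌜ 1ℚ ⌝) ⊗ v)) k) (+-mono-≤ (≤-reflexive (norm-⌜⌝ 1ℚ k))
          (≤-trans (≤-reflexive (norm-⊝ ((z ⊖ ⌜ 1ℚ ⌝) ⊗ v) k)) (≤-trans (norm-⊗ (z ⊖ ⌜ 1ℚ ⌝) v k)
            (*-monoʳ₀ {norm (z ⊖ ⌜ 1ℚ ⌝) k} {¾ + t} (norm v k) (0≤norm v k) (proj₂ (h t 0<t) k (≤⊔ˡ le))))))))))
    (p≤p+q 9ℚ (<⇒≤ 0<ε))
  where
  t : ℚ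
  t = ½ * (½ * ½)
  0<t : 0ℚ < t
  0<t = positive⁻¹ t
  v≈ : v ≈ ⌜ 1ℚ ⌝ ⊖ (z ⊖ ⌜ 1ℚ ⌝) ⊗ v
  v≈ = ≈-trans (solveᶜ 2 (λ z v → v ≔ (z ⊠ v) ⊟ (z ⊟ conᶜ 1ℚ) ⊠ v) ≈-refl z v) (⊕-cong zv ≈-refl)
  solve-for : ∀ x → x ≤ 0ℚ + t + (1ℚ + (¾ + t) * x) → x ≤ 9ℚ
  solve-for x le =
    subst₂ _≤_ (solve 1 (λ x → con 8ℚ :* (x :- con (¾ + t) :* x) := x) refl x)
                (solve 1 (λ x → con 8ℚ :* ((con (0ℚ + t) :+ (con 1ℚ :+ con (¾ + t) :* x)) :- con (¾ + t) :* x) := con 9ℚ) refl x)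
      (*-monoˡ₀ 8ℚ (nonNegative⁻¹ 8ℚ) (+-monoˡ-≤ (- ((¾ + t) * x)) le))

near-1-inverse : ∀ {z} → ∥ z ⊖ ⌜ 1ℚ ⌝ ∥≤ ¾ → Inverse z 9ℚ
near-1-inverse {z} h = mkInverse (recipᶜ z z#0) (recipᶜ-inverse z z#0) (near-1-bound h (recipᶜ-inverse z z#0))
  where
  z#0 : z #0
  z#0 = near-1-#0 z h

Inverse-factor : ∀ {z B c} u → ∥ u ∥≤ c → Inverse (z ⊗ u) B → Inverse z (c * B)
Inverse-factor {z} u hu (mkInverse v e b) = mkInverse (u ⊗ v) (≈-trans (≈-sym (⊗-assoc z u v)) e) (∥∥-⊗ hu b)

Inverse-⊗ : ∀ {z w A B} → Inverse z A → Inverse w B → Inverse (z ⊗ w) (A * B)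
Inverse-⊗ {z} {w} (mkInverse v e b) (mkInverse v′ e′ b′) = mkInverse (v ⊗ v′)
  (≈-trans (solveᶜ 4 (λ z w v v′ → z ⊠ w ⊠ (v ⊠ v′) ≔ (z ⊠ v) ⊠ (w ⊠ v′)) ≈-refl z w v v′) (≈-trans (⊗-cong e e′) (⊗-identityˡ ⌜ 1ℚ ⌝)))
  (∥∥-⊗ b b′)

Inverse-resp : ∀ {z w A B} → z ≈ w → A ≡ B → Inverse z A → Inverse w B
Inverse-resp h refl (mkInverse v e b) = mkInverse v (≈-trans (⊗-cong (≈-sym h) ≈-refl) e) b

πSum≤4 : ∀ n → πSum (suc n) ≤ 4ℚ
πSum≤4 n = subst₂ _≤_ (solve 1 (λ p → con 2ℚ :* (con ½ :* p) := p) refl (πSum (suc n)))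
  (trans (cong (λ t → 2ℚ * (2ℚ * t)) (EulerSteps.x-N n)) refl)
  (*-monoˡ₀ 2ℚ 0≤2 (EulerSteps.θ≤2x n (EulerSteps.N n)))

0≤πSum : ∀ n → 0ℚ ≤ πSum n
0≤πSum n = ≤-trans (nonNeg* (0≤fromℕ 4) (<⇒≤ (0<recip (0<1+x² 1ℚ)))) (πSum-≥ n)

∥Π∥ : ∥ Π ∥≤ 4ℚ
∥Π∥ = mkBound λ ε 0<ε → 1 , bound 0<ε
  where
  bound : ∀ {ε} → 0ℚ < ε → ∀ k → 1 ℕ.≤ k → norm Π k ≤ 4ℚ + ε
  bound 0<ε (suc k) _ = ≤-trans (≤-reflexive (trans (norm-Π (suc k)) (0≤p⇒∣p∣≡p (0≤πSum (suc k))))) (≤-trans (πSum≤4 k) (p≤p+q 4ℚ (<⇒≤ 0<ε)))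

2≤πSum : ∀ n → 2ℚ ≤ πSum n
2≤πSum n = subst (_≤ πSum n) (cong (_* recip (1ℚ + 1ℚ * 1ℚ)) fromℕ-4) (πSum-≥ n)

opaque
  unfolding _⊕_ Π

  Π⁻¹ : ℂ
  Π⁻¹ = ofℝ (recipʳ π 0<π)

  norm-Π⁻¹ : ∀ k → norm Π⁻¹ k ≡ ∣ recip (πSum k) ∣
  norm-Π⁻¹ k = +-identityʳ (∣ recip (πSum k) ∣)

  Π⊗Π⁻¹ : Π ⊗ Π⁻¹ ≈ ⌜ 1ℚ ⌝
  Π⊗Π⁻¹ = exact (λ k → re-part (πSum k) (recip (πSum k)) (recip* (<-≤-trans (positive⁻¹ 2ℚ) (2≤πSum k)))) (λ k → im-part (πSum k) (recip (πSum k)))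
    where
    re-part : ∀ p r → r * p ≡ 1ℚ → p * r - 0ℚ * 0ℚ ≡ 1ℚ
    re-part p r h = trans (solve 2 (λ p r → p :* r :- con 0ℚ :* con 0ℚ := r :* p) refl p r) h
    im-part : ∀ p r → p * 0ℚ + 0ℚ * r ≡ 0ℚ
    im-part = solve 2 (λ p r → p :* con 0ℚ :+ con 0ℚ :* r := con 0ℚ) refl

∥Π⁻¹∥ : ∥ Π⁻¹ ∥≤ ½
∥Π⁻¹∥ = ∥∥-pointwise λ k → ≤-trans (≤-reflexive (trans (norm-Π⁻¹ k) (0≤p⇒∣p∣≡p (<⇒≤ (0<recip (<-≤-trans 0<2 (2≤πSum k)))))))
    (recip-anti {2ℚ} {πSum k} 0<2 (2≤πSum k))
  where
  0<2 : 0ℚ < 2ℚ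
  0<2 = positive⁻¹ 2ℚ

∥iπ⊗∥ : ∀ {w q} → ∥ w ∥≤ q → ∥ iπ ⊗ w ∥≤ 4ℚ * q
∥iπ⊗∥ h = ∥∥-⊗ (∥∥-≡ (*-identityˡ 4ℚ) (∥∥-⊗ ∥∥-ι ∥Π∥)) h

iπ⊗⊝ : ∀ w → ⊝ (iπ ⊗ w) ≈ iπ ⊗ (⊝ w)
iπ⊗⊝ w = solveᶜ 2 (λ p w → ⊟ (p ⊠ w) ≔ p ⊠ (⊟ w)) ≈-refl iπ w

D-approx : ∀ {w q} → ∥ iπ ⊗ w ∥≤ q → q ≤ 1ℚ → ∥ D w ⊖ ⌜ 2ℚ ⌝ ⊗ (iπ ⊗ w) ∥≤ 1½ * (q * q)
D-approx {w} {q} h q≤1 = ∥∥-≡ (solve 1 (λ s → con ¾ :* s :+ con ¾ :* s := con 1½ :* s) refl (q * q))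
  (∥∥-resp (solveᶜ 4 (λ a b p w → (a ⊟ (conᶜ 1ℚ ⊞ p ⊠ w)) ⊟ (b ⊟ (conᶜ 1ℚ ⊞ p ⊠ (⊟ w))) ≔ (a ⊟ b) ⊟ conᶜ 2ℚ ⊠ (p ⊠ w)) ≈-refl (e w) (e (⊝ w)) iπ w)
    (∥∥-⊖ (Exp-remainder h q≤1) (Exp-remainder (∥∥-resp (iπ⊗⊝ w) (∥∥-⊝ h)) q≤1)))

C-approx : ∀ {w q} → ∥ iπ ⊗ w ∥≤ q → q ≤ 1ℚ → ∥ C w ⊖ ⌜ 2ℚ ⌝ ∥≤ 1½ * (q * q)
C-approx {w} {q} h q≤1 = ∥∥-≡ (solve 1 (λ s → con ¾ :* s :+ con ¾ :* s := con 1½ :* s) refl (q * q))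
  (∥∥-resp (solveᶜ 4 (λ a b p w → (a ⊟ (conᶜ 1ℚ ⊞ p ⊠ w)) ⊞ (b ⊟ (conᶜ 1ℚ ⊞ p ⊠ (⊟ w))) ≔ (a ⊞ b) ⊟ conᶜ 2ℚ) ≈-refl (e w) (e (⊝ w)) iπ w)
    (∥∥-⊕ (Exp-remainder h q≤1) (Exp-remainder (∥∥-resp (iπ⊗⊝ w) (∥∥-⊝ h)) q≤1)))

∥D∥ : ∀ {w q} → ∥ iπ ⊗ w ∥≤ q → q ≤ 1ℚ → ∥ D w ∥≤ 4ℚ * q
∥D∥ {w} {q} h q≤1 = ∥∥-≡ (solve 1 (λ q → (q :+ q) :+ (q :+ q) := con 4ℚ :* q) refl q)
  (∥∥-resp (solveᶜ 2 (λ a b → (a ⊟ conᶜ 1ℚ) ⊟ (b ⊟ conᶜ 1ℚ) ≔ a ⊟ b) ≈-refl (e w) (e (⊝ w)))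
    (∥∥-⊖ (Exp-near-1 h q≤1) (Exp-near-1 (∥∥-resp (iπ⊗⊝ w) (∥∥-⊝ h)) q≤1)))

∥⌜⌝∥≤ : ∀ {q c} → 0ℚ ≤ q → q ≤ c → ∥ ⌜ q ⌝ ∥≤ c
∥⌜⌝∥≤ 0≤q q≤c = ∥∥-weaken (∥∥-⌜⌝⁺ 0≤q) q≤c

-- As 4 bounds π, b ≤ ¼ gives ∥ iπb ∥≤ 1. Then C b differs from 2 by at most 1½, and half of it from
-- 1 by at most ¾.
C-inverse : ∀ {b} → 0ℚ ≤ b → b ≤ ¼ → Inverse (C ⌜ b ⌝) (½ * 9ℚ)
C-inverse {b} 0≤b b≤¼ = Inverse-factor ⌜ ½ ⌝ (∥∥-⌜⌝⁺ (<⇒≤ 0<½)) (near-1-inverse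
  (∥∥-resp (solveᶜ 1 (λ c → (c ⊟ conᶜ 2ℚ) ⊠ conᶜ ½ ≔ c ⊠ conᶜ ½ ⊟ conᶜ 1ℚ) ≈-refl (C ⌜ b ⌝))
    (∥∥-⊗ (C-approx (∥iπ⊗∥ (∥⌜⌝∥≤ 0≤b b≤¼)) ≤-refl) (∥∥-⌜⌝⁺ (<⇒≤ 0<½)))))

⅛ : ℚ
⅛ = ½ * (½ * ½)

-- The inverse u of the linear part 2πib brings D b close to 1: the error is at most 1½ (4b)² · 1 /
-- (4b) = 6b, which stays below ¾ exactly up to b = ⅛.
D-inverse-small : ∀ {b} → 0ℚ < b → b ≤ ⅛ → Inverse (D ⌜ b ⌝) (½ * (½ * recip b) * 9ℚ)
D-inverse-small {b} 0<b b≤⅛ = Inverse-factor u ∥u∥ (near-1-inverse (∥∥-weaken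
    (∥∥-resp (≈-trans (solveᶜ 3 (λ d x u → (d ⊟ x) ⊠ u ≔ d ⊠ u ⊟ x ⊠ u) ≈-refl (D ⌜ b ⌝) (⌜ 2ℚ ⌝ ⊗ (iπ ⊗ ⌜ b ⌝)) u) (⊖-congˡ u-inverse))
      (∥∥-⊗ (D-approx {q = 4ℚ * b} (∥iπ⊗∥ (∥∥-⌜⌝⁺ 0≤b)) (≤-trans (*-monoˡ₀ 4ℚ 0≤4 b≤⅛) (p≤p+q ½ (<⇒≤ 0<½)))) ∥u∥))
    (begin
      1½ * (4ℚ * b * (4ℚ * b)) * (½ * (½ * recip b))
        ≡⟨ solve 2 (λ b r → con 1½ :* (con 4ℚ :* b :* (con 4ℚ :* b)) :* (con ½ :* (con ½ :* r)) := con (4ℚ + 2ℚ) :* b :* (r :* b)) refl b (recip b) ⟩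
      (4ℚ + 2ℚ) * b * (recip b * b)   ≡⟨ trans (cong ((4ℚ + 2ℚ) * b *_) (recip* 0<b)) (*-identityʳ ((4ℚ + 2ℚ) * b)) ⟩
      (4ℚ + 2ℚ) * b                   ≤⟨ *-monoˡ₀ (4ℚ + 2ℚ) (nonNegative⁻¹ (4ℚ + 2ℚ)) b≤⅛ ⟩
      (4ℚ + 2ℚ) * ⅛                   ≡⟨⟩
      ¾                               ∎)))
  where
  open ≤-Reasoning
  0≤b = <⇒≤ 0<b
  u : ℂ
  u = ⌜ ½ ⌝ ⊗ ((⊝ ι) ⊗ Π⁻¹ ⊗ ⌜ recip b ⌝)
  ∥u∥ : ∥ u ∥≤ ½ * (½ * recip b)
  ∥u∥ = ∥∥-⊗ (∥∥-⌜⌝⁺ (<⇒≤ 0<½)) (∥∥-⊗ (∥∥-≡ (*-identityˡ ½) (∥∥-⊗ (∥∥-⊝ ∥∥-ι) ∥Π⁻¹∥)) (∥∥-⌜⌝⁺ (<⇒≤ (0<recip 0<b))))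
  u-inverse : ⌜ 2ℚ ⌝ ⊗ (iπ ⊗ ⌜ b ⌝) ⊗ u ≈ ⌜ 1ℚ ⌝
  u-inverse = ≈-trans
    (solveᶜ 5 (λ i p b p′ r → conᶜ 2ℚ ⊠ (i ⊠ p ⊠ b) ⊠ (conᶜ ½ ⊠ ((⊟ i) ⊠ p′ ⊠ r)) ≔ (i ⊠ (⊟ i)) ⊠ (p ⊠ p′) ⊠ (r ⊠ b)) ≈-refl ι Π ⌜ b ⌝ Π⁻¹ ⌜ recip b ⌝)
    (≈-trans (⊗-cong (⊗-cong ι⊗-ι Π⊗Π⁻¹) (≈-trans (≈-sym (⌜⌝-* (recip b) b)) (⌜⌝-cong (recip* 0<b))))
      (solveᶜ 0 (conᶜ 1ℚ ⊠ conᶜ 1ℚ ⊠ conᶜ 1ℚ ≔ conᶜ 1ℚ) ≈-refl))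

-- Three inverses of numbers near 1 give 9 each. The weights are ½ · ½ · 4 for D b with b = q/4, and
-- ½ for each of the two cosines.
Kᴰ : ℚ
Kᴰ = 9ℚ * 9ℚ * 9ℚ * ¼

-- Small angles are handled by the series, larger ones by D (4b) = D b · C b · C (2b).
D-inverse : ∀ {q} → 0ℚ < q → q ≤ ½ → Inverse (D ⌜ q ⌝) (Kᴰ * recip q)
D-inverse {q} 0<q q≤½ = Inverse-resp quadruple
    (trans (cong (λ r → ½ * (½ * r) * 9ℚ * (½ * 9ℚ) * (½ * 9ℚ)) recip-b)
      (solve 1 (λ r → con ½ :* (con ½ :* (con 4ℚ :* r)) :* con 9ℚ :* (con ½ :* con 9ℚ) :* (con ½ :* con 9ℚ) := con Kᴰ :* r) refl (recip q)))
    (Inverse-⊗ (Inverse-⊗ (D-inverse-small 0<b b≤⅛) (C-inverse 0≤b (≤-trans b≤⅛ (p≤p+q ⅛ (nonNegative⁻¹ ⅛)))))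
               (C-inverse (nonNeg+ 0≤b 0≤b) (+-mono-≤ b≤⅛ b≤⅛)))
  where
  b : ℚ
  b = ¼ * q
  0<b : 0ℚ < b
  0<b = pos* (positive⁻¹ ¼) 0<q
  0≤b = <⇒≤ 0<b
  b≤⅛ : b ≤ ⅛
  b≤⅛ = *-monoˡ₀ ¼ (nonNegative⁻¹ ¼) q≤½
  recip-b : recip b ≡ 4ℚ * recip q
  recip-b = inv-unique {c = b} (recip* 0<b) (trans (solve 2 (λ r q → con 4ℚ :* r :* (con ¼ :* q) := r :* q) refl (recip q) q) (recip* 0<q))
  quadruple : D ⌜ b ⌝ ⊗ C ⌜ b ⌝ ⊗ C ⌜ b + b ⌝ ≈ D ⌜ q ⌝
  quadruple = begin
    D ⌜ b ⌝ ⊗ C ⌜ b ⌝ ⊗ C ⌜ b + b ⌝              ≈⟨ ⊗-cong (≈-trans (≈-sym (D-double ⌜ b ⌝)) (D-cong (≈-sym (⌜⌝-+ b b)))) ≈-refl ⟩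
    D ⌜ b + b ⌝ ⊗ C ⌜ b + b ⌝                    ≈⟨ ≈-sym (D-double ⌜ b + b ⌝) ⟩
    D (⌜ b + b ⌝ ⊕ ⌜ b + b ⌝)                    ≈⟨ D-cong (≈-trans (≈-sym (⌜⌝-+ (b + b) (b + b))) (⌜⌝-cong (solve 1 (λ q → con ¼ :* q :+ con ¼ :* q :+ (con ¼ :* q :+ con ¼ :* q) := q) refl q))) ⟩
    D ⌜ q ⌝                                      ∎
    where open ≈-Reasoning

inverse-D : ∀ q → Dec (0ℚ < q) → Dec (q ≤ ½) → ℂ
inverse-D q (yes 0<q) (yes q≤½) = inverse (D-inverse 0<q q≤½)
inverse-D q _         _         = ⌜ 0ℚ ⌝

-- 1 / D q for 0 < q ≤ ½, and junk otherwise.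
opaque
  D⁻¹ : ℚ → ℂ
  D⁻¹ q = inverse-D q (0ℚ <? q) (q ≤? ½)

  D⁻¹-spec : ∀ q → 0ℚ < q → q ≤ ½ → D ⌜ q ⌝ ⊗ D⁻¹ q ≈ ⌜ 1ℚ ⌝ × ∥ D⁻¹ q ∥≤ Kᴰ * recip q
  D⁻¹-spec q 0<q q≤½ = go (0ℚ <? q) (q ≤? ½)
    where
    go : ∀ d d′ → D ⌜ q ⌝ ⊗ inverse-D q d d′ ≈ ⌜ 1ℚ ⌝ × ∥ inverse-D q d d′ ∥≤ Kᴰ * recip q
    go (yes 0<q) (yes q≤½) = isInverse (D-inverse 0<q q≤½) , ∥inverse∥ (D-inverse 0<q q≤½)
    go (no ¬p)   _         = contradiction 0<q ¬p
    go (yes _)   (no ¬p)   = contradiction q≤½ ¬p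

∥∥-near-1 : ∀ {z q} → ∥ z ⊖ ⌜ 1ℚ ⌝ ∥≤ q → ∥ z ∥≤ q + 1ℚ
∥∥-near-1 {z} h = ∥∥-resp (solveᶜ 1 (λ p → (p ⊟ conᶜ 1ℚ) ⊞ conᶜ 1ℚ ≔ p) ≈-refl z) (∥∥-⊕ h ∥∥-1)

-- The bounds for y are differences of u, so that they telescope. By induction the partial product
-- stays within 1 of 1, as u 0 ≤ ½; its norm is then at most 2, which is the factor 2 in the bound
-- for the next step.
prod-near-1 : ∀ (y : ℕ → ℂ) (u : ℕ → ℚ) n → (∀ k → 0ℚ ≤ u k) → u 0 ≤ ½ → (∀ k → k ℕ.< n → ∥ y k ∥≤ u k - u (suc k)) →
              ∥ prod n (λ k → ⌜ 1ℚ ⌝ ⊖ y k) ⊖ ⌜ 1ℚ ⌝ ∥≤ 2ℚ * (u 0 - u n)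
prod-near-1 y u zero    0≤u u≤½ h = ∥z⊖z∥ ≈-refl (≤-reflexive (solve 1 (λ u → con 0ℚ := con 2ℚ :* (u :- u)) refl (u 0)))
prod-near-1 y u (suc n) 0≤u u≤½ h = ∥∥-≡ (solve 3 (λ a b c → con 2ℚ :* (a :- b) :+ con 2ℚ :* (b :- c) := con 2ℚ :* (a :- c)) refl (u 0) (u n) (u (suc n)))
  (∥∥-resp (solveᶜ 2 (λ p y → (p ⊟ conᶜ 1ℚ) ⊟ p ⊠ y ≔ p ⊠ (conᶜ 1ℚ ⊟ y) ⊟ conᶜ 1ℚ) ≈-refl P (y n))
    (∥∥-⊖ ih (∥∥-⊗ ∥P∥ (h n ℕₚ.≤-refl))))
  where
  P : ℂ
  P = prod n (λ k → ⌜ 1ℚ ⌝ ⊖ y k)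
  ih = prod-near-1 y u n 0≤u u≤½ λ k k<n → h k (ℕₚ.m<n⇒m<1+n k<n)
  ∥P∥ : ∥ P ∥≤ 2ℚ
  ∥P∥ = ∥∥-weaken (∥∥-near-1 ih)
    (+-monoˡ-≤ 1ℚ (*-monoˡ₀ {u 0 - u n} {½} 2ℚ 0≤2 (≤-trans (p-q≤p (u 0) (0≤u n)) u≤½)))

-- For n = j + 1 this is 1/n ≤ 2 / (n + 1) multiplied by 1/n. It gives ∑ 1/n² a telescoping
-- majorant, as `prod-near-1` requires.
inv-square≤ : ∀ j → inv (suc j) * inv (suc j) ≤ 2ℚ * inv (suc j) - 2ℚ * inv (suc (suc j))
inv-square≤ j = begin
  a * a                        ≤⟨ *-monoˡ₀ a (0≤inv j) a≤2b ⟩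
  a * (2ℚ * b)                 ≡⟨ solve 2 (λ a b → a :* (con 2ℚ :* b) := con 2ℚ :* (a :* b :* con 1ℚ)) refl a b ⟩
  2ℚ * (a * b * 1ℚ)            ≡⟨ cong (λ t → 2ℚ * (a * b * t)) (trans (solve 1 (λ m → con 1ℚ := (con 1ℚ :+ m) :- m) refl (fromℕ (suc j))) (cong (_- fromℕ (suc j)) (sym (fromℕ-suc (suc j))))) ⟩
  2ℚ * (a * b * (n - m))       ≡⟨ solve 4 (λ a b n m → con 2ℚ :* (a :* b :* (n :- m)) := con 2ℚ :* a :* (b :* n) :- con 2ℚ :* b :* (a :* m)) refl a b n m ⟩
  2ℚ * a * (b * n) - 2ℚ * b * (a * m)  ≡⟨ cong₂ (λ s t → 2ℚ * a * s - 2ℚ * b * t) (inv*fromℕ (suc j)) (inv*fromℕ j) ⟩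
  2ℚ * a * 1ℚ - 2ℚ * b * 1ℚ    ≡⟨ cong₂ _-_ (*-identityʳ (2ℚ * a)) (*-identityʳ (2ℚ * b)) ⟩
  2ℚ * a - 2ℚ * b              ∎
  where
  open ≤-Reasoning
  a b m n : ℚ
  a = inv (suc j)
  b = inv (suc (suc j))
  m = fromℕ (suc j)
  n = fromℕ (suc (suc j))
  a≤2b : a ≤ 2ℚ * b
  a≤2b = subst (_≤ 2ℚ * b) (trans (cong (2ℚ *_) (trans (inv-* (suc j) 2) (cong (a *_) inv-2))) (solve 1 (λ a → con 2ℚ :* (a :* con ½) := a) refl a))
    (*-monoˡ₀ 2ℚ 0≤2 (inv-anti {suc j} {suc (j ℕ.* 2)} (ℕ.s≤s (ℕₚ.m≤m*n j 2))))

-- The limit of the finite products, by Tannery's theorem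

module Tannery (w : ℂ) where
  β : ℚ
  β = fromℕ (proj₁ (∥∥-bounded w))
  0≤β : 0ℚ ≤ β
  0≤β = 0≤fromℕ (proj₁ (∥∥-bounded w))
  ∥w∥ : ∥ w ∥≤ β
  ∥w∥ = proj₂ (∥∥-bounded w)

  H G : ℕ → ℚ
  H r = ½ ^ℚ suc r
  G r = fromℕ (2 ℕ.^ suc r)
  G*H : ∀ r → G r * H r ≡ 1ℚ
  G*H r = 2^*½^ (suc r)

  α : ℕ → ℂ
  α r = D (⌜ H r ⌝ ⊗ w)
  y : ℕ → ℕ → ℂ
  y r k = sq (α r ⊗ D⁻¹ (angle r k))

  recip-angle : ∀ r k → recip (angle r k) ≡ inv (suc k) * G r
  recip-angle r k = inv-unique {c = angle r k} (recip* (angle-pos r k))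
    (trans (solve 4 (λ i g m h → i :* g :* (m :* h) := (i :* m) :* (g :* h)) refl (inv (suc k)) (G r) (fromℕ (suc k)) (H r))
      (trans (cong₂ _*_ (inv*fromℕ k) (G*H r)) (*-identityˡ 1ℚ)))

  D⁻¹-inverse : ∀ r {k} → k ℕ.≤ 2^-1 r → D ⌜ angle r k ⌝ ⊗ D⁻¹ (angle r k) ≈ ⌜ 1ℚ ⌝
  D⁻¹-inverse r {k} k≤ = proj₁ (D⁻¹-spec (angle r k) (angle-pos r k) (angle≤½ r k≤))

  ∥D⁻¹∥ : ∀ r {k} → k ℕ.≤ 2^-1 r → ∥ D⁻¹ (angle r k) ∥≤ Kᴰ * (inv (suc k) * G r)
  ∥D⁻¹∥ r {k} k≤ = ∥∥-≡ (cong (Kᴰ *_) (recip-angle r k)) (proj₂ (D⁻¹-spec (angle r k) (angle-pos r k) (angle≤½ r k≤)))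

  η : ℕ → ℚ
  η r = 4ℚ * (½ ^ℚ r * β)
  ∥iπw∥ : ∀ r → ∥ iπ ⊗ (⌜ ½ ^ℚ r ⌝ ⊗ w) ∥≤ η r
  ∥iπw∥ r = ∥iπ⊗∥ (∥∥-⊗ (∥∥-⌜⌝⁺ (<⇒≤ (0<½^ r))) ∥w∥)

  r₀ : ℕ
  r₀ = proj₁ (nullSeq (4ℚ * β) (nonNeg* 0≤4 0≤β) 1ℚ 0<1)
  η≤1 : ∀ {r} → r₀ ℕ.≤ r → η r ≤ 1ℚ
  η≤1 {r} le = begin
    4ℚ * (½ ^ℚ r * β)   ≡⟨ solve 2 (λ h b → con 4ℚ :* (h :* b) := con 4ℚ :* b :* h) refl (½ ^ℚ r) β ⟩
    4ℚ * β * ½ ^ℚ r     ≤⟨ *-monoˡ₀ (4ℚ * β) (nonNeg* 0≤4 0≤β) (½^-anti le) ⟩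
    4ℚ * β * ½ ^ℚ r₀    ≤⟨ proj₂ (nullSeq (4ℚ * β) (nonNeg* 0≤4 0≤β) 1ℚ 0<1) ⟩
    1ℚ                  ∎
    where open ≤-Reasoning

  -- ∥ α r ∥ is at most 4 · 4 H β and the inverse sine at most Kᴰ G / (k + 1). As G H = 1, their
  -- product is at most c / (k + 1), uniformly in r.
  c : ℚ
  c = 4ℚ * 4ℚ * Kᴰ * β
  0≤c : 0ℚ ≤ c
  0≤c = nonNeg* (nonNegative⁻¹ (4ℚ * 4ℚ * Kᴰ)) 0≤β
  β≤c : β ≤ c
  β≤c = subst (_≤ c) (*-identityˡ β) (*-monoʳ₀ {1ℚ} {4ℚ * 4ℚ * Kᴰ} β 0≤β (p≤p+q 1ℚ (nonNegative⁻¹ (4ℚ * 4ℚ * Kᴰ - 1ℚ))))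

  u : ℕ → ℚ
  u j = c * c * (2ℚ * inv (suc j))
  0≤u : ∀ j → 0ℚ ≤ u j
  0≤u j = nonNeg* (square-nonNeg c) (nonNeg* 0≤2 (0≤inv j))
  square≤u : ∀ j → c * inv (suc j) * (c * inv (suc j)) ≤ u j - u (suc j)
  square≤u j = begin
    c * inv (suc j) * (c * inv (suc j))          ≡⟨ solve 2 (λ c i → c :* i :* (c :* i) := c :* c :* (i :* i)) refl c (inv (suc j)) ⟩
    c * c * (inv (suc j) * inv (suc j))          ≤⟨ *-monoˡ₀ (c * c) (square-nonNeg c) (inv-square≤ j) ⟩
    c * c * (2ℚ * inv (suc j) - 2ℚ * inv (suc (suc j)))
      ≡⟨ solve 3 (λ c a b → c :* (a :- b) := c :* a :- c :* b) refl (c * c) (2ℚ * inv (suc j)) (2ℚ * inv (suc (suc j))) ⟩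
    u j - u (suc j)                              ∎
    where open ≤-Reasoning

  ∥y∥ : ∀ {r k} → r₀ ℕ.≤ r → k ℕ.≤ 2^-1 r → ∥ y r k ∥≤ u k - u (suc k)
  ∥y∥ {r} {k} r₀≤r k≤ = ∥∥-weaken (∥∥-⊗ ∥αV∥ ∥αV∥) (square≤u k)
    where
    ∥αV∥ : ∥ α r ⊗ D⁻¹ (angle r k) ∥≤ c * inv (suc k)
    ∥αV∥ = ∥∥-≡ (trans (solve 4 (λ h b i g → con 4ℚ :* (con 4ℚ :* (h :* b)) :* (con Kᴰ :* (i :* g)) := con (4ℚ * 4ℚ * Kᴰ) :* b :* i :* (g :* h)) refl (H r) β (inv (suc k)) (G r))
        (trans (cong (c * inv (suc k) *_) (G*H r)) (*-identityʳ (c * inv (suc k)))))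
      (∥∥-⊗ (∥D∥ (∥iπw∥ (suc r)) (η≤1 (ℕₚ.m≤n⇒m≤1+n r₀≤r))) (∥D⁻¹∥ r k≤))

  factor : ℕ → ℂ
  factor k = ⌜ inv (suc k) ⌝ ⊗ w

  ∥factor∥ : ∀ k → ∥ sq (factor k) ∥≤ u k - u (suc k)
  ∥factor∥ k = ∥∥-weaken (∥∥-⊗ ∥iw∥ ∥iw∥) (square≤u k)
    where
    ∥iw∥ : ∥ factor k ∥≤ c * inv (suc k)
    ∥iw∥ = ∥∥-weaken (∥∥-⊗ (∥∥-⌜⌝⁺ (0≤inv k)) ∥w∥) (≤-trans (*-monoˡ₀ (inv (suc k)) (0≤inv k) β≤c) (≤-reflexive (*-comm (inv (suc k)) c)))

  r≤2^-1 : ∀ r → r ℕ.≤ 2^-1 r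
  r≤2^-1 zero    = ℕ.z≤n
  r≤2^-1 (suc r) = ℕ.s≤s (ℕₚ.≤-trans (r≤2^-1 r) (ℕₚ.m≤m+n _ _))

  -- Numerator and denominator are compared with their linear parts, whose quotient is exactly w /
  -- (k + 1). The errors are O(H²) and the inverse sine is O(G), so that O(H) remains; r₁ ensures
  -- that the linearisation applies at the angle of index k.
  factor-⇒ : ∀ k → (λ r → α r ⊗ D⁻¹ (angle r k)) ⇒ factor k
  factor-⇒ k = ⇒-½^ C₀ 0≤C₀ (r₀ ℕ.⊔ (k ℕ.⊔ r₁)) λ r le → close r (≤⊔ˡ le) (≤⊔ˡ (≤⊔ʳ {r₀} le)) (≤⊔ʳ {k} (≤⊔ʳ {r₀} le))
    where
    i m C₀ : ℚ
    i = inv (suc k)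
    m = fromℕ (suc k)
    C₀ = Kᴰ * i * 1½ * (4ℚ * 4ℚ * (β * β) + i * β * (4ℚ * 4ℚ * (m * m))) * ½
    0≤m : 0ℚ ≤ m
    0≤m = 0≤fromℕ (suc k)
    0≤C₀ : 0ℚ ≤ C₀
    0≤C₀ = nonNeg* (nonNeg* (nonNeg* (nonNeg* (nonNegative⁻¹ Kᴰ) (0≤inv k)) 0≤1½)
      (nonNeg+ (nonNeg* (nonNegative⁻¹ (4ℚ * 4ℚ)) (square-nonNeg β)) (nonNeg* (nonNeg* (0≤inv k) 0≤β) (nonNeg* (nonNegative⁻¹ (4ℚ * 4ℚ)) (square-nonNeg m))))) (<⇒≤ 0<½)
    r₁ : ℕ
    r₁ = proj₁ (nullSeq (4ℚ * m) (nonNeg* 0≤4 0≤m) 1ℚ 0<1)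
    close : ∀ r → r₀ ℕ.≤ r → k ℕ.≤ r → r₁ ℕ.≤ r → ∥ α r ⊗ D⁻¹ (angle r k) ⊖ factor k ∥≤ C₀ * ½ ^ℚ r
    close r r₀≤r k≤r r₁≤r = ∥∥-≡ constants (∥∥-resp split
        (∥∥-⊖ (∥∥-⊗ (D-approx (∥iπw∥ (suc r)) (η≤1 (ℕₚ.m≤n⇒m≤1+n r₀≤r))) (∥D⁻¹∥ r k≤n))
              (∥∥-⊗ (∥∥-⊗ (∥∥-⌜⌝⁺ (0≤inv k)) ∥w∥) (∥∥-⊗ (D-approx ∥q∥ 4q≤1) (∥D⁻¹∥ r k≤n)))))
      where
      k≤n : k ℕ.≤ 2^-1 r
      k≤n = ℕₚ.≤-trans k≤r (r≤2^-1 r)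
      q : ℚ
      q = angle r k
      ∥q∥ : ∥ iπ ⊗ ⌜ q ⌝ ∥≤ 4ℚ * q
      ∥q∥ = ∥iπ⊗∥ (∥∥-⌜⌝⁺ (<⇒≤ (angle-pos r k)))
      4q≤1 : 4ℚ * q ≤ 1ℚ
      4q≤1 = ≤-trans (≤-reflexive (sym (*-assoc 4ℚ m (H r)))) (≤-trans (*-monoˡ₀ (4ℚ * m) (nonNeg* 0≤4 0≤m) (½^-anti (ℕₚ.m≤n⇒m≤1+n r₁≤r)))
        (proj₂ (nullSeq (4ℚ * m) (nonNeg* 0≤4 0≤m) 1ℚ 0<1)))
      v : ℂ
      v = D⁻¹ q
      i⊗q : ⌜ i ⌝ ⊗ ⌜ q ⌝ ≈ ⌜ H r ⌝
      i⊗q = ≈-trans (≈-sym (⌜⌝-* i q)) (⌜⌝-cong (trans (sym (*-assoc i m (H r))) (trans (cong (_* H r) (inv*fromℕ k)) (*-identityˡ (H r)))))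
      split : (α r ⊖ ⌜ 2ℚ ⌝ ⊗ (iπ ⊗ (⌜ H r ⌝ ⊗ w))) ⊗ v ⊖ ⌜ i ⌝ ⊗ w ⊗ ((D ⌜ q ⌝ ⊖ ⌜ 2ℚ ⌝ ⊗ (iπ ⊗ ⌜ q ⌝)) ⊗ v) ≈ α r ⊗ v ⊖ factor k
      split = begin
        (α r ⊖ ⌜ 2ℚ ⌝ ⊗ (iπ ⊗ (⌜ H r ⌝ ⊗ w))) ⊗ v ⊖ ⌜ i ⌝ ⊗ w ⊗ ((D ⌜ q ⌝ ⊖ ⌜ 2ℚ ⌝ ⊗ (iπ ⊗ ⌜ q ⌝)) ⊗ v)
          ≈⟨ ⊕-cong (⊗-cong (⊖-congˡ (⊗-congˡ (⊗-congˡ (⊗-cong (≈-sym i⊗q) ≈-refl)))) ≈-refl) ≈-refl ⟩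
        (α r ⊖ ⌜ 2ℚ ⌝ ⊗ (iπ ⊗ (⌜ i ⌝ ⊗ ⌜ q ⌝ ⊗ w))) ⊗ v ⊖ ⌜ i ⌝ ⊗ w ⊗ ((D ⌜ q ⌝ ⊖ ⌜ 2ℚ ⌝ ⊗ (iπ ⊗ ⌜ q ⌝)) ⊗ v)
          ≈⟨ solveᶜ 7 (λ a p i q w v d → (a ⊟ conᶜ 2ℚ ⊠ (p ⊠ (i ⊠ q ⊠ w))) ⊠ v ⊟ i ⊠ w ⊠ ((d ⊟ conᶜ 2ℚ ⊠ (p ⊠ q)) ⊠ v) ≔ a ⊠ v ⊟ i ⊠ w ⊠ (d ⊠ v)) ≈-refl
               (α r) iπ ⌜ i ⌝ ⌜ q ⌝ w v (D ⌜ q ⌝) ⟩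
        α r ⊗ v ⊖ ⌜ i ⌝ ⊗ w ⊗ (D ⌜ q ⌝ ⊗ v)
          ≈⟨ ⊖-congˡ (≈-trans (⊗-congˡ (D⁻¹-inverse r k≤n)) (solveᶜ 1 (λ z → z ⊠ conᶜ 1ℚ ≔ z) ≈-refl (⌜ i ⌝ ⊗ w))) ⟩
        α r ⊗ v ⊖ factor k ∎
        where open ≈-Reasoning
      constants : 1½ * (η (suc r) * η (suc r)) * (Kᴰ * (i * G r)) + i * β * (1½ * (4ℚ * q * (4ℚ * q)) * (Kᴰ * (i * G r))) ≡ C₀ * ½ ^ℚ r
      constants = trans
        (solve 5 (λ h g i m b → con 1½ :* (con 4ℚ :* (h :* con ½ :* b) :* (con 4ℚ :* (h :* con ½ :* b))) :* (con Kᴰ :* (i :* g))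
            :+ i :* b :* (con 1½ :* (con 4ℚ :* (m :* (h :* con ½)) :* (con 4ℚ :* (m :* (h :* con ½)))) :* (con Kᴰ :* (i :* g)))
          := con Kᴰ :* i :* con 1½ :* (con 4ℚ :* con 4ℚ :* (b :* b) :+ i :* b :* (con 4ℚ :* con 4ℚ :* (m :* m))) :* con ½ :* h :* (g :* (h :* con ½))) refl
          (½ ^ℚ r) (G r) i m β)
        (trans (cong (C₀ * ½ ^ℚ r *_) (G*H r)) (*-identityʳ (C₀ * ½ ^ℚ r)))

  P : ℕ → ℂ
  P K = prod K (λ k → ⌜ 1ℚ ⌝ ⊖ sq (factor k))

  prod-⇒ : ∀ K → (λ r → prod K (λ k → ⌜ 1ℚ ⌝ ⊖ y r k)) ⇒ P K
  prod-⇒ zero    = ⇒-const ≈-refl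
  prod-⇒ (suc K) = ⇒-⊗ (prod-⇒ K) (⇒-⊕ (⇒-const ≈-refl) (⇒-⊝ (⇒-⊗ (factor-⇒ K) (factor-⇒ K))))

  T : ℕ → ℂ
  T r = ⌜ fromℕ (2 ℕ.^ r) ⌝ ⊗ D (⌜ ½ ^ℚ r ⌝ ⊗ w)

  T-⇒ : T ⇒ ⌜ 2ℚ ⌝ ⊗ (iπ ⊗ w)
  T-⇒ = ⇒-½^ C₀ 0≤C₀ r₀ λ r r₀≤r → ∥∥-≡ (constants r) (∥∥-resp (split r)
      (∥∥-⊗ (∥∥-⌜⌝⁺ (0≤fromℕ (2 ℕ.^ r))) (D-approx (∥iπw∥ r) (η≤1 r₀≤r))))
    where
    C₀ : ℚ
    C₀ = 1½ * (4ℚ * 4ℚ) * (β * β)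
    0≤C₀ : 0ℚ ≤ C₀
    0≤C₀ = nonNeg* (nonNegative⁻¹ (1½ * (4ℚ * 4ℚ))) (square-nonNeg β)
    constants : ∀ r → fromℕ (2 ℕ.^ r) * (1½ * (η r * η r)) ≡ C₀ * ½ ^ℚ r
    constants r = trans (solve 3 (λ m h b → m :* (con 1½ :* (con 4ℚ :* (h :* b) :* (con 4ℚ :* (h :* b)))) := con 1½ :* (con 4ℚ :* con 4ℚ) :* (b :* b) :* h :* (m :* h)) refl (fromℕ (2 ℕ.^ r)) (½ ^ℚ r) β)
      (trans (cong (C₀ * ½ ^ℚ r *_) (2^*½^ r)) (*-identityʳ (C₀ * ½ ^ℚ r)))
    split : ∀ r → ⌜ fromℕ (2 ℕ.^ r) ⌝ ⊗ (D (⌜ ½ ^ℚ r ⌝ ⊗ w) ⊖ ⌜ 2ℚ ⌝ ⊗ (iπ ⊗ (⌜ ½ ^ℚ r ⌝ ⊗ w))) ≈ T r ⊖ ⌜ 2ℚ ⌝ ⊗ (iπ ⊗ w)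
    split r = ≈-trans (solveᶜ 5 (λ m d h p w → m ⊠ (d ⊟ conᶜ 2ℚ ⊠ (p ⊠ (h ⊠ w))) ≔ m ⊠ d ⊟ (m ⊠ h) ⊠ (conᶜ 2ℚ ⊠ (p ⊠ w))) ≈-refl ⌜ fromℕ (2 ℕ.^ r) ⌝ (D (⌜ ½ ^ℚ r ⌝ ⊗ w)) ⌜ ½ ^ℚ r ⌝ iπ w)
      (⊖-congˡ (≈-trans (⊗-cong (≈-trans (≈-sym (⌜⌝-* (fromℕ (2 ℕ.^ r)) (½ ^ℚ r))) (⌜⌝-cong (2^*½^ r))) ≈-refl) (⊗-identityˡ (⌜ 2ℚ ⌝ ⊗ (iπ ⊗ w)))))

  X : ℕ → ℂ
  X K = ⌜ 2ℚ ⌝ ⊗ (iπ ⊗ w) ⊗ P K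

  x : ℕ → ℕ → ℂ
  x K r = T r ⊗ prod K (λ k → ⌜ 1ℚ ⌝ ⊖ y r k)

  -- For each late r, `D w` is the truncated product `x K r` times a tail within 2 u K of 1. That
  -- bound is uniform in r, so r can be taken so large that `x K r` is as close to `X K` as desired.
  near : ∀ K {B} → u K ≤ ½ → ∥ X K ∥≤ B → ∥ D w ⊖ X K ∥≤ B * (2ℚ * u K)
  near K {B} u≤½ hB = ∥∥-closed λ ε 0<ε →
    let N , h = within (⇒-⊗ T-⇒ (prod-⇒ K)) (½ * ε) (pos* 0<½ 0<ε)
        r = N ℕ.⊔ (K ℕ.⊔ r₀)
    in at ε (<⇒≤ 0<ε) r (ℕₚ.≤-trans (ℕₚ.m≤n⊔m K r₀) (ℕₚ.m≤n⊔m N _)) (ℕₚ.≤-trans (ℕₚ.≤-trans (ℕₚ.m≤m⊔n K r₀) (ℕₚ.m≤n⊔m N _)) (r≤2^-1 r)) (h r (ℕₚ.m≤m⊔n N _))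
    where
    at : ∀ ε → 0ℚ ≤ ε → ∀ r → r₀ ℕ.≤ r → K ℕ.≤ 2^-1 r → ∥ x K r ⊖ X K ∥≤ ½ * ε → ∥ D w ⊖ X K ∥≤ B * (2ℚ * u K) + ε
    at ε 0≤ε r r₀≤r K≤n h = ∥∥-weaken (∥∥-resp split (∥∥-⊕ (∥∥-⊗ ∥x∥ ∥R-1∥) h)) (begin
        (B + ½ * ε) * (2ℚ * (u (K ℕ.+ 0) - u (K ℕ.+ n))) + ½ * ε
          ≤⟨ +-monoˡ-≤ (½ * ε) (*-monoˡ₀ (B + ½ * ε) (nonNeg+ (∥∥-nonNeg hB) 0≤½ε) (*-monoˡ₀ 2ℚ 0≤2 (≤-trans (p-q≤p (u (K ℕ.+ 0)) (0≤u (K ℕ.+ n))) (≤-reflexive (cong u (ℕₚ.+-identityʳ K)))))) ⟩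
        (B + ½ * ε) * (2ℚ * u K) + ½ * ε
          ≡⟨ solve 3 (λ B e u → (B :+ e) :* u :+ e := B :* u :+ (e :* u :+ e)) refl B (½ * ε) (2ℚ * u K) ⟩
        B * (2ℚ * u K) + (½ * ε * (2ℚ * u K) + ½ * ε)
          ≤⟨ +-monoʳ-≤ (B * (2ℚ * u K)) (+-monoˡ-≤ (½ * ε) (*-monoˡ₀ (½ * ε) 0≤½ε (*-monoˡ₀ 2ℚ 0≤2 u≤½))) ⟩
        B * (2ℚ * u K) + (½ * ε * (2ℚ * ½) + ½ * ε)
          ≡⟨ cong (B * (2ℚ * u K) +_) (solve 1 (λ e → con ½ :* e :* (con 2ℚ :* con ½) :+ con ½ :* e := e) refl ε) ⟩
        B * (2ℚ * u K) + ε ∎)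
      where
      open ≤-Reasoning
      0≤½ε : 0ℚ ≤ ½ * ε
      0≤½ε = nonNeg* (<⇒≤ 0<½) 0≤ε
      n : ℕ
      n = 2^-1 r ∸ K
      R′ : ℂ
      R′ = prod n (λ k → ⌜ 1ℚ ⌝ ⊖ y r (K ℕ.+ k))
      ∥R-1∥ : ∥ R′ ⊖ ⌜ 1ℚ ⌝ ∥≤ 2ℚ * (u (K ℕ.+ 0) - u (K ℕ.+ n))
      ∥R-1∥ = prod-near-1 (λ k → y r (K ℕ.+ k)) (λ k → u (K ℕ.+ k)) n (λ k → 0≤u (K ℕ.+ k)) (subst (λ j → u j ≤ ½) (sym (ℕₚ.+-identityʳ K)) u≤½)
        λ k k<n → subst (λ j → ∥ y r (K ℕ.+ k) ∥≤ u (K ℕ.+ k) - u j) (sym (ℕₚ.+-suc K k))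
          (∥y∥ r₀≤r (ℕₚ.≤-trans (ℕₚ.+-monoʳ-≤ K (ℕₚ.<⇒≤ k<n)) (ℕₚ.≤-reflexive (ℕₚ.m+[n∸m]≡n K≤n))))
      ∥x∥ : ∥ x K r ∥≤ B + ½ * ε
      ∥x∥ = ∥∥-resp (solveᶜ 2 (λ X x → X ⊞ (x ⊟ X) ≔ x) ≈-refl (X K) (x K r)) (∥∥-⊕ hB h)
      D-product : D w ≈ x K r ⊗ R′
      D-product = ≈-trans (finite-product D⁻¹ (λ q 0<q q≤½ → proj₁ (D⁻¹-spec q 0<q q≤½)) w r)
        (≈-trans (⊗-congˡ (≈-trans (≈-reflexive (cong (λ j → prod j (λ k → ⌜ 1ℚ ⌝ ⊖ y r k)) (sym (ℕₚ.m+[n∸m]≡n K≤n)))) (prod-+ K n (λ k → ⌜ 1ℚ ⌝ ⊖ y r k))))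
          (≈-sym (⊗-assoc (T r) _ R′)))
      split : x K r ⊗ (R′ ⊖ ⌜ 1ℚ ⌝) ⊕ (x K r ⊖ X K) ≈ D w ⊖ X K
      split = ≈-trans (solveᶜ 3 (λ x R X → x ⊠ (R ⊟ conᶜ 1ℚ) ⊞ (x ⊟ X) ≔ x ⊠ R ⊟ X) ≈-refl (x K r) R′ (X K)) (⊕-cong (≈-sym D-product) ≈-refl)

  K₀ : ℕ
  K₀ = proj₁ (archimedes (c * c * 2ℚ) ½ 0<½)
  u≤½ : ∀ {K} → K₀ ℕ.≤ K → u K ≤ ½
  u≤½ {K} le = begin
    c * c * (2ℚ * inv (suc K))   ≡⟨ sym (*-assoc (c * c) 2ℚ (inv (suc K))) ⟩
    c * c * 2ℚ * inv (suc K)     ≤⟨ *-monoˡ₀ (c * c * 2ℚ) (nonNeg* (square-nonNeg c) 0≤2) (inv-anti le) ⟩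
    c * c * 2ℚ * inv (suc K₀)    ≤⟨ proj₂ (archimedes (c * c * 2ℚ) ½ 0<½) ⟩
    ½                            ∎
    where open ≤-Reasoning

  B : ℚ
  B = fromℕ (proj₁ (∥∥-bounded (X K₀))) * 2ℚ

  -- A bound uniform in K, without which `near` would not force convergence: beyond K₀ the remaining
  -- factors have a product of norm at most 2.
  ∥X∥ : ∀ {K} → K₀ ℕ.≤ K → ∥ X K ∥≤ B
  ∥X∥ {K} le = ∥∥-resp split (∥∥-⊗ (proj₂ (∥∥-bounded (X K₀))) ∥R∥′)
    where
    n : ℕ
    n = K ∸ K₀
    R′ : ℂ
    R′ = prod n (λ k → ⌜ 1ℚ ⌝ ⊖ sq (factor (K₀ ℕ.+ k)))
    u₀≤½ : u (K₀ ℕ.+ 0) ≤ ½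
    u₀≤½ = u≤½ (ℕₚ.m≤m+n K₀ 0)
    ∥R∥′ : ∥ R′ ∥≤ 2ℚ
    ∥R∥′ = ∥∥-weaken (∥∥-near-1 (prod-near-1 (λ k → sq (factor (K₀ ℕ.+ k))) (λ k → u (K₀ ℕ.+ k)) n (λ k → 0≤u (K₀ ℕ.+ k)) u₀≤½
          (λ k _ → subst (λ j → ∥ sq (factor (K₀ ℕ.+ k)) ∥≤ u (K₀ ℕ.+ k) - u j) (sym (ℕₚ.+-suc K₀ k)) (∥factor∥ (K₀ ℕ.+ k)))))
      (+-monoˡ-≤ 1ℚ (*-monoˡ₀ {u (K₀ ℕ.+ 0) - u (K₀ ℕ.+ n)} {½} 2ℚ 0≤2 (≤-trans (p-q≤p (u (K₀ ℕ.+ 0)) (0≤u (K₀ ℕ.+ n))) u₀≤½)))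
    split : X K₀ ⊗ R′ ≈ X K
    split = ≈-trans (⊗-assoc (⌜ 2ℚ ⌝ ⊗ (iπ ⊗ w)) (P K₀) R′) (⊗-congˡ (≈-trans (≈-sym (prod-+ K₀ n (λ k → ⌜ 1ℚ ⌝ ⊖ sq (factor k))))
      (≈-reflexive (cong P (ℕₚ.m+[n∸m]≡n le)))))

  X-⇒ : X ⇒ D w
  X-⇒ = ⇒-inv (B * (2ℚ * (c * c * 2ℚ))) (nonNeg* (nonNeg* (0≤fromℕ _) 0≤2) (nonNeg* 0≤2 (nonNeg* (square-nonNeg c) 0≤2))) K₀ λ K le →
    ∥∥-≡ (solve 3 (λ B c i → B :* (con 2ℚ :* (c :* (con 2ℚ :* i))) := B :* (con 2ℚ :* (c :* con 2ℚ)) :* i) refl B (c * c) (inv (suc K)))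
      (∥∥-⊖-sym (near K (u≤½ le) (∥X∥ le)))

-- Euler's totient function modulo 8

∑ : ℕ → (ℕ → ℕ) → ℕ
∑ zero    f = 0
∑ (suc n) f = ∑ n f ℕ.+ f n

∑-cong : ∀ n {f g} → (∀ k → k ℕ.< n → f k ≡ g k) → ∑ n f ≡ ∑ n g
∑-cong zero    h = refl
∑-cong (suc n) h = cong₂ ℕ._+_ (∑-cong n λ k k<n → h k (ℕₚ.m<n⇒m<1+n k<n)) (h n ℕₚ.≤-refl)

∑-split : ∀ m n f → ∑ (m ℕ.+ n) f ≡ ∑ m f ℕ.+ ∑ n (λ k → f (m ℕ.+ k))
∑-split m zero    f rewrite ℕₚ.+-identityʳ m = sym (ℕₚ.+-identityʳ _)
∑-split m (suc n) f rewrite ℕₚ.+-suc m n = trans (cong (ℕ._+ f (m ℕ.+ n)) (∑-split m n f)) (ℕₚ.+-assoc (∑ m f) _ _)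

∑-distrib : ∀ n f g → ∑ n (λ k → f k ℕ.+ g k) ≡ ∑ n f ℕ.+ ∑ n g
∑-distrib zero    f g = refl
∑-distrib (suc n) f g = trans (cong (ℕ._+ (f n ℕ.+ g n)) (∑-distrib n f g))
  (solveⁿ 4 (λ a b c d → (a ⊕ⁿ b) ⊕ⁿ (c ⊕ⁿ d) ≔ⁿ (a ⊕ⁿ c) ⊕ⁿ (b ⊕ⁿ d)) refl (∑ n f) (∑ n g) (f n) (g n))

∑-zero : ∀ n {f} → (∀ k → k ℕ.< n → f k ≡ 0) → ∑ n f ≡ 0
∑-zero zero    h = refl
∑-zero (suc n) h = cong₂ ℕ._+_ (∑-zero n λ k k<n → h k (ℕₚ.m<n⇒m<1+n k<n)) (h n ℕₚ.≤-refl)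

χ : ∀ {P : Set} → Dec P → ℕ
χ (yes _) = 1
χ (no  _) = 0

χ-cong : ∀ {P Q : Set} (p : Dec P) (q : Dec Q) → (P → Q) → (Q → P) → χ p ≡ χ q
χ-cong (yes p) (yes q) f g = refl
χ-cong (yes p) (no ¬q) f g = contradiction (f p) ¬q
χ-cong (no ¬p) (yes q) f g = contradiction (g q) ¬p
χ-cong (no ¬p) (no ¬q) f g = refl

coprime? : ∀ j n → Dec (gcd j n ≡ 1)
coprime? j n = gcd j n ℕₚ.≟ 1

coprimesUpTo-suc : ∀ N m → coprimesUpTo (suc N) m ≡ coprimesUpTo N m ++ filter (λ j → coprime? j m) (suc N ∷ [])
coprimesUpTo-suc N m = trans (cong (λ l → filter (λ j → coprime? j m) (map suc l)) (sym (Listₚ.upTo-∷ʳ N)))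
  (trans (cong (filter (λ j → coprime? j m)) (Listₚ.map-++ suc (upTo N) (N ∷ []))) (Listₚ.filter-++ (λ j → coprime? j m) (map suc (upTo N)) (suc N ∷ [])))

length-filter₁ : ∀ j m → length (filter (λ j → coprime? j m) (j ∷ [])) ≡ χ (coprime? j m)
length-filter₁ j m = go (coprime? j m)
  where
  go : (d : Dec (gcd j m ≡ 1)) → length (filter (λ j → coprime? j m) (j ∷ [])) ≡ χ d
  go (yes p) = cong length (Listₚ.filter-accept (λ j → coprime? j m) {x = j} {xs = []} p)
  go (no ¬p) = cong length (Listₚ.filter-reject (λ j → coprime? j m) {x = j} {xs = []} ¬p)

length-coprimesUpTo : ∀ N m → length (coprimesUpTo N m) ≡ ∑ N (λ k → χ (coprime? (suc k) m))
length-coprimesUpTo zero    m = refl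
length-coprimesUpTo (suc N) m = trans (cong length (coprimesUpTo-suc N m))
  (trans (Listₚ.length-++ (coprimesUpTo N m)) (cong₂ ℕ._+_ (length-coprimesUpTo N m) (length-filter₁ (suc N) m)))

φ-∑ : ∀ m → φ m ≡ ∑ m (λ k → χ (coprime? (suc k) m))
φ-∑ m = length-coprimesUpTo m m

coprime-shift : ∀ {j n} → Coprime j n → Coprime (n ℕ.+ j) n
coprime-shift c (d∣n+j , d∣n) = c (∣ₚ.∣m+n∣m⇒∣n d∣n+j d∣n , d∣n)

coprime-unshift : ∀ {j n} → Coprime (n ℕ.+ j) n → Coprime j n
coprime-unshift c (d∣j , d∣n) = c (∣ₚ.∣m∣n⇒∣m+n d∣n d∣j , d∣n)

χ-coprime : ∀ {i m j n} → (Coprime i m → Coprime j n) → (Coprime j n → Coprime i m) → χ (coprime? i m) ≡ χ (coprime? j n)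
χ-coprime {i} {m} {j} {n} f g = χ-cong (coprime? i m) (coprime? j n)
  (λ h → coprime⇒gcd≡1 (f (gcd≡1⇒coprime h))) (λ h → coprime⇒gcd≡1 (g (gcd≡1⇒coprime h)))

∑-periods : ∀ k n → ∑ (k ℕ.* n) (λ i → χ (coprime? (suc i) n)) ≡ k ℕ.* φ n
∑-periods zero    n = refl
∑-periods (suc k) n = trans (∑-split n (k ℕ.* n) _) (cong₂ ℕ._+_ (sym (φ-∑ n))
  (trans (∑-cong (k ℕ.* n) λ i _ → trans (cong (λ j → χ (coprime? j n)) (sym (ℕₚ.+-suc n i))) (χ-coprime {n ℕ.+ suc i} {n} {suc i} {n} coprime-unshift coprime-shift)) (∑-periods k n)))

-- Each block of p consecutive numbers, the first being 1, ..., p, contains one multiple of p, at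
-- its end.
∑-multiples : ∀ p n (g : ℕ → ℕ) .{{_ : NonZero p}} →
  ∑ (n ℕ.* p) (λ i → χ (p ∣ₚ.∣? suc i) ℕ.* g (suc i)) ≡ ∑ n (λ i → g (suc i ℕ.* p))
∑-multiples p zero    g = refl
∑-multiples p@(suc p′) (suc n) g = begin
  ∑ (p ℕ.+ n ℕ.* p) f                                ≡⟨ ∑-split p (n ℕ.* p) f ⟩
  ∑ p f ℕ.+ ∑ (n ℕ.* p) (λ i → f (p ℕ.+ i))          ≡⟨ cong₂ ℕ._+_ first rest ⟩
  g (1 ℕ.* p) ℕ.+ ∑ n (λ i → g (suc (suc i) ℕ.* p))  ≡⟨ sym (∑-split 1 n (λ i → g (suc i ℕ.* p))) ⟩
  ∑ (suc n) (λ i → g (suc i ℕ.* p))                  ∎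
  where
  open ≡-Reasoning
  f : ℕ → ℕ
  f i = χ (p ∣ₚ.∣? suc i) ℕ.* g (suc i)
  χ-no : ∀ {j} → ¬ p ∣ j → χ (p ∣ₚ.∣? j) ≡ 0
  χ-no {j} ¬d = χ-cong (p ∣ₚ.∣? j) (no id) ¬d (λ ())
  first : ∑ p f ≡ g (1 ℕ.* p)
  first = begin
    ∑ p′ f ℕ.+ χ (p ∣ₚ.∣? p) ℕ.* g p
      ≡⟨ cong₂ (λ a b → a ℕ.+ b ℕ.* g p) (∑-zero p′ λ k k<p′ → cong (ℕ._* g (suc k)) (χ-no (∣ₚ.>⇒∤ (ℕ.s≤s k<p′)))) (χ-cong (p ∣ₚ.∣? p) (yes (∣ₚ.∣-refl {p})) id id) ⟩
    1 ℕ.* g p    ≡⟨ ℕₚ.*-identityˡ (g p) ⟩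
    g p          ≡⟨ cong g (sym (ℕₚ.*-identityˡ p)) ⟩
    g (1 ℕ.* p)  ∎
  rest : ∑ (n ℕ.* p) (λ i → f (p ℕ.+ i)) ≡ ∑ n (λ i → g (suc (suc i) ℕ.* p))
  rest = trans (∑-cong (n ℕ.* p) λ i _ → cong₂ ℕ._*_
      (χ-cong (p ∣ₚ.∣? suc (p ℕ.+ i)) (p ∣ₚ.∣? suc i)
        (λ d → ∣ₚ.∣m+n∣m⇒∣n (subst (p ∣_) (sym (ℕₚ.+-suc p i)) d) ∣ₚ.∣-refl)
        (λ d → subst (p ∣_) (ℕₚ.+-suc p i) (∣ₚ.∣m∣n⇒∣m+n ∣ₚ.∣-refl d)))
      (cong g (sym (ℕₚ.+-suc p i))))
    (∑-multiples p n (λ j → g (p ℕ.+ j)))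

prime-coprime : ∀ {p j} → Prime p → ¬ p ∣ j → Coprime j p
prime-coprime pp p∤j (d∣j , d∣p) = [ id , (λ { refl → contradiction d∣j p∤j }) ]′ (prime⇒irreducible pp d∣p)

coprime-* : ∀ {j p n} → Coprime j p → Coprime j n → Coprime j (p ℕ.* n)
coprime-* cp cn (d∣j , d∣pn) = cn (d∣j , coprime-divisor (λ { (e∣d , e∣p) → cp (∣ₚ.∣-trans e∣d d∣j , e∣p) }) d∣pn)

coprime-*ˡ : ∀ {i p n} → Coprime i n → Coprime p n → Coprime (i ℕ.* p) n
coprime-*ˡ {i} {p} ci cp = Coprimality.sym (subst (Coprime _) (ℕₚ.*-comm p i) (coprime-* (Coprimality.sym cp) (Coprimality.sym ci)))

prime≢1 : ∀ {p} → Prime p → ¬ p ≡ 1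
prime≢1 pp refl = ¬prime[1] pp

φ-*-∣ : ∀ {p n} → Prime p → p ∣ n → φ (p ℕ.* n) ≡ p ℕ.* φ n
φ-*-∣ {p} {n} pp p∣n = trans (φ-∑ (p ℕ.* n)) (trans (∑-cong (p ℕ.* n) λ i _ → χ-coprime {suc i} {p ℕ.* n} {suc i} {n} down up) (∑-periods p n))
  where
  down : ∀ {j} → Coprime j (p ℕ.* n) → Coprime j n
  down c (d∣j , d∣n) = c (d∣j , ∣ₚ.∣n⇒∣m*n p d∣n)
  up : ∀ {j} → Coprime j n → Coprime j (p ℕ.* n)
  up c = coprime-* (λ { (d∣j , d∣p) → c (d∣j , ∣ₚ.∣-trans d∣p p∣n) }) c

-- Among the numbers up to pn that are prime to n, those not divisible by p are the ones prime to
-- pn, and the others are the ip with i ≤ n prime to n. The additive form avoids subtraction.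
φ-*-∤ : ∀ {p n} → Prime p → ¬ p ∣ n → φ (p ℕ.* n) ℕ.+ φ n ≡ p ℕ.* φ n
φ-*-∤ {p} {n} pp p∤n = begin
  φ (p ℕ.* n) ℕ.+ φ n
    ≡⟨ cong₂ ℕ._+_ (φ-∑ (p ℕ.* n)) (trans (φ-∑ n) (∑-cong n λ i _ → χ-coprime {suc i} {n} {suc i ℕ.* p} {n} (λ c → coprime-*ˡ c (Coprimality.sym (prime-coprime pp p∤n))) (drop (suc i)))) ⟩
  ∑ (p ℕ.* n) f ℕ.+ ∑ n (λ i → χ (coprime? (suc i ℕ.* p) n))
    ≡⟨ cong (∑ (p ℕ.* n) f ℕ.+_) (sym (trans (cong (λ N → ∑ N g) (ℕₚ.*-comm p n)) (∑-multiples p n (λ j → χ (coprime? j n)) {{prime⇒nonZero pp}}))) ⟩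
  ∑ (p ℕ.* n) f ℕ.+ ∑ (p ℕ.* n) g
    ≡⟨ sym (∑-distrib (p ℕ.* n) f g) ⟩
  ∑ (p ℕ.* n) (λ i → f i ℕ.+ g i)
    ≡⟨ ∑-cong (p ℕ.* n) (λ i _ → cases (suc i) (p ∣ₚ.∣? suc i)) ⟩
  ∑ (p ℕ.* n) (λ i → χ (coprime? (suc i) n))
    ≡⟨ ∑-periods p n ⟩
  p ℕ.* φ n ∎
  where
  open ≡-Reasoning
  f g : ℕ → ℕ
  f i = χ (coprime? (suc i) (p ℕ.* n))
  g i = χ (p ∣ₚ.∣? suc i) ℕ.* χ (coprime? (suc i) n)
  drop : ∀ i → Coprime (i ℕ.* p) n → Coprime i n
  drop i c (d∣i , d∣n) = c (∣ₚ.∣m⇒∣m*n p d∣i , d∣n)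
  cases : ∀ j (d : Dec (p ∣ j)) → χ (coprime? j (p ℕ.* n)) ℕ.+ χ d ℕ.* χ (coprime? j n) ≡ χ (coprime? j n)
  cases j (yes p∣j) = trans (cong (ℕ._+ (χ (coprime? j n) ℕ.+ 0)) (χ-cong (coprime? j (p ℕ.* n)) (no id)
      (λ h → contradiction (gcd≡1⇒coprime h (p∣j , ∣ₚ.m∣m*n n)) (prime≢1 pp)) (λ ()))) (ℕₚ.+-identityʳ _)
  cases j (no p∤j) = trans (ℕₚ.+-identityʳ _) (χ-coprime {j} {p ℕ.* n} {j} {n}
      (λ c → λ { (d∣j , d∣n) → c (d∣j , ∣ₚ.∣n⇒∣m*n p d∣n) }) (coprime-* (prime-coprime pp p∤j)))

φ∣φ-* : ∀ {p} n → Prime p → φ n ∣ φ (p ℕ.* n)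
φ∣φ-* {p} n pp = go (p ∣ₚ.∣? n)
  where
  go : Dec (p ∣ n) → φ n ∣ φ (p ℕ.* n)
  go (yes p∣n) = ∣ₚ.divides p (φ-*-∣ pp p∣n)
  go (no  p∤n) = ∣ₚ.∣m+n∣m⇒∣n {n = φ (p ℕ.* n)} (subst (φ n ∣_) (trans (sym (φ-*-∤ pp p∤n)) (ℕₚ.+-comm (φ (p ℕ.* n)) (φ n))) (∣ₚ.n∣m*n p)) ∣ₚ.∣-refl

-- The prime factors of the cofactor are attached to d one at a time.
φ-mono-∣ : ∀ {d m} .{{_ : NonZero m}} → d ∣ m → φ d ∣ φ m
φ-mono-∣ {d} (∣ₚ.divides zero refl) = contradiction refl (ℕ.≢-nonZero⁻¹ 0)
φ-mono-∣ {d} (∣ₚ.divides k@(suc _) refl) = subst (λ k → φ d ∣ φ (k ℕ.* d)) (sym (PrimeFactorisation.isFactorisation F)) (go (factors F) (PrimeFactorisation.factorsPrime F))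
  where
  F = factorise k
  go : ∀ ps → All Prime ps → φ d ∣ φ (product ps ℕ.* d)
  go []       []         = subst (λ k → φ d ∣ φ k) (sym (ℕₚ.+-identityʳ d)) ∣ₚ.∣-refl
  go (p ∷ ps) (pp ∷ pps) = ∣ₚ.∣-trans (go ps pps) (subst (λ k → φ (product ps ℕ.* d) ∣ φ k) (sym (ℕₚ.*-assoc p (product ps) d)) (φ∣φ-* (product ps ℕ.* d) pp))

φ-prime-* : ∀ {s n} → Prime (suc s) → ¬ suc s ∣ n → φ (suc s ℕ.* n) ≡ s ℕ.* φ n
φ-prime-* {s} {n} pp p∤n = ℕₚ.+-cancelʳ-≡ (φ n) _ _ (trans (φ-*-∤ pp p∤n) (ℕₚ.+-comm (φ n) (s ℕ.* φ n)))

-- The parity of φ(m)/4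

odd-form : ∀ n → ¬ 2 ∣ n → ∃ λ t → n ≡ suc (2 ℕ.* t)
odd-form zero          2∤n = contradiction (∣ₚ._∣0 2) 2∤n
odd-form (suc zero)    2∤n = 0 , refl
odd-form (suc (suc n)) 2∤n = let t , e = odd-form n (λ 2∣n → 2∤n (∣ₚ.∣m∣n⇒∣m+n ∣ₚ.∣-refl 2∣n)) in
  suc t , cong suc (cong suc (trans e (sym (ℕₚ.+-suc t (t ℕ.+ 0)))))

odd-prime∤2 : ∀ {p} → Prime p → ¬ 2 ∣ p → ¬ p ∣ 2
odd-prime∤2 pp 2∤p p∣2 = [ prime≢1 pp , (λ { refl → 2∤p ∣ₚ.∣-refl }) ]′ (prime⇒irreducible prime[2] p∣2)

odd-prime∤2* : ∀ {p n} → Prime p → ¬ 2 ∣ p → ¬ p ∣ n → ¬ p ∣ 2 ℕ.* n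
odd-prime∤2* {p} {n} pp 2∤p p∤n d = [ odd-prime∤2 pp 2∤p , p∤n ]′ (euclidsLemma 2 n pp d)

odd-prime∤4 : ∀ {p} → Prime p → ¬ 2 ∣ p → ¬ p ∣ 4
odd-prime∤4 pp 2∤p = odd-prime∤2* pp 2∤p (odd-prime∤2 pp 2∤p)

-- φ (8p) = 4 (p - 1) with p - 1 even. Likewise `8∣φ-4p` rests on φ (4p) = 2 (p - 1), and `8∣φ-4pq`
-- on φ (4pq) = 2 (p - 1) (q - 1).
8∣φ-8p : ∀ {p} → Prime p → ¬ 2 ∣ p → 8 ∣ φ (p ℕ.* 8)
8∣φ-8p {p} pp 2∤p = go (odd-form p 2∤p) pp 2∤p
  where
  go : ∀ {p} → (∃ λ t → p ≡ suc (2 ℕ.* t)) → Prime p → ¬ 2 ∣ p → 8 ∣ φ (p ℕ.* 8)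
  go (t , refl) pp 2∤p = ∣ₚ.divides t (trans (φ-prime-* {2 ℕ.* t} {8} pp (odd-prime∤2* {n = 4} pp 2∤p (odd-prime∤4 pp 2∤p)))
    (solveⁿ 1 (λ t → conⁿ 2 ⊗ⁿ t ⊗ⁿ conⁿ 4 ≔ⁿ t ⊗ⁿ conⁿ 8) refl t))

8∣φ-4p : ∀ t → Prime (suc (t ℕ.* 4)) → ¬ 2 ∣ suc (t ℕ.* 4) → 8 ∣ φ (suc (t ℕ.* 4) ℕ.* 4)
8∣φ-4p t pp 2∤p = ∣ₚ.divides t (trans (φ-prime-* {t ℕ.* 4} {4} pp (odd-prime∤4 pp 2∤p))
  (solveⁿ 1 (λ t → t ⊗ⁿ conⁿ 4 ⊗ⁿ conⁿ 2 ≔ⁿ t ⊗ⁿ conⁿ 8) refl t))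

8∣φ-4pq : ∀ {p q} → Prime p → ¬ 2 ∣ p → Prime q → ¬ 2 ∣ q → ¬ q ≡ p → 8 ∣ φ (q ℕ.* (p ℕ.* 4))
8∣φ-4pq {p} {q} pp 2∤p qp 2∤q q≢p = go (odd-form p 2∤p) (odd-form q 2∤q) pp 2∤p qp 2∤q q≢p
  where
  go : ∀ {p q} → (∃ λ t → p ≡ suc (2 ℕ.* t)) → (∃ λ s → q ≡ suc (2 ℕ.* s)) → Prime p → ¬ 2 ∣ p → Prime q → ¬ 2 ∣ q → ¬ q ≡ p → 8 ∣ φ (q ℕ.* (p ℕ.* 4))
  go {p} {q} (t , refl) (s , refl) pp 2∤p qp 2∤q q≢p = ∣ₚ.divides (s ℕ.* t) (trans (φ-prime-* {2 ℕ.* s} {p ℕ.* 4} qp q∤4p)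
    (trans (cong (2 ℕ.* s ℕ.*_) (φ-prime-* {2 ℕ.* t} {4} pp (odd-prime∤4 pp 2∤p)))
      (solveⁿ 2 (λ s t → conⁿ 2 ⊗ⁿ s ⊗ⁿ (conⁿ 2 ⊗ⁿ t ⊗ⁿ conⁿ 2) ≔ⁿ s ⊗ⁿ t ⊗ⁿ conⁿ 8) refl s t)))
    where
    q∤4p : ¬ q ∣ p ℕ.* 4
    q∤4p d = [ (λ q∣p → [ prime≢1 qp , q≢p ]′ (prime⇒irreducible pp q∣p)) , odd-prime∤4 qp 2∤q ]′ (euclidsLemma p 4 qp d)

other-prime : ∀ p ps → All Prime ps → product ps ≡ p ℕ.^ length ps ⊎ ∃ λ q → Prime q × ¬ q ≡ p × q ∣ product ps
other-prime p []       []         = inj₁ refl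
other-prime p (q ∷ qs) (qp ∷ qps) = go (q ℕₚ.≟ p) (other-prime p qs qps)
  where
  go : Dec (q ≡ p) → product qs ≡ p ℕ.^ length qs ⊎ (∃ λ r → Prime r × ¬ r ≡ p × r ∣ product qs) →
       product (q ∷ qs) ≡ p ℕ.^ suc (length qs) ⊎ ∃ λ r → Prime r × ¬ r ≡ p × r ∣ product (q ∷ qs)
  go (no q≢p)   _                        = inj₂ (q , qp , q≢p , ∣ₚ.m∣m*n (product qs))
  go (yes refl) (inj₁ e)                 = inj₁ (cong (q ℕ.*_) e)
  go (yes _)    (inj₂ (r , rp , r≢p , d)) = inj₂ (r , rp , r≢p , ∣ₚ.∣n⇒∣m*n q d)

residues : ∀ r → r ℕ.< 4 → ¬ 2 ∣ r → r ≡ 1 ⊎ r ≡ 3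
residues 0 _ 2∤r = contradiction (∣ₚ._∣0 2) 2∤r
residues 1 _ _   = inj₁ refl
residues 2 _ 2∤r = contradiction ∣ₚ.∣-refl 2∤r
residues 3 _ _   = inj₂ refl
residues (suc (suc (suc (suc _)))) (ℕ.s≤s (ℕ.s≤s (ℕ.s≤s (ℕ.s≤s ())))) _

odd-prime-mod-4 : ∀ p → ¬ 2 ∣ p → p DivMod.% 4 ≡ 1 ⊎ p DivMod.% 4 ≡ 3
odd-prime-mod-4 p 2∤p = residues (p DivMod.% 4) (DivMod.m%n<n p 4) λ d → 2∤p
  (subst (2 ∣_) (sym (DivMod.m≡m%n+[m/n]*n p 4)) (∣ₚ.∣m∣n⇒∣m+n d (∣ₚ.∣n⇒∣m*n (p / 4) (∣ₚ.divides 2 refl))))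

-- With d ∣ m ⇒ φ d ∣ φ m it is enough to find one of 16, 8p, 4p (p ≡ 1 mod 4) and 4pq among the divisors of 4n.
8∣φ : ∀ n .{{_ : NonZero n}} → ¬ n ≡ 1 → ¬ Exceptional (4 ℕ.* n) → 8 ∣ φ (4 ℕ.* n)
8∣φ n n≢1 ¬exc = parity (2 ∣ₚ.∣? n)
  where
  instance
    4n≢0 : NonZero (4 ℕ.* n)
    4n≢0 = ℕₚ.m*n≢0 4 n
  even : ∀ k → n ≡ k ℕ.* 2 → ∀ ps → All Prime ps → k ≡ product ps → 8 ∣ φ (4 ℕ.* n)
  -- Here k = 1, which is the exceptional m = 8.
  even k n≡ []       []         refl = contradiction (inj₁ (cong (4 ℕ.*_) n≡)) ¬exc
  even k n≡ (p ∷ ps) (pp ∷ pps) refl = go (2 ∣ₚ.∣? p)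
    where
    go : Dec (2 ∣ p) → 8 ∣ φ (4 ℕ.* n)
    -- 16 divides 4n, and `φ 16` computes to 8.
    go (yes (∣ₚ.divides j refl)) = φ-mono-∣ {16} (∣ₚ.divides (j ℕ.* product ps) (trans (cong (4 ℕ.*_) n≡)
      (solveⁿ 2 (λ j s → conⁿ 4 ⊗ⁿ (j ⊗ⁿ conⁿ 2 ⊗ⁿ s ⊗ⁿ conⁿ 2) ≔ⁿ j ⊗ⁿ s ⊗ⁿ conⁿ 16) refl j (product ps))))
    go (no 2∤p) = ∣ₚ.∣-trans (8∣φ-8p pp 2∤p) (φ-mono-∣ (∣ₚ.divides (product ps) (trans (cong (4 ℕ.*_) n≡)
      (solveⁿ 2 (λ p s → conⁿ 4 ⊗ⁿ (p ⊗ⁿ s ⊗ⁿ conⁿ 2) ≔ⁿ s ⊗ⁿ (p ⊗ⁿ conⁿ 8)) refl p (product ps)))))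
  odd : ¬ 2 ∣ n → ∀ ps → All Prime ps → n ≡ product ps → 8 ∣ φ (4 ℕ.* n)
  odd 2∤n []       []         n≡ = contradiction n≡ n≢1
  odd 2∤n (p ∷ ps) (pp ∷ pps) n≡ = go (odd-prime-mod-4 p 2∤p)
    where
    2∤p : ¬ 2 ∣ p
    2∤p d = 2∤n (subst (2 ∣_) (sym n≡) (∣ₚ.∣m⇒∣m*n (product ps) d))
    go : p DivMod.% 4 ≡ 1 ⊎ p DivMod.% 4 ≡ 3 → 8 ∣ φ (4 ℕ.* n)
    go (inj₁ p%4) = ∣ₚ.∣-trans (subst (λ p → Prime p → ¬ 2 ∣ p → 8 ∣ φ (p ℕ.* 4)) (sym p≡) (8∣φ-4p (p / 4)) pp 2∤p)
      (φ-mono-∣ (∣ₚ.divides (product ps) (trans (cong (4 ℕ.*_) n≡) (solveⁿ 2 (λ p s → conⁿ 4 ⊗ⁿ (p ⊗ⁿ s) ≔ⁿ s ⊗ⁿ (p ⊗ⁿ conⁿ 4)) refl p (product ps)))))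
      where
      p≡ : p ≡ suc (p / 4 ℕ.* 4)
      p≡ = trans (DivMod.m≡m%n+[m/n]*n p 4) (cong (ℕ._+ p / 4 ℕ.* 4) p%4)
    go (inj₂ p%4) = search (other-prime p ps pps)
      where
      search : product ps ≡ p ℕ.^ length ps ⊎ (∃ λ q → Prime q × ¬ q ≡ p × q ∣ product ps) → 8 ∣ φ (4 ℕ.* n)
      search (inj₁ e) = contradiction (inj₂ (p , suc (length ps) , pp , p%4 , ℕ.s≤s ℕ.z≤n , cong (4 ℕ.*_) (trans n≡ (cong (p ℕ.*_) e)))) ¬exc
      search (inj₂ (q , qp , q≢p , ∣ₚ.divides j e)) = ∣ₚ.∣-trans (8∣φ-4pq pp 2∤p qp 2∤q q≢p)
        (φ-mono-∣ (∣ₚ.divides j (trans (cong (4 ℕ.*_) (trans n≡ (cong (p ℕ.*_) e))) (solveⁿ 3 (λ p q j → conⁿ 4 ⊗ⁿ (p ⊗ⁿ (j ⊗ⁿ q)) ≔ⁿ j ⊗ⁿ (q ⊗ⁿ (p ⊗ⁿ conⁿ 4))) refl p q j))))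
        where
        2∤q : ¬ 2 ∣ q
        2∤q d = 2∤n (subst (2 ∣_) (sym n≡) (∣ₚ.∣n⇒∣m*n p (subst (2 ∣_) (sym e) (∣ₚ.∣n⇒∣m*n j d))))
  parity : Dec (2 ∣ n) → 8 ∣ φ (4 ℕ.* n)
  parity (no 2∤n) = odd 2∤n (factors F) (PrimeFactorisation.factorsPrime F) (PrimeFactorisation.isFactorisation F)
    where F = factorise n
  parity (yes (∣ₚ.divides zero e)) = contradiction e (ℕ.≢-nonZero⁻¹ n)
  parity (yes (∣ₚ.divides k@(suc _) e)) = even k e (factors F) (PrimeFactorisation.factorsPrime F) (PrimeFactorisation.isFactorisation F)
    where F = factorise k

-- φ 8 = 4, and φ (4p) = 2 (p - 1) is 4 times an odd number when p ≡ 3 modulo 4; each further factor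
-- p multiplies φ by p, which is odd.
φ-exceptional : ∀ {m} → Exceptional m → ∃ λ s → φ m ≡ 4 ℕ.* suc (2 ℕ.* s)
φ-exceptional (inj₁ refl) = 0 , refl
φ-exceptional (inj₂ (p , suc α , pp , p%4 , _ , refl)) = subst (λ p → Prime p → ∀ α → ∃ λ s → φ (4 ℕ.* p ℕ.^ suc α) ≡ 4 ℕ.* suc (2 ℕ.* s)) (sym p≡) (powers (p / 4)) pp α
  where
  p≡ : p ≡ 3 ℕ.+ p / 4 ℕ.* 4
  p≡ = trans (DivMod.m≡m%n+[m/n]*n p 4) (cong (ℕ._+ p / 4 ℕ.* 4) p%4)
  powers : ∀ t → Prime (3 ℕ.+ t ℕ.* 4) → ∀ α → ∃ λ s → φ (4 ℕ.* (3 ℕ.+ t ℕ.* 4) ℕ.^ suc α) ≡ 4 ℕ.* suc (2 ℕ.* s)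
  powers t pp zero = t , (begin
    φ (4 ℕ.* (q ℕ.* 1))      ≡⟨ cong φ (solveⁿ 1 (λ q → conⁿ 4 ⊗ⁿ (q ⊗ⁿ conⁿ 1) ≔ⁿ q ⊗ⁿ conⁿ 4) refl q) ⟩
    φ (q ℕ.* 4)              ≡⟨ φ-prime-* {2 ℕ.+ t ℕ.* 4} {4} pp (odd-prime∤4 pp 2∤q) ⟩
    (2 ℕ.+ t ℕ.* 4) ℕ.* 2    ≡⟨ solveⁿ 1 (λ t → (conⁿ 2 ⊕ⁿ t ⊗ⁿ conⁿ 4) ⊗ⁿ conⁿ 2 ≔ⁿ conⁿ 4 ⊗ⁿ (conⁿ 1 ⊕ⁿ conⁿ 2 ⊗ⁿ t)) refl t ⟩
    4 ℕ.* suc (2 ℕ.* t)      ∎)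
    where
    open ≡-Reasoning
    q : ℕ
    q = 3 ℕ.+ t ℕ.* 4
    2∤q : ¬ 2 ∣ q
    2∤q d = contradiction (∣ₚ.∣1⇒≡1 (∣ₚ.∣m+n∣m⇒∣n (subst (2 ∣_) (solveⁿ 1 (λ t → conⁿ 3 ⊕ⁿ t ⊗ⁿ conⁿ 4 ≔ⁿ (conⁿ 1 ⊕ⁿ t ⊗ⁿ conⁿ 2) ⊗ⁿ conⁿ 2 ⊕ⁿ conⁿ 1) refl t) d) (∣ₚ.n∣m*n (1 ℕ.+ t ℕ.* 2)))) λ ()
  -- The witness is the half of (1 + 2a) (1 + 2s) - 1, where q = 3 + 4t = 1 + 2a with a = 1 + 2t.
  powers t pp (suc α) = let s , e = powers t pp α in (suc (2 ℕ.* t)) ℕ.+ s ℕ.+ 2 ℕ.* (suc (2 ℕ.* t) ℕ.* s) , (begin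
    φ (4 ℕ.* (q ℕ.* q ℕ.^ suc α))      ≡⟨ cong φ (solveⁿ 2 (λ q r → conⁿ 4 ⊗ⁿ (q ⊗ⁿ r) ≔ⁿ q ⊗ⁿ (conⁿ 4 ⊗ⁿ r)) refl q (q ℕ.^ suc α)) ⟩
    φ (q ℕ.* (4 ℕ.* q ℕ.^ suc α))      ≡⟨ φ-*-∣ pp (∣ₚ.∣n⇒∣m*n 4 (∣ₚ.m∣m*n (q ℕ.^ α))) ⟩
    q ℕ.* φ (4 ℕ.* q ℕ.^ suc α)        ≡⟨ cong (q ℕ.*_) e ⟩
    q ℕ.* (4 ℕ.* suc (2 ℕ.* s))
      ≡⟨ solveⁿ 2 (λ t s → (conⁿ 3 ⊕ⁿ t ⊗ⁿ conⁿ 4) ⊗ⁿ (conⁿ 4 ⊗ⁿ (conⁿ 1 ⊕ⁿ conⁿ 2 ⊗ⁿ s)) ≔ⁿ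
           conⁿ 4 ⊗ⁿ (conⁿ 1 ⊕ⁿ conⁿ 2 ⊗ⁿ ((conⁿ 1 ⊕ⁿ conⁿ 2 ⊗ⁿ t) ⊕ⁿ s ⊕ⁿ conⁿ 2 ⊗ⁿ ((conⁿ 1 ⊕ⁿ conⁿ 2 ⊗ⁿ t) ⊗ⁿ s)))) refl t s ⟩
    4 ℕ.* suc (2 ℕ.* (suc (2 ℕ.* t) ℕ.+ s ℕ.+ 2 ℕ.* (suc (2 ℕ.* t) ℕ.* s)))  ∎)
    where
    open ≡-Reasoning
    q : ℕ
    q = 3 ℕ.+ t ℕ.* 4

-- The product over the residues prime to m

norm-square : ∀ a b {c} → ∣ a ∣ + ∣ b ∣ ≤ c → a * a + b * b ≤ c * c
norm-square a b {c} h = begin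
  a * a + b * b                        ≡⟨ cong₂ _+_ (abs-square a) (abs-square b) ⟩
  s * s + t * t                        ≤⟨ p≤p+q (s * s + t * t) (nonNeg+ (nonNeg* 0≤s 0≤t) (nonNeg* 0≤s 0≤t)) ⟩
  s * s + t * t + (s * t + s * t)      ≡⟨ solve 2 (λ s t → s :* s :+ t :* t :+ (s :* t :+ s :* t) := (s :+ t) :* (s :+ t)) refl s t ⟩
  (s + t) * (s + t)                    ≤⟨ *-mono₀ {s + t} {c} {s + t} {c} (nonNeg+ 0≤s 0≤t) (≤-trans (nonNeg+ 0≤s 0≤t) h) h h ⟩
  c * c                                ∎
  where
  open ≤-Reasoning
  s t : ℚ
  s = ∣ a ∣
  t = ∣ b ∣
  0≤s = 0≤∣p∣ a
  0≤t = 0≤∣p∣ b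
  abs-square : ∀ a → a * a ≡ ∣ a ∣ * ∣ a ∣
  abs-square a = trans (sym (0≤p⇒∣p∣≡p (square-nonNeg a))) (∣p*q∣≡∣p∣*∣q∣ a a)

-- ½ ε is the bound, ¼ ε its slack, and ¼ ε² the gap that the strict `_<ʳ_` demands: (½ + ¼)² + ¼ =
-- 1 - ¼ · ¾.
margin : ∀ a b ε → ∣ a ∣ + ∣ b ∣ ≤ ½ * ε + ¼ * ε → a * a + b * b + ¼ * (ε * ε) ≤ ε * ε
margin a b ε h = begin
  a * a + b * b + ¼ * (ε * ε)                            ≤⟨ +-monoˡ-≤ (¼ * (ε * ε)) (norm-square a b h) ⟩
  (½ * ε + ¼ * ε) * (½ * ε + ¼ * ε) + ¼ * (ε * ε)
    ≤⟨ p≤p+q ((½ * ε + ¼ * ε) * (½ * ε + ¼ * ε) + ¼ * (ε * ε)) (nonNeg* (nonNegative⁻¹ (¼ * ¾)) (square-nonNeg ε)) ⟩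
  (½ * ε + ¼ * ε) * (½ * ε + ¼ * ε) + ¼ * (ε * ε) + ¼ * ¾ * (ε * ε)
    ≡⟨ solve 1 (λ e → (con ½ :* e :+ con ¼ :* e) :* (con ½ :* e :+ con ¼ :* e) :+ con ¼ :* (e :* e) :+ con ¼ :* con ¾ :* (e :* e) := e :* e) refl ε ⟩
  ε * ε                                                  ∎
  where open ≤-Reasoning

opaque
  unfolding _⊕_

  gap-< : ∀ z w {ε} → 0ℚ < ε → ∥ z ⊖ w ∥≤ ½ * ε → ∣ z -ᶜ w ∣² <ʳ ofℚ (ε * ε)
  gap-< z w {ε} 0<ε (mkBound h) = ¼ * (ε * ε) , pos* (positive⁻¹ ¼) (pos* 0<ε 0<ε) , proj₁ (h (¼ * ε) (pos* (positive⁻¹ ¼) 0<ε)) , λ k le →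
    margin (seq (re z) k - seq (re w) k) (seq (im z) k - seq (im w) k) ε (proj₂ (h (¼ * ε) (pos* (positive⁻¹ ¼) 0<ε)) k le)

⇒-⟶ : ∀ {x L} → x ⇒ L → x ⟶ L
⇒-⟶ {x} {L} (mk⇒ h) ε 0<ε = proj₁ (h (½ * ε) (pos* 0<½ 0<ε)) , λ n le → gap-< (x n) L 0<ε (proj₂ (h (½ * ε) (pos* 0<½ 0<ε)) n le)

opaque
  unfolding _⊕_ Exp Π

  *ᶜ-≈ : ∀ z w → z *ᶜ w ≈ z ⊗ w
  *ᶜ-≈ z w = exact (λ _ → refl) (λ _ → refl)

  -ᶜ-≈ : ∀ z w → z -ᶜ w ≈ z ⊖ w
  -ᶜ-≈ z w = exact (λ _ → refl) (λ _ → refl)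

  negᶜ-≈ : ∀ z → -ᶜ z ≈ ⊝ z
  negᶜ-≈ z = exact (λ _ → refl) (λ _ → refl)

  𝕚-≈ : 𝕚 ≈ ι
  𝕚-≈ = exact (λ _ → refl) (λ _ → refl)

  πᶜ-≈ : πᶜ ≈ Π
  πᶜ-≈ = exact (λ _ → refl) (λ _ → refl)

  •-≈ : ∀ q z → q • z ≈ q ⊙ z
  •-≈ q z = exact (λ _ → refl) (λ _ → refl)

  ^ᶜ-≈ : ∀ z n → z ^ᶜ n ≈ z ↑ n
  ^ᶜ-≈ z n = exact (λ _ → refl) (λ _ → refl)

  exp-≡ : ∀ z → exp z ≡ Exp z
  exp-≡ z = refl

  ÷ᶜ-≈ : ∀ z w w#0 → z ÷ᶜ w [ w#0 ] ≈ z ⊗ recipᶜ w w#0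
  ÷ᶜ-≈ z w w#0 = exact (λ _ → refl) (λ _ → refl)

opaque
  ∏ᵒ : List ℕ → (ℕ → ℂ) → ℂ
  ∏ᵒ = ∏

  partialProductᵒ : ((k : ℕ) → .{{NonZero k}} → ℂ) → ℕ → ℂ
  partialProductᵒ = partialProduct

opaque
  unfolding _⊕_ ∏ᵒ

  ∏-≡ : ∀ js f → ∏ js f ≡ ∏ᵒ js f
  ∏-≡ js f = refl

  partialProduct-≡ : ∀ (f : (k : ℕ) → .{{NonZero k}} → ℂ) n → partialProduct f n ≡ partialProductᵒ f n
  partialProduct-≡ f n = refl

  ∏-[] : ∀ f → ∏ᵒ [] f ≈ ⌜ 1ℚ ⌝
  ∏-[] f = exact (λ _ → refl) (λ _ → refl)

  ∏-∷ : ∀ j js f → ∏ᵒ (j ∷ js) f ≈ f j ⊗ ∏ᵒ js f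
  ∏-∷ j js f = exact (λ _ → refl) (λ _ → refl)

  partialProduct-0 : ∀ (f : (k : ℕ) → .{{NonZero k}} → ℂ) → partialProductᵒ f 0 ≈ ⌜ 1ℚ ⌝
  partialProduct-0 f = exact (λ _ → refl) (λ _ → refl)

  partialProduct-suc : ∀ (f : (k : ℕ) → .{{NonZero k}} → ℂ) n → partialProductᵒ f (suc n) ≈ partialProductᵒ f n ⊗ f (suc n)
  partialProduct-suc f n = exact (λ _ → refl) (λ _ → refl)

exp-≈ : ∀ z {w} → z ≈ w → exp z ≈ Exp w
exp-≈ z h = ≈-trans (≈-reflexive (exp-≡ z)) (Exp-cong h)

sin-raw : ∀ z → sin z ≡ (-½ • 𝕚) *ᶜ (exp (𝕚 *ᶜ z) -ᶜ exp (-ᶜ (𝕚 *ᶜ z)))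
sin-raw z = refl

sin-≈ : ∀ z {w} → z ≈ Π ⊗ w → sin z ≈ ⌜ -½ ⌝ ⊗ ι ⊗ D w
sin-≈ z {w} h = ≈-trans (≈-reflexive (sin-raw z)) (≈-trans (*ᶜ-≈ (-½ • 𝕚) (exp (𝕚 *ᶜ z) -ᶜ exp (-ᶜ (𝕚 *ᶜ z)))) (⊗-cong
  (≈-trans (•-≈ -½ 𝕚) (≈-trans (⊙-≈ -½ 𝕚) (⊗-congˡ 𝕚-≈)))
  (≈-trans (-ᶜ-≈ (exp (𝕚 *ᶜ z)) (exp (-ᶜ (𝕚 *ᶜ z))))
    (⊕-cong (exp-≈ (𝕚 *ᶜ z) iz) (⊝-cong (exp-≈ (-ᶜ (𝕚 *ᶜ z)) (≈-trans (negᶜ-≈ (𝕚 *ᶜ z)) (≈-trans (⊝-cong iz) (iπ⊗⊝ w)))))))))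
  where
  iz : 𝕚 *ᶜ z ≈ iπ ⊗ w
  iz = ≈-trans (*ᶜ-≈ 𝕚 z) (≈-trans (⊗-cong 𝕚-≈ h) (≈-sym (⊗-assoc ι Π w)))

root-raw : ∀ m .{{_ : NonZero m}} j → rootOfUnity m j ≡ exp ((fromℕ (2 ℕ.* j) * inv m) • (πᶜ *ᶜ 𝕚))
root-raw m j = refl

exp-• : ∀ q → exp (q • (πᶜ *ᶜ 𝕚)) ≈ e ⌜ q ⌝
exp-• q = exp-≈ (q • (πᶜ *ᶜ 𝕚))
  (≈-trans (•-≈ q (πᶜ *ᶜ 𝕚)) (≈-trans (⊙-≈ q (πᶜ *ᶜ 𝕚)) (≈-trans (⊗-congˡ (≈-trans (*ᶜ-≈ πᶜ 𝕚) (⊗-cong πᶜ-≈ 𝕚-≈)))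
    (solveᶜ 3 (λ q p i → q ⊠ (p ⊠ i) ≔ i ⊠ p ⊠ q) ≈-refl ⌜ q ⌝ Π ι))))

root-≈ : ∀ m .{{_ : NonZero m}} j → rootOfUnity m j ≈ e ⌜ fromℕ (2 ℕ.* j) * inv m ⌝
root-≈ m j = ≈-trans (≈-reflexive (root-raw m j)) (exp-• (fromℕ (2 ℕ.* j) * inv m))

∏-++ : ∀ is js f → ∏ᵒ (is ++ js) f ≈ ∏ᵒ is f ⊗ ∏ᵒ js f
∏-++ []       js f = ≈-sym (≈-trans (⊗-cong (∏-[] f) ≈-refl) (⊗-identityˡ _))
∏-++ (i ∷ is) js f = ≈-trans (∏-∷ i (is ++ js) f) (≈-trans (⊗-congˡ (∏-++ is js f))
  (≈-trans (≈-sym (⊗-assoc (f i) (∏ᵒ is f) (∏ᵒ js f))) (⊗-cong (≈-sym (∏-∷ i is f)) ≈-refl)))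

-- A factor 1 for the residues not prime to m turns the product over a filtered list into one over
-- an interval, which can be reversed, split and folded.
pick : ∀ {P : Set} → Dec P → ℂ → ℂ
pick (yes _) z = z
pick (no  _) z = ⌜ 1ℚ ⌝

∏-filter₁ : ∀ j m f → ∏ᵒ (filter (λ j → coprime? j m) (j ∷ [])) f ≈ pick (coprime? j m) (f j)
∏-filter₁ j m f = go (coprime? j m)
  where
  go : (d : Dec (gcd j m ≡ 1)) → ∏ᵒ (filter (λ j → coprime? j m) (j ∷ [])) f ≈ pick d (f j)
  go (yes p) = ≈-trans (≈-reflexive (cong (λ js → ∏ᵒ js f) (Listₚ.filter-accept (λ j → coprime? j m) {x = j} {xs = []} p)))
    (≈-trans (∏-∷ j [] f) (≈-trans (⊗-congˡ (∏-[] f)) (solveᶜ 1 (λ z → z ⊠ conᶜ 1ℚ ≔ z) ≈-refl (f j))))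
  go (no ¬p) = ≈-trans (≈-reflexive (cong (λ js → ∏ᵒ js f) (Listₚ.filter-reject (λ j → coprime? j m) {x = j} {xs = []} ¬p))) (∏-[] f)

∏-coprimesUpTo : ∀ N m f → ∏ᵒ (coprimesUpTo N m) f ≈ prod N (λ k → pick (coprime? (suc k) m) (f (suc k)))
∏-coprimesUpTo zero    m f = ∏-[] f
∏-coprimesUpTo (suc N) m f = ≈-trans (≈-reflexive (cong (λ js → ∏ᵒ js f) (coprimesUpTo-suc N m)))
  (≈-trans (∏-++ (coprimesUpTo N m) _ f) (⊗-cong (∏-coprimesUpTo N m f) (∏-filter₁ (suc N) m f)))

partialProduct-prod : ∀ (f : (k : ℕ) → .{{NonZero k}} → ℂ) n → partialProductᵒ f n ≈ prod n (λ k → f (suc k))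
partialProduct-prod f zero    = partialProduct-0 f
partialProduct-prod f (suc n) = ≈-trans (partialProduct-suc f n) (⊗-cong (partialProduct-prod f n) ≈-refl)

opaque
  −1ᵒ 1ᵒ : ℂ
  −1ᵒ = -ᶜ 1ᶜ
  1ᵒ = 1ᶜ

  −1ᵒ-≡ : -ᶜ 1ᶜ ≡ −1ᵒ
  −1ᵒ-≡ = refl

  1ᵒ-≡ : 1ᶜ ≡ 1ᵒ
  1ᵒ-≡ = refl

opaque
  unfolding _⊕_ −1ᵒ

  −1ᵒ-≈ : −1ᵒ ≈ ⊝ ⌜ 1ℚ ⌝
  −1ᵒ-≈ = exact (λ _ → refl) (λ _ → refl)

  1ᵒ-≈ : 1ᵒ ≈ ⌜ 1ℚ ⌝
  1ᵒ-≈ = exact (λ _ → refl) (λ _ → refl)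

δ-4 : δ 4 ≈ ι
δ-4 = 𝕚-≈

δ-values : ∀ m → ¬ m ≡ 4 → (Exceptional m × δ m ≡ −1ᵒ) ⊎ (¬ Exceptional m × δ m ≡ 1ᵒ)
δ-values m m≢4 with m ℕₚ.≟ 4
... | yes m≡4 = contradiction m≡4 m≢4
... | no _ with exceptional? m
...   | yes exc = inj₁ (exc , −1ᵒ-≡)
...   | no ¬exc = inj₂ (¬exc , 1ᵒ-≡)

δ-cases : ∀ m → ¬ m ≡ 4 → (Exceptional m × δ m ≈ ⊝ ⌜ 1ℚ ⌝) ⊎ (¬ Exceptional m × δ m ≈ ⌜ 1ℚ ⌝)
δ-cases m m≢4 = [ (λ (exc , h) → inj₁ (exc , ≈-trans (≈-reflexive h) −1ᵒ-≈)) , (λ (¬exc , h) → inj₂ (¬exc , ≈-trans (≈-reflexive h) 1ᵒ-≈)) ]′ (δ-values m m≢4)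

pick-cong : ∀ {P : Set} (d : Dec P) {z w} → z ≈ w → pick d z ≈ pick d w
pick-cong (yes _) h = h
pick-cong (no  _) h = ≈-refl

pick-⊗ : ∀ {P : Set} (d : Dec P) z w → pick d z ⊗ pick d w ≈ pick d (z ⊗ w)
pick-⊗ (yes _) z w = ≈-refl
pick-⊗ (no  _) z w = ⊗-identityˡ ⌜ 1ℚ ⌝

pick-1 : ∀ {P : Set} (d : Dec P) → pick d ⌜ 1ℚ ⌝ ≈ ⌜ 1ℚ ⌝
pick-1 (yes _) = ≈-refl
pick-1 (no  _) = ≈-refl

pick-⇔ : ∀ {P Q : Set} (d : Dec P) (d′ : Dec Q) z → (P → Q) → (Q → P) → pick d z ≈ pick d′ z
pick-⇔ (yes p) (yes q) z f g = ≈-refl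
pick-⇔ (yes p) (no ¬q) z f g = contradiction (f p) ¬q
pick-⇔ (no ¬p) (yes q) z f g = contradiction (g q) ¬p
pick-⇔ (no ¬p) (no ¬q) z f g = ≈-refl

pick-yes : ∀ {P : Set} (d : Dec P) z → P → pick d z ≈ z
pick-yes d z p = pick-⇔ d (yes p) z id id

pick-no : ∀ {P : Set} (d : Dec P) z → ¬ P → pick d z ≈ ⌜ 1ℚ ⌝
pick-no d z ¬p = pick-⇔ d (no ¬p) z id id

pick-↑ : ∀ {P : Set} (d : Dec P) c s → c ↑ s ⊗ pick d c ≈ c ↑ (s ℕ.+ χ d)
pick-↑ (yes _) c s = ≈-trans (≈-sym (↑-suc c s)) (≈-reflexive (cong (c ↑_) (ℕₚ.+-comm 1 s)))
pick-↑ (no  _) c s = ≈-trans (solveᶜ 1 (λ z → z ⊠ conᶜ 1ℚ ≔ z) ≈-refl (c ↑ s)) (≈-reflexive (cong (c ↑_) (sym (ℕₚ.+-identityʳ s))))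

⇒-pick : ∀ {P : Set} (d : Dec P) {x L} → x ⇒ L → (λ n → pick d (x n)) ⇒ pick d L
⇒-pick (yes _) h = h
⇒-pick (no  _) h = ⇒-const ≈-refl

prod-⊗ : ∀ n f g → prod n f ⊗ prod n g ≈ prod n (λ k → f k ⊗ g k)
prod-⊗ zero    f g = ⊗-identityˡ ⌜ 1ℚ ⌝
prod-⊗ (suc n) f g = ≈-trans (solveᶜ 4 (λ a b c d → (a ⊠ b) ⊠ (c ⊠ d) ≔ (a ⊠ c) ⊠ (b ⊠ d)) ≈-refl (prod n f) (f n) (prod n g) (g n))
  (⊗-cong (prod-⊗ n f g) ≈-refl)

prod-reverse : ∀ n f → prod n f ≈ prod n (λ k → f (n ∸ suc k))
prod-reverse zero    f = ≈-refl
prod-reverse (suc n) f = ≈-trans (⊗-comm (prod n f) (f n)) (≈-trans (⊗-congˡ (prod-reverse n f)) (≈-sym (prod-head n (λ k → f (n ∸ k)))))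

∑-head : ∀ n f → ∑ (suc n) f ≡ f 0 ℕ.+ ∑ n (f ∘ suc)
∑-head n f = ∑-split 1 n f

∑-fold : ∀ n f → ∑ (suc (n ℕ.+ n)) f ≡ ∑ n (λ k → f k ℕ.+ f (n ℕ.+ n ∸ k)) ℕ.+ f n
∑-fold zero    f = refl
∑-fold (suc n) f rewrite ℕₚ.+-suc n n = begin
  ∑ (suc (suc (n ℕ.+ n))) f ℕ.+ f (suc (suc (n ℕ.+ n)))
    ≡⟨ cong (ℕ._+ f (suc (suc (n ℕ.+ n)))) (trans (∑-head (suc (n ℕ.+ n)) f) (cong (f 0 ℕ.+_) (∑-fold n (f ∘ suc)))) ⟩
  f 0 ℕ.+ (s ℕ.+ f (suc n)) ℕ.+ f (suc (suc (n ℕ.+ n)))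
    ≡⟨ solveⁿ 4 (λ a s b c → a ⊕ⁿ (s ⊕ⁿ b) ⊕ⁿ c ≔ⁿ (a ⊕ⁿ c) ⊕ⁿ s ⊕ⁿ b) refl (f 0) s (f (suc n)) (f (suc (suc (n ℕ.+ n)))) ⟩
  (f 0 ℕ.+ f (suc (suc (n ℕ.+ n)))) ℕ.+ s ℕ.+ f (suc n)
    ≡⟨ cong (ℕ._+ f (suc n)) (trans (cong ((f 0 ℕ.+ f (suc (suc (n ℕ.+ n)))) ℕ.+_) (∑-cong n λ k k<n → cong (λ j → f (suc k) ℕ.+ f j) (sym (ℕₚ.+-∸-assoc 1 (ℕₚ.≤-trans (ℕₚ.<⇒≤ k<n) (ℕₚ.m≤m+n n n))))))
         (sym (∑-head n (λ k → f k ℕ.+ f (suc (suc (n ℕ.+ n)) ∸ k))))) ⟩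
  ∑ (suc n) (λ k → f k ℕ.+ f (suc (suc (n ℕ.+ n)) ∸ k)) ℕ.+ f (suc n) ∎
  where
  open ≡-Reasoning
  s : ℕ
  s = ∑ n (λ k → f (suc k) ℕ.+ f (suc (n ℕ.+ n ∸ k)))

inv*fromℕ′ : ∀ m .{{_ : NonZero m}} → inv m * fromℕ m ≡ 1ℚ
inv*fromℕ′ (suc n) = inv*fromℕ n

e-1 : e ⌜ 1ℚ ⌝ ≈ ⊝ ⌜ 1ℚ ⌝
e-1 = ≈-trans (e-cong (⌜⌝-+ ½ ½)) (≈-trans (e-⊕ ⌜ ½ ⌝ ⌜ ½ ⌝) (≈-trans (⊗-cong e-½ e-½) ι²))

−1-even : ∀ s → (⊝ ⌜ 1ℚ ⌝) ↑ (2 ℕ.* s) ≈ ⌜ 1ℚ ⌝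
−1-even zero    = ↑-zero _
−1-even (suc s) = ≈-trans (≈-reflexive (cong ((⊝ ⌜ 1ℚ ⌝) ↑_) (ℕₚ.*-suc 2 s))) (≈-trans (≈-trans (↑-suc _ _) (⊗-cong (↑-suc _ _) ≈-refl))
  (≈-trans (⊗-cong (⊗-cong (−1-even s) ≈-refl) ≈-refl) (solveᶜ 0 (conᶜ 1ℚ ⊠ (⊟ conᶜ 1ℚ) ⊠ (⊟ conᶜ 1ℚ) ≔ conᶜ 1ℚ) ≈-refl)))

-- Here m = 2N = 4 (n + 1), and j ranges over the residues below N = K + 1 that are prime to m.
module Residues (n m : ℕ) .{{m≢0 : NonZero m}} (m≡ : m ≡ suc (suc (n ℕ.+ n)) ℕ.+ suc (suc (n ℕ.+ n))) where
  K N : ℕ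
  K = suc (n ℕ.+ n)
  N = suc K

  2∣N : 2 ∣ N
  2∣N = ∣ₚ.divides (suc n) (solveⁿ 1 (λ n → conⁿ 2 ⊕ⁿ (n ⊕ⁿ n) ≔ⁿ (conⁿ 1 ⊕ⁿ n) ⊗ⁿ conⁿ 2) refl n)

  N∣m : N ∣ m
  N∣m = ∣ₚ.divides 2 (trans m≡ (cong (N ℕ.+_) (sym (ℕₚ.+-identityʳ N))))

  -- N is even, so that being prime to N already means being prime to m = 2N. Modulo N the
  -- reflection and the shift of residues are immediate.
  lift : ∀ j → Coprime j N → Coprime j m
  lift j c = subst (Coprime j) (trans (cong (N ℕ.+_) (ℕₚ.+-identityʳ N)) (sym m≡))
    (coprime-* {j} {2} {N} (λ { (d∣j , d∣2) → c (d∣j , ∣ₚ.∣-trans d∣2 2∣N) }) c)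

  lower : ∀ j → Coprime j m → Coprime j N
  lower j c (d∣j , d∣N) = c (d∣j , ∣ₚ.∣-trans d∣N N∣m)

  reflect : ∀ i j → i ℕ.+ j ≡ N → gcd i m ≡ 1 → gcd j m ≡ 1
  reflect i j i+j≡N h = coprime⇒gcd≡1 (lift j λ { {d} (d∣j , d∣N) →
    lower i (gcd≡1⇒coprime {i} {m} h) (∣ₚ.∣m+n∣m⇒∣n (subst (d ∣_) (trans (sym i+j≡N) (ℕₚ.+-comm i j)) d∣N) d∣j , d∣N) })

  shift-cop : ∀ j → gcd j m ≡ 1 → gcd (N ℕ.+ j) m ≡ 1
  shift-cop j h = coprime⇒gcd≡1 (lift (N ℕ.+ j) (coprime-shift {j} {N} (lower j (gcd≡1⇒coprime {j} {m} h))))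

  unshift-cop : ∀ j → gcd (N ℕ.+ j) m ≡ 1 → gcd j m ≡ 1
  unshift-cop j h = coprime⇒gcd≡1 (lift j (coprime-unshift {j} {N} (lower (N ℕ.+ j) (gcd≡1⇒coprime {N ℕ.+ j} {m} h))))

  common : ∀ {d j} → ¬ d ≡ 1 → d ∣ j → d ∣ m → ¬ gcd j m ≡ 1
  common {d} {j} d≢1 d∣j d∣m h = d≢1 (gcd≡1⇒coprime {j} {m} h (d∣j , d∣m))

  2∣m : 2 ∣ m
  2∣m = ∣ₚ.∣-trans 2∣N N∣m

  not-N : ¬ gcd N m ≡ 1
  not-N = common {2} (λ ()) 2∣N 2∣m

  not-2N : ¬ gcd (N ℕ.+ N) m ≡ 1
  not-2N = common {2} (λ ()) (∣ₚ.∣m∣n⇒∣m+n 2∣N 2∣N) 2∣m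

  cop : ∀ j → Dec (gcd j m ≡ 1)
  cop j = coprime? j m

  S : (ℕ → ℂ) → ℂ
  S f = prod K (λ k → pick (cop (suc k)) (f (suc k)))

  S-cong : ∀ {f g} → (∀ j → j ℕ.≤ K → f j ≈ g j) → S f ≈ S g
  S-cong h = prod-cong K λ k k<K → pick-cong (cop (suc k)) (h (suc k) k<K)

  S-⊗ : ∀ f g → S f ⊗ S g ≈ S (λ j → f j ⊗ g j)
  S-⊗ f g = ≈-trans (prod-⊗ K _ _) (prod-cong K λ k _ → pick-⊗ (cop (suc k)) (f (suc k)) (g (suc k)))

  S-1 : S (λ _ → ⌜ 1ℚ ⌝) ≈ ⌜ 1ℚ ⌝
  S-1 = go K
    where
    go : ∀ n → prod n (λ k → pick (cop (suc k)) ⌜ 1ℚ ⌝) ≈ ⌜ 1ℚ ⌝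
    go zero    = ≈-refl
    go (suc n) = ≈-trans (⊗-cong (go n) (pick-1 (cop (suc n)))) (⊗-identityˡ ⌜ 1ℚ ⌝)

  N∸-+ : ∀ {j} → j ℕ.≤ K → j ℕ.+ (N ∸ j) ≡ N
  N∸-+ j≤K = ℕₚ.m+[n∸m]≡n (ℕₚ.m≤n⇒m≤1+n j≤K)

  S-reflect : ∀ f → S f ≈ S (λ j → f (N ∸ j))
  S-reflect f = ≈-trans (prod-reverse K _) (prod-cong K λ k k<K →
    ≈-trans (≈-reflexive (cong (λ j → pick (cop j) (f j)) (sym (ℕₚ.+-∸-assoc 1 k<K))))
      (pick-⇔ (cop (N ∸ suc k)) (cop (suc k)) (f (N ∸ suc k)) (reflect (N ∸ suc k) (suc k) (trans (ℕₚ.+-comm (N ∸ suc k) (suc k)) (N∸-+ k<K))) (reflect (suc k) (N ∸ suc k) (N∸-+ k<K))))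

  S-⇒ : ∀ {x : ℕ → ℕ → ℂ} {L} → (∀ j → x j ⇒ L j) → (λ n → S (λ j → x j n)) ⇒ S L
  S-⇒ {x} {L} h = go K
    where
    go : ∀ i → (λ n → prod i (λ k → pick (cop (suc k)) (x (suc k) n))) ⇒ prod i (λ k → pick (cop (suc k)) (L (suc k)))
    go zero    = ⇒-const ≈-refl
    go (suc i) = ⇒-⊗ (go i) (⇒-pick (cop (suc i)) (h (suc i)))

  S-swap : ∀ i (t : ℕ → ℕ → ℂ) → prod i (λ k → S (t k)) ≈ S (λ j → prod i (λ k → t k j))
  S-swap zero    t = ≈-sym S-1
  S-swap (suc i) t = ≈-trans (⊗-cong (S-swap i t) ≈-refl) (S-⊗ (λ j → prod i (λ k → t k j)) (t i))

  prod-const : ∀ i c → prod i (λ k → pick (cop (suc k)) c) ≈ c ↑ ∑ i (λ k → χ (cop (suc k)))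
  prod-const zero    c = ≈-sym (↑-zero c)
  prod-const (suc i) c = ≈-trans (⊗-cong (prod-const i c) ≈-refl) (pick-↑ (cop (suc i)) c _)

  h : ℕ
  h = ∑ K (λ k → χ (cop (suc k)))

  S-all : ∀ f → ∏ᵒ (coprimesUpTo m m) f ≈ S (λ j → f j ⊗ f (N ℕ.+ j))
  S-all f = begin
    ∏ᵒ (coprimesUpTo m m) f              ≈⟨ ∏-coprimesUpTo m m f ⟩
    prod m g                             ≈⟨ ≈-reflexive (cong (λ M → prod M g) m≡) ⟩
    prod (N ℕ.+ N) g                     ≈⟨ prod-+ N N g ⟩
    prod K g ⊗ g K ⊗ (prod K (λ k → g (N ℕ.+ k)) ⊗ g (N ℕ.+ K))
      -- The last indices of the two halves are N and 2N; both are even and drop out.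
      ≈⟨ ⊗-cong (⊗-congˡ (pick-no (cop N) (f N) not-N)) (⊗-cong (prod-cong K λ k _ → shifted k)
           (pick-no (cop (suc (N ℕ.+ K))) (f (suc (N ℕ.+ K))) (subst (λ j → ¬ gcd j m ≡ 1) (ℕₚ.+-suc N K) not-2N))) ⟩
    S f ⊗ ⌜ 1ℚ ⌝ ⊗ (S (λ j → f (N ℕ.+ j)) ⊗ ⌜ 1ℚ ⌝)
      ≈⟨ solveᶜ 2 (λ a b → a ⊠ conᶜ 1ℚ ⊠ (b ⊠ conᶜ 1ℚ) ≔ a ⊠ b) ≈-refl (S f) (S (λ j → f (N ℕ.+ j))) ⟩
    S f ⊗ S (λ j → f (N ℕ.+ j))          ≈⟨ S-⊗ f (λ j → f (N ℕ.+ j)) ⟩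
    S (λ j → f j ⊗ f (N ℕ.+ j))          ∎
    where
    open ≈-Reasoning
    g : ℕ → ℂ
    g k = pick (cop (suc k)) (f (suc k))
    shifted : ∀ k → g (N ℕ.+ k) ≈ pick (cop (suc k)) (f (N ℕ.+ suc k))
    shifted k = ≈-trans (≈-reflexive (cong (λ j → pick (cop j) (f j)) (sym (ℕₚ.+-suc N k))))
      (pick-⇔ (cop (N ℕ.+ suc k)) (cop (suc k)) (f (N ℕ.+ suc k)) (unshift-cop (suc k)) (shift-cop (suc k)))

  χ-no : ∀ j → ¬ gcd j m ≡ 1 → χ (cop j) ≡ 0
  χ-no j ¬c = χ-cong (cop j) (no ¬c) id id

  φ≡2h : φ m ≡ h ℕ.+ h
  φ≡2h = begin
    φ m                        ≡⟨ φ-∑ m ⟩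
    ∑ m g                      ≡⟨ cong (λ M → ∑ M g) m≡ ⟩
    ∑ (N ℕ.+ N) g              ≡⟨ ∑-split N N g ⟩
    (h ℕ.+ g K) ℕ.+ (∑ K (λ k → g (N ℕ.+ k)) ℕ.+ g (N ℕ.+ K))
      ≡⟨ cong₂ ℕ._+_ (cong (h ℕ.+_) (χ-no N not-N)) (cong₂ ℕ._+_ (∑-cong K λ k _ → shifted k) (χ-no (suc (N ℕ.+ K)) (subst (λ j → ¬ gcd j m ≡ 1) (ℕₚ.+-suc N K) not-2N))) ⟩
    (h ℕ.+ 0) ℕ.+ (h ℕ.+ 0)    ≡⟨ cong₂ ℕ._+_ (ℕₚ.+-identityʳ h) (ℕₚ.+-identityʳ h) ⟩
    h ℕ.+ h                    ∎
    where
    open ≡-Reasoning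
    g : ℕ → ℕ
    g k = χ (cop (suc k))
    shifted : ∀ k → g (N ℕ.+ k) ≡ g k
    shifted k = trans (cong (λ j → χ (cop j)) (sym (ℕₚ.+-suc N k))) (χ-cong (cop (N ℕ.+ suc k)) (cop (suc k)) (unshift-cop (suc k)) (shift-cop (suc k)))

  q : ℕ → ℚ
  q j = fromℕ (2 ℕ.* j) * inv m

  ω : ℕ → ℂ
  ω j = e ⌜ q j ⌝

  q-+ : ∀ i j → q i + q j ≡ q (i ℕ.+ j)
  q-+ i j = trans (sym (*-distribʳ-+ (inv m) (fromℕ (2 ℕ.* i)) (fromℕ (2 ℕ.* j))))
    (cong (_* inv m) (trans (sym (fromℕ-+ (2 ℕ.* i) (2 ℕ.* j))) (cong fromℕ (sym (ℕₚ.*-distribˡ-+ 2 i j)))))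

  q-N : q N ≡ 1ℚ
  q-N = trans (cong (λ M → fromℕ M * inv m) (trans (cong (N ℕ.+_) (ℕₚ.+-identityʳ N)) (sym m≡))) (trans (*-comm (fromℕ m) (inv m)) (inv*fromℕ′ m))

  ω-+ : ∀ i j → ω (i ℕ.+ j) ≈ ω i ⊗ ω j
  ω-+ i j = ≈-trans (e-cong (≈-trans (⌜⌝-cong (sym (q-+ i j))) (⌜⌝-+ (q i) (q j)))) (e-⊕ ⌜ q i ⌝ ⌜ q j ⌝)

  ω-N : ω N ≈ ⊝ ⌜ 1ℚ ⌝
  ω-N = ≈-trans (e-cong (⌜⌝-cong q-N)) e-1

  ω-reflect : ∀ i j → i ℕ.+ j ≡ N → ω i ⊗ ω j ≈ ⊝ ⌜ 1ℚ ⌝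
  ω-reflect i j i+j≡N = ≈-trans (≈-sym (ω-+ i j)) (≈-trans (≈-reflexive (cong ω i+j≡N)) ω-N)

  -- After a reflection of one of the two factors ω j, every factor of the product is -ω j · ω (N -
  -- j) = 1.
  sq-S-ω : S (λ j → ⊝ sq (ω j)) ≈ ⌜ 1ℚ ⌝
  sq-S-ω = begin
    S (λ j → ⊝ sq (ω j))
      ≈⟨ S-cong (λ j _ → solveᶜ 1 (λ w → ⊟ (w ⊠ w) ≔ (⊟ conᶜ 1ℚ) ⊠ w ⊠ w) ≈-refl (ω j)) ⟩
    S (λ j → (⊝ ⌜ 1ℚ ⌝) ⊗ ω j ⊗ ω j)            ≈⟨ ≈-sym (S-⊗ (λ j → (⊝ ⌜ 1ℚ ⌝) ⊗ ω j) ω) ⟩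
    S (λ j → (⊝ ⌜ 1ℚ ⌝) ⊗ ω j) ⊗ S ω            ≈⟨ ⊗-congˡ (S-reflect ω) ⟩
    S (λ j → (⊝ ⌜ 1ℚ ⌝) ⊗ ω j) ⊗ S (λ j → ω (N ∸ j))  ≈⟨ S-⊗ (λ j → (⊝ ⌜ 1ℚ ⌝) ⊗ ω j) (λ j → ω (N ∸ j)) ⟩
    S (λ j → (⊝ ⌜ 1ℚ ⌝) ⊗ ω j ⊗ ω (N ∸ j))
      ≈⟨ S-cong (λ j j≤K → ≈-trans (⊗-assoc _ _ _) (≈-trans (⊗-congˡ (ω-reflect j (N ∸ j) (N∸-+ j≤K))) (solveᶜ 0 ((⊟ conᶜ 1ℚ) ⊠ (⊟ conᶜ 1ℚ) ≔ conᶜ 1ℚ) ≈-refl))) ⟩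
    S (λ _ → ⌜ 1ℚ ⌝)                            ≈⟨ S-1 ⟩
    ⌜ 1ℚ ⌝                                      ∎
    where open ≈-Reasoning

  -- The pair j, N + j gives y² - (ω j)². After reflection, with a = ω j and b = ω (N - j), the
  -- constant -b² is split off and 1/b = -a turns (y/b)² into (ya)²; the constants multiply to 1 by
  -- `sq-S-ω`.
  cyclotomic : ∀ y → S (λ j → (y ⊖ ω j) ⊗ (y ⊖ ω (N ℕ.+ j))) ≈ S (λ j → ⌜ 1ℚ ⌝ ⊖ sq (y ⊗ ω j))
  cyclotomic y = begin
    S (λ j → (y ⊖ ω j) ⊗ (y ⊖ ω (N ℕ.+ j)))
      ≈⟨ S-cong (λ j _ → ≈-trans (⊗-congˡ (⊖-congˡ (≈-trans (ω-+ N j) (⊗-cong ω-N ≈-refl))))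
           (solveᶜ 2 (λ y w → (y ⊟ w) ⊠ (y ⊟ (⊟ conᶜ 1ℚ) ⊠ w) ≔ y ⊠ y ⊟ w ⊠ w) ≈-refl y (ω j))) ⟩
    S (λ j → sq y ⊖ sq (ω j))                          ≈⟨ S-reflect (λ j → sq y ⊖ sq (ω j)) ⟩
    S (λ j → sq y ⊖ sq (ω (N ∸ j)))                    ≈⟨ S-cong (λ j j≤K → factor-out (ω j) (ω (N ∸ j)) (ω-reflect j (N ∸ j) (N∸-+ j≤K))) ⟩
    S (λ j → (⊝ sq (ω (N ∸ j))) ⊗ (⌜ 1ℚ ⌝ ⊖ sq (y ⊗ ω j)))   ≈⟨ ≈-sym (S-⊗ (λ j → ⊝ sq (ω (N ∸ j))) (λ j → ⌜ 1ℚ ⌝ ⊖ sq (y ⊗ ω j))) ⟩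
    S (λ j → ⊝ sq (ω (N ∸ j))) ⊗ S (λ j → ⌜ 1ℚ ⌝ ⊖ sq (y ⊗ ω j))
      ≈⟨ ⊗-cong (≈-trans (≈-sym (S-reflect (λ j → ⊝ sq (ω j)))) sq-S-ω) ≈-refl ⟩
    ⌜ 1ℚ ⌝ ⊗ S (λ j → ⌜ 1ℚ ⌝ ⊖ sq (y ⊗ ω j))           ≈⟨ ⊗-identityˡ _ ⟩
    S (λ j → ⌜ 1ℚ ⌝ ⊖ sq (y ⊗ ω j))                    ∎
    where
    open ≈-Reasoning
    factor-out : ∀ a b → a ⊗ b ≈ ⊝ ⌜ 1ℚ ⌝ → sq y ⊖ sq b ≈ (⊝ sq b) ⊗ (⌜ 1ℚ ⌝ ⊖ sq (y ⊗ a))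
    factor-out a b ab = ≈-sym (begin
      (⊝ sq b) ⊗ (⌜ 1ℚ ⌝ ⊖ sq (y ⊗ a))
        ≈⟨ solveᶜ 3 (λ y a b → (⊟ (b ⊠ b)) ⊠ (conᶜ 1ℚ ⊟ y ⊠ a ⊠ (y ⊠ a)) ≔ y ⊠ y ⊠ ((a ⊠ b) ⊠ (a ⊠ b)) ⊟ b ⊠ b) ≈-refl y a b ⟩
      sq y ⊗ sq (a ⊗ b) ⊖ sq b
        ≈⟨ ⊕-cong (≈-trans (⊗-congˡ (sq-cong ab)) (solveᶜ 1 (λ s → s ⊠ ((⊟ conᶜ 1ℚ) ⊠ (⊟ conᶜ 1ℚ)) ≔ s) ≈-refl (sq y))) ≈-refl ⟩
      sq y ⊖ sq b ∎)

-- The root of index N/2 is absent for m > 4, and the remaining ones pair off to products −1.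
δ≈S-ω : ∀ n m .{{m≢0 : NonZero m}} m≡ → δ m ≈ Residues.S n m m≡ (Residues.ω n m m≡)
δ≈S-ω zero m m≡ = ≈-trans (≈-trans (≈-reflexive (cong δ m≡)) δ-4) (≈-sym (≈-trans
    (⊗-congˡ (pick-yes (cop 1) (ω 1) (coprime⇒gcd≡1 {1} {m} λ { (d∣1 , _) → ∣ₚ.∣1⇒≡1 d∣1 })))
    (≈-trans (⊗-identityˡ (ω 1)) (≈-trans (e-cong (⌜⌝-cong q-1)) e-½))))
  where
  open Residues zero m m≡
  -- For m = 4 the middle residue 1 is prime to m and is the only one; its root is i.
  q-1 : q 1 ≡ ½
  q-1 = trans (solve 1 (λ q → q := con ½ :* (q :+ q)) refl (q 1)) (trans (cong (½ *_) (trans (q-+ 1 1) q-N)) (*-identityʳ ½))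
δ≈S-ω n@(suc _) m m≡ = ≈-trans (δ-value (δ-cases m m≢4)) (≈-sym S-value)
  where
  open Residues n m m≡
  m≡4n : m ≡ 4 ℕ.* suc n
  m≡4n = trans m≡ (solveⁿ 1 (λ n → (conⁿ 2 ⊕ⁿ (n ⊕ⁿ n)) ⊕ⁿ (conⁿ 2 ⊕ⁿ (n ⊕ⁿ n)) ≔ⁿ conⁿ 4 ⊗ⁿ (conⁿ 1 ⊕ⁿ n)) refl n)
  m≢4 : ¬ m ≡ 4
  m≢4 e = contradiction (ℕₚ.*-cancelˡ-≡ (suc n) 1 4 (trans (sym m≡4n) e)) λ ()
  -- The number of pairs. As φ m = 4c, the sign (-1)ᶜ is read off from φ m modulo 8.
  c : ℕ
  c = ∑ n (λ k → χ (cop (suc k)))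
  not-middle : ¬ gcd (suc n) m ≡ 1
  not-middle = common {suc n} (λ ()) ∣ₚ.∣-refl (∣ₚ.divides 4 m≡4n)
  partner : ∀ k → k ℕ.< n → suc k ℕ.+ suc (n ℕ.+ n ∸ k) ≡ N
  partner k k<n = cong suc (trans (ℕₚ.+-suc k _) (cong suc (ℕₚ.m+[n∸m]≡n (ℕₚ.≤-trans (ℕₚ.<⇒≤ k<n) (ℕₚ.m≤m+n n n)))))
  S-value : S ω ≈ (⊝ ⌜ 1ℚ ⌝) ↑ c
  S-value = begin
    prod (suc (n ℕ.+ n)) g                                  ≈⟨ prod-fold n g ⟩
    prod n (λ k → g k ⊗ g (n ℕ.+ n ∸ k)) ⊗ g n              ≈⟨ ⊗-cong (prod-cong n pair) (pick-no (cop (suc n)) (ω (suc n)) not-middle) ⟩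
    prod n (λ k → pick (cop (suc k)) (⊝ ⌜ 1ℚ ⌝)) ⊗ ⌜ 1ℚ ⌝   ≈⟨ solveᶜ 1 (λ z → z ⊠ conᶜ 1ℚ ≔ z) ≈-refl _ ⟩
    prod n (λ k → pick (cop (suc k)) (⊝ ⌜ 1ℚ ⌝))            ≈⟨ prod-const n (⊝ ⌜ 1ℚ ⌝) ⟩
    (⊝ ⌜ 1ℚ ⌝) ↑ c                                          ∎
    where
    open ≈-Reasoning
    g : ℕ → ℂ
    g k = pick (cop (suc k)) (ω (suc k))
    pair : ∀ k → k ℕ.< n → g k ⊗ g (n ℕ.+ n ∸ k) ≈ pick (cop (suc k)) (⊝ ⌜ 1ℚ ⌝)
    pair k k<n = ≈-trans (⊗-congˡ (pick-⇔ (cop (suc j)) (cop (suc k)) (ω (suc j)) (reflect (suc j) (suc k) (trans (ℕₚ.+-comm (suc j) (suc k)) (partner k k<n))) (reflect (suc k) (suc j) (partner k k<n))))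
      (≈-trans (pick-⊗ (cop (suc k)) (ω (suc k)) (ω (suc j))) (pick-cong (cop (suc k)) (ω-reflect (suc k) (suc j) (partner k k<n))))
      where
      j : ℕ
      j = n ℕ.+ n ∸ k
  h≡2c : h ≡ c ℕ.+ c
  h≡2c = begin
    ∑ (suc (n ℕ.+ n)) g                                 ≡⟨ ∑-fold n g ⟩
    ∑ n (λ k → g k ℕ.+ g (n ℕ.+ n ∸ k)) ℕ.+ g n         ≡⟨ cong₂ ℕ._+_ (∑-cong n λ k k<n → cong (g k ℕ.+_) (χ-cong (cop (suc (n ℕ.+ n ∸ k))) (cop (suc k)) (reflect (suc (n ℕ.+ n ∸ k)) (suc k) (trans (ℕₚ.+-comm (suc (n ℕ.+ n ∸ k)) (suc k)) (partner k k<n))) (reflect (suc k) (suc (n ℕ.+ n ∸ k)) (partner k k<n)))) (χ-no (suc n) not-middle) ⟩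
    ∑ n (λ k → g k ℕ.+ g k) ℕ.+ 0                       ≡⟨ ℕₚ.+-identityʳ _ ⟩
    ∑ n (λ k → g k ℕ.+ g k)                             ≡⟨ ∑-distrib n g g ⟩
    c ℕ.+ c                                             ∎
    where
    open ≡-Reasoning
    g : ℕ → ℕ
    g k = χ (cop (suc k))
  φ≡4c : φ m ≡ 4 ℕ.* c
  φ≡4c = trans φ≡2h (trans (cong₂ ℕ._+_ h≡2c h≡2c) (solveⁿ 1 (λ c → c ⊕ⁿ c ⊕ⁿ (c ⊕ⁿ c) ≔ⁿ conⁿ 4 ⊗ⁿ c) refl c))
  δ-value : (Exceptional m × δ m ≈ ⊝ ⌜ 1ℚ ⌝) ⊎ (¬ Exceptional m × δ m ≈ ⌜ 1ℚ ⌝) → δ m ≈ (⊝ ⌜ 1ℚ ⌝) ↑ c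
  δ-value (inj₁ (exc , eq)) = ≈-trans eq (≈-sym (≈-trans (≈-reflexive (cong ((⊝ ⌜ 1ℚ ⌝) ↑_) c≡)) (≈-trans (↑-suc _ _) (≈-trans (⊗-cong (−1-even s) ≈-refl) (⊗-identityˡ _)))))
    where
    s : ℕ
    s = proj₁ (φ-exceptional exc)
    c≡ : c ≡ suc (2 ℕ.* s)
    c≡ = ℕₚ.*-cancelˡ-≡ c (suc (2 ℕ.* s)) 4 (trans (sym φ≡4c) (proj₂ (φ-exceptional exc)))
  δ-value (inj₂ (¬exc , eq)) = ≈-trans eq (≈-sym (even (subst (8 ∣_) φ≡4c (subst (λ m → ¬ Exceptional m → 8 ∣ φ m) (sym m≡4n) (8∣φ (suc n) (λ ())) ¬exc))))
    where
    even : 8 ∣ 4 ℕ.* c → (⊝ ⌜ 1ℚ ⌝) ↑ c ≈ ⌜ 1ℚ ⌝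
    even (∣ₚ.divides s eq) = ≈-trans (≈-reflexive (cong ((⊝ ⌜ 1ℚ ⌝) ↑_) c≡)) (−1-even s)
      where
      c≡ : c ≡ 2 ℕ.* s
      c≡ = ℕₚ.*-cancelˡ-≡ c (2 ℕ.* s) 4 (trans eq (solveⁿ 1 (λ s → s ⊗ⁿ conⁿ 8 ≔ⁿ conⁿ 4 ⊗ⁿ (conⁿ 2 ⊗ⁿ s)) refl s))

-- Assembly of the formula

↑-cong : ∀ {z w} n → z ≈ w → z ↑ n ≈ w ↑ n
↑-cong zero    h = ≈-trans (↑-zero _) (≈-sym (↑-zero _))
↑-cong (suc n) h = ≈-trans (↑-suc _ n) (≈-trans (⊗-cong (↑-cong n h) h) (≈-sym (↑-suc _ n)))

double/2 : ∀ n → (n ℕ.+ n) / 2 ≡ n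
double/2 n = trans (cong (_/ 2) (solveⁿ 1 (λ n → n ⊕ⁿ n ≔ⁿ n ⊗ⁿ conⁿ 2) refl n)) (DivMod.m*n/n≡m n 2)

∏-cong : ∀ js f g → (∀ j → f j ≈ g j) → ∏ᵒ js f ≈ ∏ᵒ js g
∏-cong []       f g h = ≈-trans (∏-[] f) (≈-sym (∏-[] g))
∏-cong (j ∷ js) f g h = ≈-trans (∏-∷ j js f) (≈-trans (⊗-cong (h j) (∏-cong js f g h)) (≈-sym (∏-∷ j js g)))

opaque
  unfolding ∏ᵒ

  Φ-≡ : ∀ m .{{_ : NonZero m}} x → Φ m x ≡ ∏ᵒ (coprimesUpTo m m) (λ j → x -ᶜ rootOfUnity m j)
  Φ-≡ m x = refl

module Assembly (n m : ℕ) .{{m≢0 : NonZero m}} (m≡ : m ≡ suc (suc (n ℕ.+ n)) ℕ.+ suc (suc (n ℕ.+ n))) (z : ℂ) (z#0 : z #0) where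
  open Residues n m m≡

  p p′ : ℂ
  p  = Π ⊗ z
  p′ = Π⁻¹ ⊗ recipᶜ z z#0

  p⊗p′ : p ⊗ p′ ≈ ⌜ 1ℚ ⌝
  p⊗p′ = ≈-trans (solveᶜ 4 (λ a b c d → a ⊠ b ⊠ (c ⊠ d) ≔ (a ⊠ c) ⊠ (b ⊠ d)) ≈-refl Π z Π⁻¹ (recipᶜ z z#0))
    (≈-trans (⊗-cong Π⊗Π⁻¹ (recipᶜ-inverse z z#0)) (⊗-identityˡ ⌜ 1ℚ ⌝))

  -- v j is the inverse of π w j, by 1 / ω j = -ω (N - j), and -½ ι is 1 / 2i. Hence u j · D (w j)
  -- is sin (π w j) / (π w j).
  w v u : ℕ → ℂ
  w j = z ⊗ ω j
  v j = p′ ⊗ (⊝ ω (N ∸ j))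
  u j = v j ⊗ (⌜ -½ ⌝ ⊗ ι)

  u⊗X : ∀ j → j ℕ.≤ K → ∀ k → u j ⊗ Tannery.X (w j) k ≈ Tannery.P (w j) k
  u⊗X j j≤K k = begin
    u j ⊗ Tannery.X (w j) k
      ≈⟨ solveᶜ 7 (λ p′ a i π z b P → p′ ⊠ (⊟ a) ⊠ (conᶜ -½ ⊠ i) ⊠ (conᶜ 2ℚ ⊠ (i ⊠ π ⊠ (z ⊠ b)) ⊠ P) ≔ (i ⊠ i) ⊠ (π ⊠ z ⊠ p′) ⊠ (b ⊠ a) ⊠ P) ≈-refl
           p′ (ω (N ∸ j)) ι Π z (ω j) (Tannery.P (w j) k) ⟩
    ι ⊗ ι ⊗ (p ⊗ p′) ⊗ (ω j ⊗ ω (N ∸ j)) ⊗ Tannery.P (w j) k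
      ≈⟨ ⊗-cong (⊗-cong (⊗-cong ι² p⊗p′) (ω-reflect j (N ∸ j) (N∸-+ j≤K))) ≈-refl ⟩
    (⊝ ⌜ 1ℚ ⌝) ⊗ ⌜ 1ℚ ⌝ ⊗ (⊝ ⌜ 1ℚ ⌝) ⊗ Tannery.P (w j) k
      ≈⟨ solveᶜ 1 (λ P → (⊟ conᶜ 1ℚ) ⊠ conᶜ 1ℚ ⊠ (⊟ conᶜ 1ℚ) ⊠ P ≔ P) ≈-refl (Tannery.P (w j) k) ⟩
    Tannery.P (w j) k ∎
    where open ≈-Reasoning

  limit : (λ k → S (λ j → Tannery.P (w j) k)) ⇒ S (λ j → u j ⊗ D (w j))
  limit = ⇒-resp 0 (λ k _ → S-cong (λ j j≤K → u⊗X j j≤K k)) ≈-refl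
    (S-⇒ {λ j k → u j ⊗ Tannery.X (w j) k} {λ j → u j ⊗ D (w j)} λ j → ⇒-⊗ (⇒-const (≈-refl {u j})) (Tannery.X-⇒ (w j)))

  Φ-≈ : ∀ x y → x ≈ y → Φ m x ≈ S (λ j → ⌜ 1ℚ ⌝ ⊖ sq (y ⊗ ω j))
  Φ-≈ x y h = ≈-trans (≈-reflexive (Φ-≡ m x)) (≈-trans (S-all (λ j → x -ᶜ rootOfUnity m j))
    (≈-trans (S-cong (λ j _ → ⊗-cong (factor-≈ j) (factor-≈ (N ℕ.+ j)))) (cyclotomic y)))
    where
    factor-≈ : ∀ j → x -ᶜ rootOfUnity m j ≈ y ⊖ ω j
    factor-≈ j = ≈-trans (-ᶜ-≈ x (rootOfUnity m j)) (⊕-cong h (⊝-cong (root-≈ m j)))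

  partial-≈ : ∀ i → partialProduct (λ k → Φ m (inv k • z)) i ≈ S (λ j → Tannery.P (w j) i)
  partial-≈ i = ≈-trans (≈-reflexive (partialProduct-≡ (λ k → Φ m (inv k • z)) i)) (≈-trans (partialProduct-prod (λ k → Φ m (inv k • z)) i)
    (≈-trans (prod-cong i λ k _ → Φ-≈ (inv (suc k) • z) (⌜ inv (suc k) ⌝ ⊗ z) (≈-trans (•-≈ (inv (suc k)) z) (⊙-≈ (inv (suc k)) z)))
      (≈-trans (S-swap i (λ k j → ⌜ 1ℚ ⌝ ⊖ sq (⌜ inv (suc k) ⌝ ⊗ z ⊗ ω j)))
        (S-cong {λ j → prod i (λ k → ⌜ 1ℚ ⌝ ⊖ sq (⌜ inv (suc k) ⌝ ⊗ z ⊗ ω j))} {λ j → Tannery.P (w j) i} λ j _ →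
          prod-cong i λ k _ → ⊖-congˡ (sq-cong (⊗-assoc ⌜ inv (suc k) ⌝ z (ω j)))))))

  sin-factor : ∀ j → sin (πᶜ *ᶜ z *ᶜ rootOfUnity m j) ≈ ⌜ -½ ⌝ ⊗ ι ⊗ D (w j)
  sin-factor j = sin-≈ (πᶜ *ᶜ z *ᶜ rootOfUnity m j) (≈-trans (*ᶜ-≈ (πᶜ *ᶜ z) (rootOfUnity m j))
    (≈-trans (⊗-cong (≈-trans (*ᶜ-≈ πᶜ z) (⊗-cong πᶜ-≈ ≈-refl)) (root-≈ m j)) (⊗-assoc Π z (ω j))))

  m/2∸1 : m / 2 ∸ 1 ≡ K
  m/2∸1 = cong (_∸ 1) (trans (cong (_/ 2) m≡) (double/2 N))

  ∏-sin : ∏ (coprimesUpTo (m / 2 ∸ 1) m) (λ j → sin (πᶜ *ᶜ z *ᶜ rootOfUnity m j)) ≈ S (λ j → ⌜ -½ ⌝ ⊗ ι ⊗ D (w j))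
  ∏-sin = ≈-trans (≈-reflexive (∏-≡ (coprimesUpTo (m / 2 ∸ 1) m) (λ j → sin (πᶜ *ᶜ z *ᶜ rootOfUnity m j))))
    (≈-trans (∏-cong (coprimesUpTo (m / 2 ∸ 1) m) (λ j → sin (πᶜ *ᶜ z *ᶜ rootOfUnity m j)) (λ j → ⌜ -½ ⌝ ⊗ ι ⊗ D (w j)) sin-factor)
      (≈-trans (≈-reflexive (cong (λ i → ∏ᵒ (coprimesUpTo i m) (λ j → ⌜ -½ ⌝ ⊗ ι ⊗ D (w j))) m/2∸1))
        (∏-coprimesUpTo K m (λ j → ⌜ -½ ⌝ ⊗ ι ⊗ D (w j)))))

  power : (-ᶜ (πᶜ *ᶜ z)) ^ᶜ (φ m / 2) ≈ S (λ _ → ⊝ p)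
  power = ≈-trans (^ᶜ-≈ (-ᶜ (πᶜ *ᶜ z)) (φ m / 2)) (≈-trans (↑-cong (φ m / 2) (≈-trans (negᶜ-≈ (πᶜ *ᶜ z)) (⊝-cong (≈-trans (*ᶜ-≈ πᶜ z) (⊗-cong πᶜ-≈ ≈-refl)))))
    (≈-trans (≈-reflexive (cong ((⊝ p) ↑_) (trans (cong (_/ 2) φ≡2h) (double/2 h)))) (≈-sym (prod-const K (⊝ p)))))

  -- v j · (-p) = ω (N - j): the sign that inverting ω j costs is absorbed by -πz, and by reflection
  -- the product of these roots is again `S ω`.
  quotient : ∀ d r → d ≈ S ω → S (λ _ → ⊝ p) ⊗ r ≈ ⌜ 1ℚ ⌝ → S v ≈ d ⊗ r
  quotient d r hd hr = begin
    S v                              ≈⟨ solveᶜ 1 (λ s → s ≔ s ⊠ conᶜ 1ℚ) ≈-refl (S v) ⟩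
    S v ⊗ ⌜ 1ℚ ⌝                     ≈⟨ ⊗-congˡ (≈-sym hr) ⟩
    S v ⊗ (S (λ _ → ⊝ p) ⊗ r)        ≈⟨ ≈-sym (⊗-assoc (S v) (S (λ _ → ⊝ p)) r) ⟩
    S v ⊗ S (λ _ → ⊝ p) ⊗ r          ≈⟨ ⊗-cong (S-⊗ v (λ _ → ⊝ p)) ≈-refl ⟩
    S (λ j → v j ⊗ (⊝ p)) ⊗ r
      ≈⟨ ⊗-cong (S-cong λ j _ → ≈-trans (solveᶜ 3 (λ p p′ a → p′ ⊠ (⊟ a) ⊠ (⊟ p) ≔ (p ⊠ p′) ⊠ a) ≈-refl p p′ (ω (N ∸ j))) (≈-trans (⊗-cong p⊗p′ ≈-refl) (⊗-identityˡ (ω (N ∸ j))))) ≈-refl ⟩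
    S (λ j → ω (N ∸ j)) ⊗ r          ≈⟨ ⊗-cong (≈-trans (≈-sym (S-reflect ω)) (≈-sym hd)) ≈-refl ⟩
    d ⊗ r                            ∎
    where open ≈-Reasoning

  value : ∀ d W W#0 Z → d ≈ S ω → W ≈ S (λ _ → ⊝ p) → Z ≈ S (λ j → ⌜ -½ ⌝ ⊗ ι ⊗ D (w j)) →
          S (λ j → u j ⊗ D (w j)) ≈ (d ÷ᶜ W [ W#0 ]) *ᶜ Z
  value d W W#0 Z hd hW hZ = ≈-sym (≈-trans (*ᶜ-≈ (d ÷ᶜ W [ W#0 ]) Z)
    (≈-trans (⊗-cong (≈-trans (÷ᶜ-≈ d W W#0) (≈-sym (quotient d (recipᶜ W W#0) hd (≈-trans (⊗-cong (≈-sym hW) ≈-refl) (recipᶜ-inverse W W#0))))) hZ)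
      (≈-trans (S-⊗ v (λ j → ⌜ -½ ⌝ ⊗ ι ⊗ D (w j))) (S-cong λ j _ → ≈-sym (⊗-assoc (v j) (⌜ -½ ⌝ ⊗ ι) (D (w j)))))))

  infinite-product : ∀ W#0 → InfiniteProduct (λ k → Φ m (inv k • z))
    ((δ m ÷ᶜ (-ᶜ (πᶜ *ᶜ z)) ^ᶜ (φ m / 2) [ W#0 ]) *ᶜ ∏ (coprimesUpTo (m / 2 ∸ 1) m) (λ j → sin (πᶜ *ᶜ z *ᶜ rootOfUnity m j)))
  infinite-product W#0 = ⇒-⟶ {partialProduct (λ k → Φ m (inv k • z))} (⇒-resp 0 (λ i _ → ≈-sym (partial-≈ i))
    (value (δ m) ((-ᶜ (πᶜ *ᶜ z)) ^ᶜ (φ m / 2)) W#0 (∏ (coprimesUpTo (m / 2 ∸ 1) m) (λ j → sin (πᶜ *ᶜ z *ᶜ rootOfUnity m j))) (δ≈S-ω n m m≡) power ∏-sin) limit)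

corollary9 : (m : ℕ) .{{_ : NonZero m}} → 4 ∣ m → (z : ℂ) (z#0 : z #0) →
    InfiniteProduct (λ k → Φ m (inv k • z))
    ((δ m ÷ᶜ (-ᶜ (πᶜ *ᶜ z)) ^ᶜ (φ m / 2)
    [ ^#0 {z = -ᶜ (πᶜ *ᶜ z)} (φ m / 2) (neg#0 {πᶜ *ᶜ z} (*#0 {πᶜ} {z} π#0 z#0)) ])
    *ᶜ ∏ (coprimesUpTo (m / 2 ∸ 1) m) (λ j → sin (πᶜ *ᶜ z *ᶜ rootOfUnity m j)))
corollary9 m (∣ₚ.divides zero    m≡) z z#0 = contradiction m≡ (ℕ.≢-nonZero⁻¹ m)
corollary9 m (∣ₚ.divides (suc n) m≡) z z#0 =
  Assembly.infinite-product n m (trans m≡ (solveⁿ 1 (λ n → (conⁿ 1 ⊕ⁿ n) ⊗ⁿ conⁿ 4 ≔ⁿ (conⁿ 2 ⊕ⁿ (n ⊕ⁿ n)) ⊕ⁿ (conⁿ 2 ⊕ⁿ (n ⊕ⁿ n))) refl n)) z z#0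
    (^#0 {z = -ᶜ (πᶜ *ᶜ z)} (φ m / 2) (neg#0 {πᶜ *ᶜ z} (*#0 {πᶜ} {z} π#0 z#0)))
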